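{- Let $F(q)=\dfrac{\prod_{i=1}^{u} f_{\alpha_i}^{r_i}}{\prod_{i=1}^{t} f_{\gamma_i}^{s_i}}=\sum_{n\ge 0}a_nq^n$ be an eta-quotient, where $f_j=f_j(q)=\prod_{i\ge 1}(1-q^{ji})$, $u,t\ge 0$ are integers, $\alpha_1,\dots,\alpha_u$ are distinct positive integers, $\gamma_1,\dots,\gamma_t$ are distinct positive integers, and $r_i,s_i$ are positive integers. Let $a\ge 1$ and $b$ be integers, and for $x>0$ let $g_{a,b}(x)$ denote the number of integers $n$ with $0\le n\le x$ and $n\equiv b \pmod a$ such that $a_n$ is even. Then $$\lim_{x\to\infty}\frac{g_{a,b}(x)}{\sqrt{x}}=\infty.$$
   Context: Here the eta-quotient is considered as a formal power series in $q$ with integer coefficients (the usual prefactor $q^{(1/24)(\sum\alpha_i r_i-\sum\gamma_i s_i)}$ is omitted). -}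

module Defs where

open import Data.Nat as ℕ using (ℕ; zero; suc; _≟_; _∸_)
open import Data.Nat.Divisibility as ℕD using ()
open import Data.Integer as ℤ using (ℤ; +_; _*_; _+_; _-_; ∣_∣)
open import Data.Fin as Fin using (Fin)
open import Data.Bool using (Bool; true; false; _∧_; if_then_else_)
open import Data.List using (List; filter; length; upTo)
open import Relation.Nullary using (does)
open import Relation.Nullary.Decidable using (_×-dec_)

Series : Set
Series = ℕ → ℤ

sumTo : ℕ → (ℕ → ℤ) → ℤ
sumTo zero h = h 0
sumTo (suc n) h = sumTo n h + h (suc n)

_⊛_ : Series → Series → Series
(A ⊛ B) n = sumTo n (λ k → A k * B (n ∸ k))

infixl 7 _⊛_

δ : ℕ → ℕ → ℤ
δ a b = if does (a ≟ b) then + 1 else + 0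

one : Series
one n = δ n 0

oneMinus : ℕ → Series
oneMinus m n = δ n 0 - δ n m

-- 1/(1 - q^m) = Σ_k q^{mk}   (used with m ≥ 1)
geom : ℕ → Series
geom m n = if does (m ℕD.∣? n) then + 1 else + 0

prodUpTo : ℕ → (ℕ → Series) → Series
prodUpTo zero P = one
prodUpTo (suc k) P = prodUpTo k P ⊛ P (suc k)

-- f_j = ∏_{i≥1} (1 - q^{ji}); for j ≥ 1 the coefficient of q^n only
-- depends on the factors with i ≤ n.
f : ℕ → Series
f j n = prodUpTo n (λ i → oneMinus (j ℕ.* i)) n

finv : ℕ → Series
finv j n = prodUpTo n (λ i → geom (j ℕ.* i)) n

pow : Series → ℕ → Series
pow S zero = one
pow S (suc r) = pow S r ⊛ S

prodFin : (k : ℕ) → (Fin k → Series) → Series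
prodFin zero P = one
prodFin (suc k) P = P Fin.zero ⊛ prodFin k (λ i → P (Fin.suc i))

etaQuotient : (u : ℕ) → (Fin u → ℕ) → (Fin u → ℕ)
            → (t : ℕ) → (Fin t → ℕ) → (Fin t → ℕ) → Series
etaQuotient u α r t γ s =
  prodFin u (λ i → pow (f (α i)) (r i)) ⊛ prodFin t (λ i → pow (finv (γ i)) (s i))

countEven : Series → ℤ → ℤ → ℕ → ℕ
countEven F a b N =
  length (filter (λ n → (∣ a ∣ ℕD.∣? ∣ (+ n) - b ∣) ×-dec (2 ℕD.∣? ∣ F n ∣)) (upTo (suc N)))

-- Work modulo 2 and let U_m keep the coefficients whose index is divisible by m. Let G Y be the parity of
-- the coefficient of F at a Y - b', where b' ≡ -b mod a, and h = Σ_{y ∈ ℤ} q^{ε y} with ε y = 2 β y (12 a y + 1).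
-- For suitable b' and β, W = (F q^{b'} h(q^a))(q^{24β}) satisfies W Π E_{βγ}^s = Π E_{βα}^r Σ_{x ≡ β} q^{x²} with
-- x running over a residue class modulo 24 a β and E_k = q^k f_{24k} = Σ_{x ≡ 1 mod 6} q^{k x²}, so that W times
-- a product B of powers of E's is a polynomial in the theta series Σ_{x ≡ c mod Λ} q^{x²}. The similitudes of ℤ²
-- of norm 2 and of ℤ⁴ of norm 3 show that U_2 and U_3 preserve such polynomials, and U_2 halves the degree up to a
-- constant; B is carried along by X² = X(q²) and E₁(q) Θ(q⁸) = E₁(q³)³. Hence the series U_{2^l 3^k} W with l large
-- lie in a finite set, and by the pigeonhole principle U_{m₁} (G h) = U_{m₂} (G h) for some {2,3}-smooth m₁, m₂
-- with m₂ / m₁ in [ρ, 2ρ), for any given ρ.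
--
-- If G were 1 throughout, the coefficient of G h at M would be the parity of #{y : ε y ≤ M}, which is constant on
-- long intervals. For large ρ, each interval of Y with even parity at m₁ Y contains one with odd parity at m₂ Y; so
-- every Y in it satisfies e + ε y = m₁ Y or m₂ Y for some y and some e with G e = 0. For fixed e and m the y with
-- m ∣ e + ε y are sparse, so there are many such e: at least a constant times √β √N, and β is arbitrarily large.

module Submission where

open import Algebra.Bundles using (CommutativeRing)
import Algebra.Solver.Ring as RingSolver
open import Algebra.Solver.Ring.AlmostCommutativeRing using (fromCommutativeRing; _-Raw-AlmostCommutative⟶_)
open import Algebra.Structures using (IsCommutativeRing)
open import Data.Bool.Base using (Bool; true; false; _∧_; _xor_; not; if_then_else_)
open import Data.Bool.Properties using (xor-assoc; xor-comm; xor-same; xor-identityʳ; ∧-distribˡ-xor; ∧-distribʳ-xor; ∧-comm; ∧-assoc; ∧-zeroʳ; ∧-identityʳ; xor-∧-commutativeRing)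
open import Data.Empty using (⊥; ⊥-elim)
open import Data.Fin.Base as Fin using (Fin; toℕ; fromℕ<)
import Data.Fin.Properties as Fin
open import Data.Integer.Base as ℤ using (ℤ; +_; -[1+_]; ∣_∣) renaming (_≤_ to _≤ℤ_)
open import Data.Integer.DivMod using (_%ℕ_; _/ℕ_; a≡a%ℕn+[a/ℕn]*n; n%ℕd<d)
import Data.Integer.Divisibility.Signed as ZDS
import Data.Integer.Properties as ℤ
import Data.Integer.Tactic.RingSolver as ZS
open import Data.List.Base as List using (List; []; _∷_; length; lookup; removeAt)
import Data.List.Properties as LP
open import Data.Maybe.Base using (Maybe; just; nothing)
open import Data.Nat.Base as ℕ using (ℕ; zero; suc; _+_; _*_; _≤_; _<_; z≤n; s≤s; _∸_; NonZero)
open import Data.Nat.Coprimality using (Coprime; coprime-divisor)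
import Data.Nat.DivMod as ℕM
open import Data.Nat.Divisibility as ND using (_∣_; _∣?_; divides; ∣-trans)
import Data.Nat.Properties as ℕ
import Data.Nat.Tactic.RingSolver as NS
open import Data.Product.Base using (∃; _×_; _,_; proj₁; proj₂)
open import Data.Sum.Base using (_⊎_; inj₁; inj₂)
open import Function.Base using (_∘_; id)
open import Function.Definitions using (Injective)
open import Level using (0ℓ)
open import Relation.Binary.Definitions using (Tri; tri<; tri≈; tri>)
open import Relation.Binary.PropositionalEquality.Core using (_≡_; refl; sym; trans; cong; cong₂; subst; subst₂; _≢_)
open import Relation.Binary.PropositionalEquality.Properties using (module ≡-Reasoning)
import Relation.Binary.Reasoning.Setoid as SetoidReasoning
open import Relation.Nullary using (¬_; Dec; yes; no; does)
open import Relation.Nullary.Decidable using (dec-true; dec-false; _×-dec_)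
open import Defs as D using (etaQuotient; countEven)

-- The ratio m₂ / m₁ must be bounded independently of β, since the final bound is √β / β₀ times a
-- factor that depends on this ratio. Powers of 2 alone would bound the ratio only through the size
-- of the finite set, which grows with β. With powers of 3 as well, any number of multipliers fits
-- into one interval [2^L, 2^(L+1)); two of them with equal series have ratio between 1 and 2, and a
-- common power moves the ratio into [ρ, 2ρ). The sparsity of the y with m ∣ e + ε y would lose a
-- factor β as well, but β / β₀ is taken to be 1 modulo 6, hence prime to every smooth m. So only
-- the fixed β₀ enters, while the quotient is free. A theta series in q^{k x²} with k > 1 is not
-- visibly a polynomial in those in q^{x²}. Its 2^(k-1)-th power is one: a similitude of multiplier
-- k on ℤ^(2^(k-1)) turns k times a sum of squares into a sum of squares. Modulo 2 a power 2^μ is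
-- the substitution q → q^(2^μ), which U₂ undoes, so that W B itself becomes a polynomial.

-- Power series over F₂

Ser : Set
Ser = ℕ → Bool

infix 4 _≈_
-- A record, so that `A` and `B` can be inferred from a proof; the bare pointwise equality would
-- leave them to higher-order unification.
record _≈_ (A B : Ser) : Set where
  constructor pw
  field at : ∀ n → A n ≡ B n
open _≈_ public

tl : Ser → Ser
tl A n = A (suc n)

infixl 6 _⊕_
infixl 7 _⊗_

opaque
  _⊕_ : Ser → Ser → Ser
  (A ⊕ B) n = A n xor B n

  -- The Cauchy product, read off from A = A 0 + q · `tl A`. The ring laws follow by induction on
  -- the index, for all series at once.
  _⊗_ : Ser → Ser → Ser
  (A ⊗ B) zero = A 0 ∧ B 0
  (A ⊗ B) (suc n) = (A 0 ∧ B (suc n)) xor (tl A ⊗ B) n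

  𝟘 : Ser
  𝟘 _ = false

  𝟙 : Ser
  𝟙 zero = true
  𝟙 (suc _) = false

xor-interchange : ∀ a b c d → (a xor b) xor (c xor d) ≡ (a xor c) xor (b xor d)
xor-interchange a b c d = begin
  (a xor b) xor (c xor d) ≡⟨ xor-assoc a b (c xor d) ⟩
  a xor (b xor (c xor d)) ≡⟨ cong (a xor_) (sym (xor-assoc b c d)) ⟩
  a xor ((b xor c) xor d) ≡⟨ cong (λ z → a xor (z xor d)) (xor-comm b c) ⟩
  a xor ((c xor b) xor d) ≡⟨ cong (a xor_) (xor-assoc c b d) ⟩
  a xor (c xor (b xor d)) ≡⟨ sym (xor-assoc a c (b xor d)) ⟩
  (a xor c) xor (b xor d) ∎
  where open ≡-Reasoning

opaque
  unfolding _⊕_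

  ⊕-at : ∀ A B n → (A ⊕ B) n ≡ A n xor B n
  ⊕-at A B n = refl

  𝟘-at : ∀ n → 𝟘 n ≡ false
  𝟘-at n = refl

  𝟙-at-0 : 𝟙 0 ≡ true
  𝟙-at-0 = refl

  𝟙-at-suc : ∀ n → 𝟙 (suc n) ≡ false
  𝟙-at-suc n = refl

  ⊗-at-0 : ∀ A B → (A ⊗ B) 0 ≡ A 0 ∧ B 0
  ⊗-at-0 A B = refl

  ⊗-at-suc : ∀ A B n → (A ⊗ B) (suc n) ≡ (A 0 ∧ B (suc n)) xor (tl A ⊗ B) n
  ⊗-at-suc A B n = refl

  ⊗-local : ∀ {A A' B B'} n → (∀ i → i ≤ n → A i ≡ A' i) → (∀ i → i ≤ n → B i ≡ B' i) → (A ⊗ B) n ≡ (A' ⊗ B') n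
  ⊗-local zero p r = cong₂ _∧_ (p 0 z≤n) (r 0 z≤n)
  ⊗-local (suc n) p r = cong₂ _xor_ (cong₂ _∧_ (p 0 z≤n) (r (suc n) ℕ.≤-refl))
    (⊗-local n (λ i le → p (suc i) (s≤s le)) (λ i le → r i (ℕ.m≤n⇒m≤1+n le)))

  ⊗-distribʳ′ : ∀ A B C n → ((A ⊕ B) ⊗ C) n ≡ ((A ⊗ C) ⊕ (B ⊗ C)) n
  ⊗-distribʳ′ A B C zero = ∧-distribʳ-xor (C 0) (A 0) (B 0)
  ⊗-distribʳ′ A B C (suc n) = begin
    ((A 0 xor B 0) ∧ C (suc n)) xor (tl (A ⊕ B) ⊗ C) n
      ≡⟨ cong₂ _xor_ (∧-distribʳ-xor (C (suc n)) (A 0) (B 0)) (⊗-distribʳ′ (tl A) (tl B) C n) ⟩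
    ((A 0 ∧ C (suc n)) xor (B 0 ∧ C (suc n))) xor ((tl A ⊗ C) n xor (tl B ⊗ C) n)
      ≡⟨ xor-interchange (A 0 ∧ C (suc n)) (B 0 ∧ C (suc n)) ((tl A ⊗ C) n) ((tl B ⊗ C) n) ⟩
    _ ∎
    where open ≡-Reasoning

  ⊗-distribˡ′ : ∀ A B C n → (A ⊗ (B ⊕ C)) n ≡ ((A ⊗ B) ⊕ (A ⊗ C)) n
  ⊗-distribˡ′ A B C zero = ∧-distribˡ-xor (A 0) (B 0) (C 0)
  ⊗-distribˡ′ A B C (suc n) = begin
    (A 0 ∧ (B (suc n) xor C (suc n))) xor (tl A ⊗ (B ⊕ C)) n
      ≡⟨ cong₂ _xor_ (∧-distribˡ-xor (A 0) (B (suc n)) (C (suc n))) (⊗-distribˡ′ (tl A) B C n) ⟩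
    _ ≡⟨ xor-interchange (A 0 ∧ B (suc n)) (A 0 ∧ C (suc n)) ((tl A ⊗ B) n) ((tl A ⊗ C) n) ⟩
    _ ∎
    where open ≡-Reasoning

  scale : Bool → Ser → Ser
  scale c A n = c ∧ A n

  ⊗-scaleˡ : ∀ c A B n → (scale c A ⊗ B) n ≡ c ∧ (A ⊗ B) n
  ⊗-scaleˡ c A B zero = ∧-assoc c (A 0) (B 0)
  ⊗-scaleˡ c A B (suc n) = begin
    ((c ∧ A 0) ∧ B (suc n)) xor (scale c (tl A) ⊗ B) n ≡⟨ cong₂ _xor_ (∧-assoc c (A 0) (B (suc n))) (⊗-scaleˡ c (tl A) B n) ⟩
    (c ∧ (A 0 ∧ B (suc n))) xor (c ∧ (tl A ⊗ B) n) ≡⟨ sym (∧-distribˡ-xor c _ _) ⟩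
    c ∧ (A ⊗ B) (suc n) ∎
    where open ≡-Reasoning

  ⊗-assoc′ : ∀ A B C n → ((A ⊗ B) ⊗ C) n ≡ (A ⊗ (B ⊗ C)) n
  ⊗-assoc′ A B C zero = ∧-assoc (A 0) (B 0) (C 0)
  ⊗-assoc′ A B C (suc n) = begin
    ((A 0 ∧ B 0) ∧ C (suc n)) xor (tl (A ⊗ B) ⊗ C) n
      -- The tail of `A ⊗ B` is `A 0` times `tl B` plus `tl A ⊗ B`, which lowers the index to `n`.
      ≡⟨ cong₂ _xor_ (∧-assoc (A 0) (B 0) (C (suc n))) (⊗-local {tl (A ⊗ B)} {scale (A 0) (tl B) ⊕ (tl A ⊗ B)} {C} {C} n (λ _ _ → refl) (λ _ _ → refl)) ⟩
    (A 0 ∧ (B 0 ∧ C (suc n))) xor ((scale (A 0) (tl B) ⊕ (tl A ⊗ B)) ⊗ C) n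
      ≡⟨ cong ((A 0 ∧ (B 0 ∧ C (suc n))) xor_) (⊗-distribʳ′ (scale (A 0) (tl B)) (tl A ⊗ B) C n) ⟩
    (A 0 ∧ (B 0 ∧ C (suc n))) xor ((scale (A 0) (tl B) ⊗ C) n xor ((tl A ⊗ B) ⊗ C) n)
      ≡⟨ cong ((A 0 ∧ (B 0 ∧ C (suc n))) xor_) (cong₂ _xor_ (⊗-scaleˡ (A 0) (tl B) C n) (⊗-assoc′ (tl A) B C n)) ⟩
    (A 0 ∧ (B 0 ∧ C (suc n))) xor ((A 0 ∧ (tl B ⊗ C) n) xor (tl A ⊗ (B ⊗ C)) n)
      ≡⟨ sym (xor-assoc (A 0 ∧ (B 0 ∧ C (suc n))) (A 0 ∧ (tl B ⊗ C) n) _) ⟩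
    ((A 0 ∧ (B 0 ∧ C (suc n))) xor (A 0 ∧ (tl B ⊗ C) n)) xor (tl A ⊗ (B ⊗ C)) n
      ≡⟨ cong (_xor (tl A ⊗ (B ⊗ C)) n) (sym (∧-distribˡ-xor (A 0) (B 0 ∧ C (suc n)) _)) ⟩
    _ ∎
    where open ≡-Reasoning

  ⊗-zeroʳ′ : ∀ A n → (A ⊗ 𝟘) n ≡ false
  ⊗-zeroʳ′ A zero = ∧-zeroʳ (A 0)
  ⊗-zeroʳ′ A (suc n) = cong₂ _xor_ (∧-zeroʳ (A 0)) (⊗-zeroʳ′ (tl A) n)

  ⊗-zeroˡ′ : ∀ A n → (𝟘 ⊗ A) n ≡ false
  ⊗-zeroˡ′ A zero = refl
  ⊗-zeroˡ′ A (suc n) = ⊗-zeroˡ′ A n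

  -- Peels the convolution from its other end. Commutativity needs both ends, and so does the
  -- comparison with the convolution of integer series, whose sum grows at the end.
  ⊗-snoc : ∀ A B n → (A ⊗ B) (suc n) ≡ (A ⊗ tl B) n xor (A (suc n) ∧ B 0)
  ⊗-snoc A B zero = refl
  ⊗-snoc A B (suc n) = begin
    (A 0 ∧ B (suc (suc n))) xor (tl A ⊗ B) (suc n) ≡⟨ cong ((A 0 ∧ B (suc (suc n))) xor_) (⊗-snoc (tl A) B n) ⟩
    (A 0 ∧ B (suc (suc n))) xor ((tl A ⊗ tl B) n xor (A (suc (suc n)) ∧ B 0)) ≡⟨ sym (xor-assoc (A 0 ∧ B (suc (suc n))) _ _) ⟩
    _ ∎
    where open ≡-Reasoning

  ⊗-comm′ : ∀ A B n → (A ⊗ B) n ≡ (B ⊗ A) n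
  ⊗-comm′ A B zero = ∧-comm (A 0) (B 0)
  ⊗-comm′ A B (suc n) = begin
    (A 0 ∧ B (suc n)) xor (tl A ⊗ B) n ≡⟨ cong₂ _xor_ (∧-comm (A 0) (B (suc n))) (⊗-comm′ (tl A) B n) ⟩
    (B (suc n) ∧ A 0) xor (B ⊗ tl A) n ≡⟨ xor-comm (B (suc n) ∧ A 0) _ ⟩
    (B ⊗ tl A) n xor (B (suc n) ∧ A 0) ≡⟨ sym (⊗-snoc B A n) ⟩
    (B ⊗ A) (suc n) ∎
    where open ≡-Reasoning

  ⊗-identityˡ′ : ∀ A n → (𝟙 ⊗ A) n ≡ A n
  ⊗-identityˡ′ A zero = refl
  ⊗-identityˡ′ A (suc n) = trans (cong (A (suc n) xor_)
    (trans (⊗-local {tl 𝟙} {𝟘} {A} {A} n (λ _ _ → refl) (λ _ _ → refl)) (⊗-zeroˡ′ A n))) (xor-identityʳ _)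

≈-refl : ∀ {A} → A ≈ A
≈-refl = pw λ _ → refl

≈-sym : ∀ {A B} → A ≈ B → B ≈ A
≈-sym p = pw λ n → sym (at p n)

≈-trans : ∀ {A B C} → A ≈ B → B ≈ C → A ≈ C
≈-trans p r = pw λ n → trans (at p n) (at r n)

opaque
  unfolding _⊕_

  ser-isCommutativeRing : IsCommutativeRing _≈_ _⊕_ _⊗_ (λ A → A) 𝟘 𝟙
  ser-isCommutativeRing = record
    { isRing = record
      { +-isAbelianGroup = record
        { isGroup = record
          { isMonoid = record
            { isSemigroup = record
              { isMagma = record
                { isEquivalence = record { refl = ≈-refl ; sym = ≈-sym ; trans = ≈-trans }
                ; ∙-cong = λ p r → pw λ n → cong₂ _xor_ (at p n) (at r n) }
              ; assoc = λ A B C → pw λ n → xor-assoc (A n) (B n) (C n) }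
            ; identity = (λ A → pw λ n → refl) , (λ A → pw λ n → xor-identityʳ (A n)) }
          ; inverse = (λ A → pw λ n → xor-same (A n)) , (λ A → pw λ n → xor-same (A n))
          ; ⁻¹-cong = λ p → p }
        ; comm = λ A B → pw λ n → xor-comm (A n) (B n) }
      ; *-cong = λ p r → pw λ n → ⊗-local n (λ i _ → at p i) (λ i _ → at r i)
      ; *-assoc = λ A B C → pw (⊗-assoc′ A B C)
      ; *-identity = (λ A → pw (⊗-identityˡ′ A)) , (λ A → pw λ n → trans (⊗-comm′ A 𝟙 n) (⊗-identityˡ′ A n))
      ; distrib = (λ A B C → pw (⊗-distribˡ′ A B C)) , (λ C A B → pw (⊗-distribʳ′ A B C)) }
    ; *-comm = λ A B → pw (⊗-comm′ A B) }

serRing : CommutativeRing 0ℓ 0ℓ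
serRing = record { isCommutativeRing = ser-isCommutativeRing }

module R = CommutativeRing serRing
module ≈R = SetoidReasoning R.setoid

constSer : Bool → Ser
constSer true = 𝟙
constSer false = 𝟘

⊕-self : ∀ A → A ⊕ A ≈ 𝟘
⊕-self A = R.-‿inverseˡ A

-- The constants form F₂, so the solver knows that the characteristic is 2.
constHom : CommutativeRing.rawRing xor-∧-commutativeRing -Raw-AlmostCommutative⟶ fromCommutativeRing serRing
constHom = record
  { ⟦_⟧ = constSer
  ; +-homo = λ { true true → R.sym (⊕-self 𝟙) ; true false → R.sym (R.+-identityʳ 𝟙) ; false b → R.sym (R.+-identityˡ _) }
  ; *-homo = λ { true b → R.sym (R.*-identityˡ _) ; false b → R.sym (R.zeroˡ _) }
  ; -‿homo = λ _ → R.refl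
  ; 0-homo = R.refl
  ; 1-homo = R.refl }

constSer-≈? : ∀ b c → Maybe (constSer b ≈ constSer c)
constSer-≈? true true = just R.refl
constSer-≈? false false = just R.refl
constSer-≈? _ _ = nothing

module RS = RingSolver (CommutativeRing.rawRing xor-∧-commutativeRing) (fromCommutativeRing serRing) constHom constSer-≈?
open RS public using (solve; _:+_; _:*_; _:=_; con)

-- The sections U and the substitutions V

U : ℕ → Ser → Ser
U k A n = A (k * n)

-- V k A is A(q^k) (for k ≥ 1)
opaque
  V : ℕ → Ser → Ser
  V k A n with k ∣? n
  ... | yes (divides q _) = A q
  ... | no _ = false

  V-* : ∀ k .{{_ : NonZero k}} A n → V k A (k * n) ≡ A n
  V-* k A n with k ∣? (k * n)
  ... | yes (divides q eq) = cong A (ℕ.*-cancelˡ-≡ q n k (trans (ℕ.*-comm k q) (sym eq)))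
  ... | no ¬p = ⊥-elim (¬p (divides n (ℕ.*-comm k n)))

  V-no : ∀ k A n → ¬ k ∣ n → V k A n ≡ false
  V-no k A n ¬p with k ∣? n
  ... | yes p = ⊥-elim (¬p p)
  ... | no _ = refl

  mono : ℕ → Ser
  mono a n = does (a ℕ.≟ n)

Supp : ℕ → Ser → Set
Supp k A = ∀ n → ¬ k ∣ n → A n ≡ false

V-supp : ∀ k A → Supp k (V k A)
V-supp = V-no

-- A series in q^k is determined by its section. The identities for `V` are proved in this way:
-- support on both sides, then equal sections.
Supp-≈ : ∀ k {A B} → Supp k A → Supp k B → U k A ≈ U k B → A ≈ B
Supp-≈ k {A} {B} sA sB e = pw go
  where
  go : ∀ n → A n ≡ B n
  go n with k ∣? n
  ... | yes (divides q eq) = trans (cong A (trans eq (ℕ.*-comm q k))) (trans (at e q) (cong B (sym (trans eq (ℕ.*-comm q k)))))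
  ... | no ¬p = trans (sA n ¬p) (sym (sB n ¬p))

U-cong : ∀ k {A B} → A ≈ B → U k A ≈ U k B
U-cong k p = pw λ n → at p (k * n)

UV : ∀ k .{{_ : NonZero k}} A → U k (V k A) ≈ A
UV k A = pw (V-* k A)

V-cong : ∀ k .{{_ : NonZero k}} {A B} → A ≈ B → V k A ≈ V k B
V-cong k {A} {B} p = Supp-≈ k (V-supp k A) (V-supp k B) (≈-trans (UV k A) (≈-trans p (≈-sym (UV k B))))

opaque
  unfolding _⊕_ mono scale

  U-⊕ : ∀ k A B → U k (A ⊕ B) ≈ U k A ⊕ U k B
  U-⊕ k A B = pw λ n → refl

  U-𝟘 : ∀ k → U k 𝟘 ≈ 𝟘
  U-𝟘 k = pw λ n → refl

  Supp-⊕ : ∀ {k A B} → Supp k A → Supp k B → Supp k (A ⊕ B)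
  Supp-⊕ sA sB n ¬p rewrite sA n ¬p = sB n ¬p

  mono-0 : mono 0 ≈ 𝟙
  mono-0 = pw λ { zero → refl ; (suc n) → refl }

  mono-⊗-lo : ∀ a A n → n < a → (mono a ⊗ A) n ≡ false
  mono-⊗-lo (suc a) A zero _ = refl
  mono-⊗-lo (suc a) A (suc n) (s≤s lt) = mono-⊗-lo a A n lt

  mono-⊗-hi : ∀ a A n → (mono a ⊗ A) (a + n) ≡ A n
  mono-⊗-hi zero A n = trans (⊗-local {mono 0} {𝟙} {A} {A} n (λ i _ → at mono-0 i) (λ _ _ → refl)) (⊗-identityˡ′ A n)
  mono-⊗-hi (suc a) A n = mono-⊗-hi a A n

  scale-≈ : ∀ c A {n} → (scale c 𝟙 ⊗ A) n ≡ c ∧ A n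
  scale-≈ c A {n} = trans (⊗-scaleˡ c 𝟙 A n) (cong (c ∧_) (⊗-identityˡ′ A n))

  private
    n<k⇒¬k∣n : ∀ {k n} → 0 < n → n < k → ¬ k ∣ n
    n<k⇒¬k∣n {k} {suc n} _ lt p = ℕ.<⇒≱ lt (ND.∣⇒≤ p)

  -- The substitution q → q^k in A = A 0 + q · `tl A`; it permits inductions in steps of `k`.
  V-step : ∀ k .{{_ : NonZero k}} A → V k A ≈ scale (A 0) 𝟙 ⊕ mono k ⊗ V k (tl A)
  V-step k@(suc k') A = pw go
    where
    go : ∀ n → V k A n ≡ (A 0 ∧ 𝟙 n) xor (mono k ⊗ V k (tl A)) n
    go zero = trans (trans (cong (V k A) (sym (ℕ.*-zeroʳ k))) (V-* k A 0)) (sym (trans (cong ((A 0 ∧ true) xor_) (mono-⊗-lo k (V k (tl A)) 0 (s≤s z≤n))) (trans (xor-identityʳ _) (∧-identityʳ _))))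
    go (suc n) with ℕ.<-≤-connex (suc n) k
    ... | inj₁ lt = trans (V-supp k A (suc n) (n<k⇒¬k∣n (s≤s z≤n) lt)) (sym (cong₂ _xor_ (∧-zeroʳ (A 0)) (mono-⊗-lo k _ (suc n) lt)))
    ... | inj₂ ge = trans (subst (λ z → V k A z ≡ (mono k ⊗ V k (tl A)) z) (ℕ.m+[n∸m]≡n ge) (step (suc n ∸ k))) (sym (cong (_xor (mono k ⊗ V k (tl A)) (suc n)) (∧-zeroʳ (A 0))))
      where
      step : ∀ m → V k A (k + m) ≡ (mono k ⊗ V k (tl A)) (k + m)
      step m with k ∣? m
      ... | yes (divides q refl) = trans (trans (cong (V k A) (sym (trans (ℕ.*-suc k q) (cong (k ℕ.+_) (ℕ.*-comm k q))))) (V-* k A (suc q)))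
              (sym (trans (mono-⊗-hi k (V k (tl A)) (q * k)) (trans (cong (V k (tl A)) (ℕ.*-comm q k)) (V-* k (tl A) q))))
      ... | no ¬p = trans (V-supp k A (k + m) (λ d → ¬p (ND.∣m+n∣m⇒∣n d ND.∣-refl))) (sym (trans (mono-⊗-hi k _ m) (V-supp k (tl A) m ¬p)))

  V-⊗-lo : ∀ k .{{_ : NonZero k}} A X n → n < k → (V k A ⊗ X) n ≡ A 0 ∧ X n
  V-⊗-lo k A X n lt = begin
    (V k A ⊗ X) n ≡⟨ at (R.*-congʳ (V-step k A)) n ⟩
    ((scale (A 0) 𝟙 ⊕ mono k ⊗ V k (tl A)) ⊗ X) n ≡⟨ ⊗-distribʳ′ _ _ X n ⟩
    (scale (A 0) 𝟙 ⊗ X) n xor ((mono k ⊗ V k (tl A)) ⊗ X) n ≡⟨ cong₂ _xor_ (scale-≈ (A 0) X) (trans (⊗-assoc′ _ _ X n) (mono-⊗-lo k _ n lt)) ⟩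
    (A 0 ∧ X n) xor false ≡⟨ xor-identityʳ _ ⟩
    A 0 ∧ X n ∎
    where open ≡-Reasoning

  V-⊗-hi : ∀ k .{{_ : NonZero k}} A X n → (V k A ⊗ X) (k + n) ≡ (A 0 ∧ X (k + n)) xor (V k (tl A) ⊗ X) n
  V-⊗-hi k A X n = begin
    (V k A ⊗ X) (k + n) ≡⟨ at (R.*-congʳ (V-step k A)) (k + n) ⟩
    ((scale (A 0) 𝟙 ⊕ mono k ⊗ V k (tl A)) ⊗ X) (k + n) ≡⟨ ⊗-distribʳ′ _ _ X (k + n) ⟩
    (scale (A 0) 𝟙 ⊗ X) (k + n) xor ((mono k ⊗ V k (tl A)) ⊗ X) (k + n)
      ≡⟨ cong₂ _xor_ (scale-≈ (A 0) X) (trans (⊗-assoc′ _ _ X (k + n)) (mono-⊗-hi k _ n)) ⟩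
    _ ∎
    where open ≡-Reasoning

  -- The projection formula: `U k` is linear over the series in q^k. With `sq-V` it carries
  -- denominators through `U 2` and `U 3`.
  U-V-⊗ : ∀ k .{{_ : NonZero k}} A X → U k (V k A ⊗ X) ≈ A ⊗ U k X
  U-V-⊗ k A X = pw (go A)
    where
    go : ∀ A n → (V k A ⊗ X) (k * n) ≡ (A ⊗ U k X) n
    go A zero = trans (cong (V k A ⊗ X) (ℕ.*-zeroʳ k)) (trans (V-⊗-lo k A X 0 (ℕ.>-nonZero⁻¹ k)) (cong (λ z → A 0 ∧ X z) (sym (ℕ.*-zeroʳ k))))
    go A (suc n) = trans (cong (V k A ⊗ X) (ℕ.*-suc k n)) (trans (V-⊗-hi k A X (k * n)) (cong₂ _xor_ (cong (λ z → A 0 ∧ X z) (sym (ℕ.*-suc k n))) (go (tl A) n)))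

  Supp-V-⊗ : ∀ k .{{_ : NonZero k}} A {X} → Supp k X → Supp k (V k A ⊗ X)
  Supp-V-⊗ k A {X} sX n = go A n n ℕ.≤-refl
    where
    go : ∀ A n b → n ≤ b → ¬ k ∣ n → (V k A ⊗ X) n ≡ false
    go A n b le ¬p with ℕ.<-≤-connex n k
    ... | inj₁ lt = trans (V-⊗-lo k A X n lt) (trans (cong (A 0 ∧_) (sX n ¬p)) (∧-zeroʳ _))
    go A n zero le ¬p | inj₂ ge = ⊥-elim (ℕ.<⇒≱ (ℕ.>-nonZero⁻¹ k) (ℕ.≤-trans ge le))
    go A n (suc b) le ¬p | inj₂ ge = subst (λ z → (V k A ⊗ X) z ≡ false) (ℕ.m+[n∸m]≡n ge)
      (trans (V-⊗-hi k A X (n ∸ k)) (cong₂ _xor_ (trans (cong (λ z → A 0 ∧ X z) (ℕ.m+[n∸m]≡n ge)) (trans (cong (A 0 ∧_) (sX n ¬p)) (∧-zeroʳ _)))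
        (go (tl A) (n ∸ k) b (ℕ.≤-pred (ℕ.≤-trans (ℕ.∸-monoʳ-< (ℕ.>-nonZero⁻¹ k) ge) le))
          (λ d → ¬p (subst (k ∣_) (ℕ.m+[n∸m]≡n ge) (ND.∣m∣n⇒∣m+n ND.∣-refl d))))))

V-⊕ : ∀ k .{{_ : NonZero k}} A B → V k (A ⊕ B) ≈ V k A ⊕ V k B
V-⊕ k A B = Supp-≈ k (V-supp k _) (Supp-⊕ (V-supp k A) (V-supp k B))
  (≈-trans (UV k _) (≈-sym (≈-trans (U-⊕ k _ _) (R.+-cong (UV k A) (UV k B)))))

V-U : ∀ k .{{_ : NonZero k}} {A} → Supp k A → V k (U k A) ≈ A
V-U k {A} s = Supp-≈ k (V-supp k (U k A)) s (UV k (U k A))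

V-⊗ : ∀ k .{{_ : NonZero k}} A B → V k (A ⊗ B) ≈ V k A ⊗ V k B
V-⊗ k A B = Supp-≈ k (V-supp k _) (Supp-V-⊗ k A (V-supp k B))
  (≈-trans (UV k (A ⊗ B)) (≈-sym (≈-trans (U-V-⊗ k A (V k B)) (R.*-congˡ (UV k B)))))

Supp-resp : ∀ {k A B} → A ≈ B → Supp k A → Supp k B
Supp-resp p s n ¬d = trans (sym (at p n)) (s n ¬d)

U-Supp-⊗ : ∀ k .{{_ : NonZero k}} {A} X → Supp k A → U k (A ⊗ X) ≈ U k A ⊗ U k X
U-Supp-⊗ k {A} X sA = ≈-trans (U-cong k (R.*-congʳ (≈-sym (V-U k sA)))) (U-V-⊗ k (U k A) X)

U-U : ∀ j k A → U j (U k A) ≈ U (k * j) A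
U-U j k A = pw λ n → cong A (sym (ℕ.*-assoc k j n))

V-V : ∀ j k .{{_ : NonZero j}} .{{_ : NonZero k}} A → V j (V k A) ≈ V (j * k) A
V-V j k A = Supp-≈ (j * k) sup (V-supp (j * k) A) (≈-trans sec (≈-sym (UV (j * k) {{ℕ.m*n≢0 j k}} A)))
  where
  sup : Supp (j * k) (V j (V k A))
  sup n ¬d with j ∣? n
  ... | no ¬e = V-supp j _ n ¬e
  ... | yes (divides q refl) = trans (cong (V j (V k A)) (ℕ.*-comm q j)) (trans (V-* j (V k A) q)
    (V-supp k A q λ d → ¬d (subst (_∣ q * j) (ℕ.*-comm k j) (ND.*-monoˡ-∣ j d))))
  sec : U (j * k) (V j (V k A)) ≈ A
  sec = pw λ n → trans (cong (V j (V k A)) (ℕ.*-assoc j k n)) (trans (V-* j (V k A) (k * n)) (V-* k A n))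

opaque
  unfolding mono

  mono-yes : ∀ a → mono a a ≡ true
  mono-yes a = dec-true (a ℕ.≟ a) refl

  mono-no : ∀ a n → a ≢ n → mono a n ≡ false
  mono-no a n ne = dec-false (a ℕ.≟ n) ne

V-mono : ∀ k .{{_ : NonZero k}} a → V k (mono a) ≈ mono (k * a)
V-mono k a = Supp-≈ k (V-supp k (mono a)) s (≈-trans (UV k (mono a)) (pw e))
  where
  s : Supp k (mono (k * a))
  s n ¬d = mono-no (k * a) n λ { refl → ¬d (ND.m∣m*n a) }
  e : ∀ n → mono a n ≡ mono (k * a) (k * n)
  e n with a ℕ.≟ n
  ... | yes refl = trans (mono-yes a) (sym (mono-yes (k * a)))
  ... | no ¬e = trans (mono-no a n ¬e) (sym (mono-no (k * a) (k * n) λ z → ¬e (ℕ.*-cancelˡ-≡ a n k z)))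

opaque
  unfolding _⊕_ mono scale

  mono-⊗-cancel : ∀ a {A B} → mono a ⊗ A ≈ mono a ⊗ B → A ≈ B
  mono-⊗-cancel a {A} {B} p = pw λ n → trans (sym (mono-⊗-hi a A n)) (trans (at p (a + n)) (mono-⊗-hi a B n))

  mono-+ : ∀ a b → mono a ⊗ mono b ≈ mono (a + b)
  mono-+ zero b = ≈-trans (R.*-congʳ mono-0) (R.*-identityˡ (mono b))
  mono-+ (suc a) b = pw λ { zero → refl ; (suc n) → at (mono-+ a b) n }

  -- Frobenius. The two cross terms `A 0 ∧ A (2 + n)` cancel and leave the coefficient `n` of the
  -- square of `tl A`, so the induction runs in steps of 2.
  sq-V : ∀ A → A ⊗ A ≈ V 2 A
  sq-V A = pw λ n → go A n n ℕ.≤-refl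
    where
    open ≡-Reasoning
    go : ∀ A n b → n ≤ b → (A ⊗ A) n ≡ V 2 A n
    go A zero _ _ = trans (idem (A 0)) (sym (V-* 2 A 0))
      where
      idem : ∀ x → x ∧ x ≡ x
      idem true = refl
      idem false = refl
    go A (suc zero) _ _ = trans (trans (cong ((A 0 ∧ A 1) xor_) (∧-comm (A 1) (A 0))) (xor-same (A 0 ∧ A 1))) (sym (V-supp 2 A 1 λ { (divides zero ()) ; (divides (suc q) ()) }))
    go A (suc (suc n)) (suc b) (s≤s le) = begin
      (A 0 ∧ A (2 + n)) xor (tl A ⊗ A) (suc n) ≡⟨ cong ((A 0 ∧ A (2 + n)) xor_) (⊗-snoc (tl A) A n) ⟩
      (A 0 ∧ A (2 + n)) xor ((tl A ⊗ tl A) n xor (A (2 + n) ∧ A 0)) ≡⟨ lem (A 0) (A (2 + n)) ((tl A ⊗ tl A) n) ⟩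
      (tl A ⊗ tl A) n ≡⟨ go (tl A) n b (ℕ.≤-trans (ℕ.n≤1+n n) le) ⟩
      V 2 (tl A) n ≡⟨ sym (mono-⊗-hi 2 (V 2 (tl A)) n) ⟩
      (mono 2 ⊗ V 2 (tl A)) (2 + n) ≡⟨ sym (trans (at (V-step 2 A) (2 + n)) (cong (_xor (mono 2 ⊗ V 2 (tl A)) (2 + n)) (∧-zeroʳ (A 0)))) ⟩
      V 2 A (2 + n) ∎
      where
      lem : ∀ x y z → (x ∧ y) xor (z xor (y ∧ x)) ≡ z
      lem true true true = refl
      lem true true false = refl
      lem true false true = refl
      lem true false false = refl
      lem false true true = refl
      lem false true false = refl
      lem false false true = refl
      lem false false false = refl

-- Sums over boxes of integer vectors, and generating series

-- ℤ^(2^m) as a binary tree, because the similitudes are block matrices acting on pairs of vectors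
-- of half the dimension.
VV : ℕ → Set
VV zero = ℤ
VV (suc m) = VV m × VV m

InB : ∀ m → ℕ → VV m → Set
InB zero n x = ∣ x ∣ ≤ n
InB (suc m) n (x , y) = InB m n x × InB m n y

InB-mono : ∀ m {n n'} → n ≤ n' → ∀ x → InB m n x → InB m n' x
InB-mono zero le x p = ℕ.≤-trans p le
InB-mono (suc m) le (x , y) (p , r) = InB-mono m le x p , InB-mono m le y r

infix 4 _≟V_
_≟V_ : ∀ {m} (x y : VV m) → Dec (x ≡ y)
_≟V_ {zero} x y = x ℤ.≟ y
_≟V_ {suc m} (x , y) (x' , y') with x ≟V x' | y ≟V y'
... | yes refl | yes refl = yes refl
... | no ne | _ = no λ { refl → ne refl }
... | yes _ | no ne = no λ { refl → ne refl }

sumZ : ℕ → (ℤ → Bool) → Bool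
sumZ zero φ = φ (+ 0)
sumZ (suc n) φ = sumZ n φ xor (φ (+ suc n) xor φ -[1+ n ])

sumV : ∀ m → ℕ → (VV m → Bool) → Bool
sumV zero n φ = sumZ n φ
sumV (suc m) n φ = sumV m n (λ x → sumV m n (λ y → φ (x , y)))

sumZ-cong : ∀ n {φ ψ : ℤ → Bool} → (∀ x → ∣ x ∣ ≤ n → φ x ≡ ψ x) → sumZ n φ ≡ sumZ n ψ
sumZ-cong zero h = h (+ 0) z≤n
sumZ-cong (suc n) h = cong₂ _xor_ (sumZ-cong n λ x le → h x (ℕ.m≤n⇒m≤1+n le)) (cong₂ _xor_ (h (+ suc n) ℕ.≤-refl) (h -[1+ n ] ℕ.≤-refl))

sum-cong : ∀ m n {φ ψ : VV m → Bool} → (∀ x → InB m n x → φ x ≡ ψ x) → sumV m n φ ≡ sumV m n ψ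
sum-cong zero n h = sumZ-cong n h
sum-cong (suc m) n h = sum-cong m n λ x ix → sum-cong m n λ y iy → h (x , y) (ix , iy)

sumZ-false : ∀ n → sumZ n (λ _ → false) ≡ false
sumZ-false zero = refl
sumZ-false (suc n) rewrite sumZ-false n = refl

sum-0 : ∀ m n → sumV m n (λ _ → false) ≡ false
sum-0 zero n = sumZ-false n
sum-0 (suc m) n = trans (sum-cong m n λ _ _ → sum-0 m n) (sum-0 m n)

sum-false : ∀ m n {φ : VV m → Bool} → (∀ x → InB m n x → φ x ≡ false) → sumV m n φ ≡ false
sum-false m n h = trans (sum-cong m n h) (sum-0 m n)

sumZ-xor : ∀ n (φ ψ : ℤ → Bool) → sumZ n (λ x → φ x xor ψ x) ≡ sumZ n φ xor sumZ n ψ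
sumZ-xor zero φ ψ = refl
sumZ-xor (suc n) φ ψ = trans (cong₂ _xor_ (sumZ-xor n φ ψ) (xor-interchange (φ (+ suc n)) (ψ (+ suc n)) (φ -[1+ n ]) (ψ -[1+ n ])))
  (xor-interchange (sumZ n φ) (sumZ n ψ) (φ (+ suc n) xor φ -[1+ n ]) (ψ (+ suc n) xor ψ -[1+ n ]))

sum-xor : ∀ m n (φ ψ : VV m → Bool) → sumV m n (λ x → φ x xor ψ x) ≡ sumV m n φ xor sumV m n ψ
sum-xor zero n φ ψ = sumZ-xor n φ ψ
sum-xor (suc m) n φ ψ = trans (sum-cong m n λ x _ → sum-xor m n (λ y → φ (x , y)) (λ y → ψ (x , y))) (sum-xor m n _ _)

sum-∧ : ∀ m n c (φ : VV m → Bool) → sumV m n (λ x → c ∧ φ x) ≡ c ∧ sumV m n φ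
sum-∧ m n true φ = refl
sum-∧ m n false φ = sum-0 m n

sumZ-swap : ∀ n m' n' (φ : ℤ → VV m' → Bool) → sumZ n (λ x → sumV m' n' (φ x)) ≡ sumV m' n' (λ y → sumZ n (λ x → φ x y))
sumZ-swap zero m' n' φ = refl
sumZ-swap (suc n) m' n' φ = begin
  sumZ n (λ x → sumV m' n' (φ x)) xor (sumV m' n' (φ (+ suc n)) xor sumV m' n' (φ -[1+ n ]))
    ≡⟨ cong₂ _xor_ (sumZ-swap n m' n' φ) (sym (sum-xor m' n' _ _)) ⟩
  sumV m' n' (λ y → sumZ n (λ x → φ x y)) xor sumV m' n' (λ y → φ (+ suc n) y xor φ -[1+ n ] y)
    ≡⟨ sym (sum-xor m' n' _ _) ⟩
  _ ∎
  where open ≡-Reasoning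

sum-swap : ∀ m n m' n' (φ : VV m → VV m' → Bool) → sumV m n (λ x → sumV m' n' (φ x)) ≡ sumV m' n' (λ y → sumV m n (λ x → φ x y))
sum-swap zero n m' n' φ = sumZ-swap n m' n' φ
sum-swap (suc m) n m' n' φ = trans (sum-cong m n λ x _ → sum-swap m n m' n' (λ y → φ (x , y))) (sum-swap m n m' n' _)

private
  sumZ-small : ∀ n x (φ : ℤ → Bool) → ∣ x ∣ ≤ n → (∀ y → ∣ y ∣ ≤ n → y ≢ x → φ y ≡ false) → sumZ n φ ≡ φ x
  sumZ-small zero (+ zero) φ _ h = refl
  sumZ-small (suc n) x φ le h with ∣ x ∣ ℕ.≤? n
  ... | yes le' = trans (cong₂ _xor_ (sumZ-small n x φ le' λ y ly → h y (ℕ.m≤n⇒m≤1+n ly))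
          (cong₂ _xor_ (h (+ suc n) ℕ.≤-refl λ { refl → ℕ.<-irrefl refl le' }) (h -[1+ n ] ℕ.≤-refl λ { refl → ℕ.<-irrefl refl le' })))
          (xor-identityʳ _)
  ... | no ¬le = trans (cong (_xor (φ (+ suc n) xor φ -[1+ n ])) (trans (sumZ-cong n {ψ = λ _ → false} λ y ly → h y (ℕ.m≤n⇒m≤1+n ly) λ { refl → ¬le ly }) (sumZ-false n)))
          (top x (ℕ.≤-antisym le (ℕ.≰⇒> ¬le)) h)
    where
    top : ∀ x → ∣ x ∣ ≡ suc n → (∀ y → ∣ y ∣ ≤ suc n → y ≢ x → φ y ≡ false) → φ (+ suc n) xor φ -[1+ n ] ≡ φ x
    top (+ suc _) refl h = trans (cong (φ (+ suc n) xor_) (h -[1+ n ] ℕ.≤-refl λ ())) (xor-identityʳ _)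
    top -[1+ _ ] refl h = cong (_xor φ -[1+ n ]) (h (+ suc n) ℕ.≤-refl λ ())

sum-δ : ∀ m n x (φ : VV m → Bool) → InB m n x → (∀ y → InB m n y → y ≢ x → φ y ≡ false) → sumV m n φ ≡ φ x
sum-δ zero n x φ ix h = sumZ-small n x φ ix h
sum-δ (suc m) n (x , y) φ (ix , iy) h = trans
  (sum-δ m n x _ ix λ x' ix' ne → sum-false m n λ y' iy' → h (x' , y') (ix' , iy') λ { refl → ne refl })
  (sum-δ m n y _ iy λ y' iy' ne → h (x , y') (ix , iy') λ { refl → ne refl })

private
  ∧-true : ∀ {a b} → a ∧ b ≡ true → a ≡ true × b ≡ true
  ∧-true {true} {true} _ = refl , refl

  bool-cases : ∀ (b : Bool) → (b ≡ true) ⊎ (b ≡ false)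
  bool-cases true = inj₁ refl
  bool-cases false = inj₂ refl

  ¬true : ∀ {b} → (b ≡ true → ⊥) → b ≡ false
  ¬true {true} h = ⊥-elim (h refl)
  ¬true {false} h = refl

does-true : ∀ {A : Set} (d : Dec A) → does d ≡ true → A
does-true (yes a) _ = a

-- Double counting of the pairs (x, y) with `g y ≡ x` and `ψ y`: summing over y gives `φ x`, summing
-- over x gives `ψ y`.
sum-bij : ∀ m n m' n' (φ : VV m → Bool) (ψ : VV m' → Bool) (g : VV m' → VV m)
  → (∀ y → ψ y ≡ true → φ (g y) ≡ true × InB m n (g y))
  → (∀ y y' → ψ y ≡ true → ψ y' ≡ true → g y ≡ g y' → y ≡ y')
  → (∀ x → φ x ≡ true → ∃ λ y → InB m' n' y × ψ y ≡ true × g y ≡ x)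
  → sumV m n φ ≡ sumV m' n' ψ
sum-bij m n m' n' φ ψ g h1 h2 h3 = begin
  sumV m n φ ≡⟨ sum-cong m n (λ x _ → sym (inner x)) ⟩
  sumV m n (λ x → sumV m' n' (e x)) ≡⟨ sum-swap m n m' n' e ⟩
  sumV m' n' (λ y → sumV m n (λ x → e x y)) ≡⟨ sum-cong m' n' (λ y _ → outer y) ⟩
  sumV m' n' ψ ∎
  where
  open ≡-Reasoning
  e : VV m → VV m' → Bool
  e x y = does (g y ≟V x) ∧ ψ y
  inner : ∀ x → sumV m' n' (e x) ≡ φ x
  inner x with bool-cases (φ x)
  ... | inj₂ f = trans (sum-false m' n' λ y _ → ¬true λ t → case y t) (sym f)
    where
    case : ∀ y → e x y ≡ true → ⊥
    case y t with does-true (g y ≟V x) (proj₁ (∧-true t)) | proj₂ (∧-true {does (g y ≟V x)} t)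
    ... | refl | py with trans (sym (proj₁ (h1 y py))) f
    ... | ()
  ... | inj₁ tt with h3 x tt
  ... | y , iy , py , gy = trans (sum-δ m' n' y (e x) iy λ y' _ ne → ¬true λ t →
          ne (h2 y' y (proj₂ (∧-true {does (g y' ≟V x)} t)) py (trans (does-true (g y' ≟V x) (proj₁ (∧-true t))) (sym gy))))
          (trans (cong₂ _∧_ (dec-true (g y ≟V x) gy) py) (sym tt))
  outer : ∀ y → sumV m n (λ x → e x y) ≡ ψ y
  outer y with bool-cases (ψ y)
  ... | inj₂ f = trans (sum-false m n λ x _ → trans (cong (does (g y ≟V x) ∧_) f) (∧-zeroʳ _)) (sym f)
  ... | inj₁ t = trans (sum-δ m n (g y) (λ x → e x y) (proj₂ (h1 y t)) λ x _ ne → cong (_∧ ψ y) (dec-false (g y ≟V x) (ne ∘ sym)))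
                 (cong (_∧ ψ y) (dec-true (g y ≟V g y) refl))

-- Σ_{x ∈ C} q^{w x}; junk unless every x ∈ C lies in the box of radius w x
opaque
  Gen : ∀ m → (VV m → ℕ) → (VV m → Bool) → Ser
  Gen m w C n = sumV m n (λ x → C x ∧ mono (w x) n)

  private
    mono-true : ∀ a n → mono a n ≡ true → a ≡ n
    mono-true a n t with a ℕ.≟ n
    ... | yes e = e
    ... | no ne with trans (sym t) (mono-no a n ne)
    ... | ()

  -- Two exponents `n` and `n'` occur so that sections can be computed as well, with n = k n'.
  Gen-bij : ∀ {m w C m' w' C'} (g : VV m' → VV m) n n'
    → (∀ x → C x ≡ true → InB m (w x) x) → (∀ x → C' x ≡ true → InB m' (w' x) x)
    → (∀ y → C' y ≡ true → w' y ≡ n' → C (g y) ≡ true × w (g y) ≡ n)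
    → (∀ y y' → C' y ≡ true → C' y' ≡ true → g y ≡ g y' → y ≡ y')
    → (∀ x → C x ≡ true → w x ≡ n → ∃ λ y → C' y ≡ true × w' y ≡ n' × g y ≡ x)
    → Gen m w C n ≡ Gen m' w' C' n'
  Gen-bij {m} {w} {C} {m'} {w'} {C'} g n n' b b' h1 h2 h3 = sum-bij m n m' n' _ _ g
    (λ y t → let (t1 , t2) = ∧-true {C' y} t
                 (p , r) = h1 y t1 (mono-true (w' y) n' t2) in
       cong₂ _∧_ p (trans (cong (λ z → mono z n) r) (mono-yes n)) , subst (λ z → InB m z (g y)) r (b (g y) p))
    (λ y y' t t' → h2 y y' (proj₁ (∧-true {C' y} t)) (proj₁ (∧-true {C' y'} t')))
    (λ x t → let (t1 , t2) = ∧-true {C x} t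
                 (y , p , r , e) = h3 x t1 (mono-true (w x) n t2) in
       y , subst (λ z → InB m' z y) r (b' y p) , cong₂ _∧_ p (trans (cong (λ z → mono z n') r) (mono-yes n')) , e)

  Gen-zero : ∀ {m w C} n → (∀ x → C x ≡ true → w x ≢ n) → Gen m w C n ≡ false
  Gen-zero {m} {w} {C} n h = sum-false m n λ x _ → ¬true λ t → h x (proj₁ (∧-true {C x} t)) (mono-true (w x) n (proj₂ (∧-true {C x} t)))

  Gen-cong : ∀ {m w C C'} → (∀ x → C x ≡ C' x) → Gen m w C ≈ Gen m w C'
  Gen-cong {m} {w} h = pw λ n → sum-cong m n λ x _ → cong (_∧ mono (w x) n) (h x)

  Gen-xor : ∀ {m w C C'} → Gen m w (λ x → C x xor C' x) ≈ Gen m w C ⊕ Gen m w C'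
  Gen-xor {m} {w} {C} {C'} = pw λ n → trans (sum-cong m n λ x _ → ∧-distribʳ-xor (mono (w x) n) (C x) (C' x)) (trans (sum-xor m n _ _) (sym (⊕-at _ _ n)))

  Gen-false : ∀ {m w} → Gen m w (λ _ → false) ≈ 𝟘
  Gen-false {m} {w} = pw λ n → trans (sum-0 m n) (sym (𝟘-at n))

  -- A larger box adds only points of larger weight, so the coefficients of both factors of a
  -- product can be taken over one common box.
  Gen-box : ∀ m w (C : VV m → Bool) N k → (∀ x → C x ≡ true → InB m (w x) x) → k ≤ N → Gen m w C k ≡ sumV m N (λ x → C x ∧ mono (w x) k)
  Gen-box m w C N k b le = sum-bij m k m N _ _ id
      (λ y t → t , subst (λ z → InB m z y) (mono-true (w y) k (proj₂ (∧-true {C y} t))) (b y (proj₁ (∧-true {C y} t))))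
      (λ _ _ _ _ e → e)
      (λ x t → x , InB-mono m le x (subst (λ z → InB m z x) (mono-true (w x) k (proj₂ (∧-true {C x} t))) (b x (proj₁ (∧-true {C x} t)))) , t , refl)

  private
    sum-⊗ : ∀ m n (F : VV m → Ser) G N → ((λ k → sumV m n (λ x → F x k)) ⊗ G) N ≡ sumV m n (λ x → (F x ⊗ G) N)
    sum-⊗ m n F G zero = trans (⊗-at-0 _ G) (trans (∧-comm _ (G 0)) (trans (sym (sum-∧ m n (G 0) _)) (sum-cong m n λ x _ → trans (∧-comm (G 0) _) (sym (⊗-at-0 (F x) G)))))
    sum-⊗ m n F G (suc N) = trans (⊗-at-suc _ G N) (trans (cong₂ _xor_
      (trans (∧-comm _ (G (suc N))) (trans (sym (sum-∧ m n (G (suc N)) _)) (sum-cong m n λ x _ → ∧-comm (G (suc N)) (F x 0))))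
      (sum-⊗ m n (tl ∘ F) G N)) (trans (sym (sum-xor m n _ _)) (sum-cong m n λ x _ → sym (⊗-at-suc (F x) G N))))

    cmono-⊗ : ∀ c a G N → ((λ k → c ∧ mono a k) ⊗ G) N ≡ c ∧ (mono a ⊗ G) N
    cmono-⊗ true a G N = refl
    cmono-⊗ false a G N = trans (⊗-local {B = G} {B' = G} N (λ i _ → sym (𝟘-at i)) (λ _ _ → refl)) (⊗-zeroˡ′ G N)

  Gen-⊗ : ∀ m w w' (A B : VV m → Bool) → (∀ x → A x ≡ true → InB m (w x) x) → (∀ x → B x ≡ true → InB m (w' x) x)
    → Gen m w A ⊗ Gen m w' B ≈ Gen (suc m) (λ p → w (proj₁ p) + w' (proj₂ p)) (λ p → A (proj₁ p) ∧ B (proj₂ p))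
  Gen-⊗ m w w' A B bA bB = pw λ N → begin
    (Gen m w A ⊗ Gen m w' B) N ≡⟨ ⊗-local N (λ k le → Gen-box m w A N k bA le) (λ k le → Gen-box m w' B N k bB le) ⟩
    (_ ⊗ GB N) N ≡⟨ sum-⊗ m N (λ x k → A x ∧ mono (w x) k) (GB N) N ⟩
    sumV m N (λ x → ((λ k → A x ∧ mono (w x) k) ⊗ GB N) N) ≡⟨ sum-cong m N (λ x _ → inner x N) ⟩
    _ ∎
    where
    open ≡-Reasoning
    GB : ℕ → Ser
    GB N k = sumV m N (λ y → B y ∧ mono (w' y) k)
    inner : ∀ x N → ((λ k → A x ∧ mono (w x) k) ⊗ GB N) N ≡ sumV m N (λ y → (A x ∧ B y) ∧ mono (w x + w' y) N)
    inner x N = begin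
      _ ≡⟨ cmono-⊗ (A x) (w x) (GB N) N ⟩
      A x ∧ (mono (w x) ⊗ GB N) N ≡⟨ cong (A x ∧_) (trans (⊗-comm′ (mono (w x)) (GB N) N) (sum-⊗ m N (λ y k → B y ∧ mono (w' y) k) (mono (w x)) N)) ⟩
      A x ∧ sumV m N (λ y → ((λ k → B y ∧ mono (w' y) k) ⊗ mono (w x)) N) ≡⟨ sym (sum-∧ m N (A x) _) ⟩
      sumV m N (λ y → A x ∧ ((λ k → B y ∧ mono (w' y) k) ⊗ mono (w x)) N) ≡⟨ sum-cong m N (λ y _ → trans (cong (A x ∧_)
          (trans (cmono-⊗ (B y) (w' y) (mono (w x)) N) (cong (B y ∧_) (trans (⊗-comm′ (mono (w' y)) (mono (w x)) N) (at (mono-+ (w x) (w' y)) N)))))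
          (sym (∧-assoc (A x) (B y) _))) ⟩
      _ ∎

  -- A sum of translates of `G`, one for each point; the count of zeros of `G` starts from this
  -- form.
  Gen-⊗-at : ∀ m w (C : VV m → Bool) G N → (∀ x → C x ≡ true → InB m (w x) x) → (Gen m w C ⊗ G) N ≡ sumV m N (λ x → C x ∧ (mono (w x) ⊗ G) N)
  Gen-⊗-at m w C G N b = trans (⊗-local {B = G} {B' = G} N (λ k le → Gen-box m w C N k b le) (λ _ _ → refl))
    (trans (sum-⊗ m N (λ x k → C x ∧ mono (w x) k) G N) (sum-cong m N λ x _ → cmono-⊗ (C x) (w x) G N))

-- Congruences modulo q^(K+1) and infinite products

infix 4 _≈[_]_
record _≈[_]_ (A : Ser) (K : ℕ) (B : Ser) : Set where
  constructor pwK
  field atK : ∀ n → n ≤ K → A n ≡ B n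
open _≈[_]_ public

K-from : ∀ {A B K} → A ≈ B → A ≈[ K ] B
K-from p = pwK λ n _ → at p n

K-to : ∀ {A B} → (∀ K → A ≈[ K ] B) → A ≈ B
K-to h = pw λ n → atK (h n) n ℕ.≤-refl

K-refl : ∀ {A K} → A ≈[ K ] A
K-refl = K-from ≈-refl

K-sym : ∀ {A B K} → A ≈[ K ] B → B ≈[ K ] A
K-sym p = pwK λ n le → sym (atK p n le)

K-trans : ∀ {A B C K} → A ≈[ K ] B → B ≈[ K ] C → A ≈[ K ] C
K-trans p r = pwK λ n le → trans (atK p n le) (atK r n le)

K-⊗ : ∀ {A A' B B' K} → A ≈[ K ] A' → B ≈[ K ] B' → A ⊗ B ≈[ K ] A' ⊗ B'
K-⊗ p r = pwK λ n le → ⊗-local n (λ i l → atK p i (ℕ.≤-trans l le)) (λ i l → atK r i (ℕ.≤-trans l le))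

K-⊕ : ∀ {A A' B B' K} → A ≈[ K ] A' → B ≈[ K ] B' → A ⊕ B ≈[ K ] A' ⊕ B'
K-⊕ {A} {A'} {B} {B'} p r = pwK λ n le → trans (⊕-at A B n) (trans (cong₂ _xor_ (atK p n le) (atK r n le)) (sym (⊕-at A' B' n)))

K-mono : ∀ {a K} → K < a → mono a ≈[ K ] 𝟘
K-mono {a} {K} lt = pwK λ n le → trans (mono-no a n λ { refl → ℕ.<-irrefl refl (ℕ.<-≤-trans lt le) }) (sym (𝟘-at n))

opaque
  unfolding _⊕_

  lead-⊗ : ∀ A X n → (∀ i → i < n → X i ≡ false) → (A ⊗ X) n ≡ A 0 ∧ X n
  lead-⊗ A X zero _ = refl
  lead-⊗ A X (suc n) h = trans (cong ((A 0 ∧ X (suc n)) xor_) (trans (⊗-local {tl A} {tl A} {X} {𝟘} n (λ _ _ → refl) (λ i le → h i (s≤s le))) (⊗-zeroʳ′ (tl A) n))) (xor-identityʳ _)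

  -- The first nonzero coefficient of `X` would reappear in `A ⊗ X`, as `A 0` is 1.
  unit-zero : ∀ A X K → A 0 ≡ true → (∀ n → n ≤ K → (A ⊗ X) n ≡ false) → ∀ n → n ≤ K → X n ≡ false
  unit-zero A X K a h n le = go n n ℕ.≤-refl le
    where
    go : ∀ b n → n ≤ b → n ≤ K → X n ≡ false
    go b n le leK = trans (trans (cong (_∧ X n) (sym a)) (sym (lead-⊗ A X n (low b n le leK)))) (h n leK)
      where
      low : ∀ b n → n ≤ b → n ≤ K → ∀ i → i < n → X i ≡ false
      low (suc b) n le leK i lt = go b i (ℕ.≤-pred (ℕ.≤-trans lt le)) (ℕ.≤-trans (ℕ.<⇒≤ lt) leK)
      low zero n le leK i lt = ⊥-elim (ℕ.<⇒≱ lt (ℕ.≤-trans le z≤n))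

  xor-false⇒≡ : ∀ a b → a xor b ≡ false → a ≡ b
  xor-false⇒≡ true true _ = refl
  xor-false⇒≡ false false _ = refl

  unit-cancelK : ∀ A {X Y K} → A 0 ≡ true → A ⊗ X ≈[ K ] A ⊗ Y → X ≈[ K ] Y
  unit-cancelK A {X} {Y} {K} a p = pwK λ n le → xor-false⇒≡ (X n) (Y n) (unit-zero A (X ⊕ Y) K a
    (λ i l → trans (⊗-distribˡ′ A X Y i) (trans (cong ((A ⊗ X) i xor_) (sym (atK p i l))) (xor-same ((A ⊗ X) i)))) n le)

unit-cancel : ∀ A {X Y} → A 0 ≡ true → A ⊗ X ≈ A ⊗ Y → X ≈ Y
unit-cancel A a p = K-to λ K → unit-cancelK A a (K-from p)

opaque
  Pr : (ℕ → ℕ) → ℕ → Ser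
  Pr e zero = 𝟙
  Pr e (suc k) = Pr e k ⊗ (𝟙 ⊕ mono (e k))

  Pr-0 : ∀ e → Pr e 0 ≈ 𝟙
  Pr-0 e = ≈-refl

  Pr-suc : ∀ e k → Pr e (suc k) ≈ Pr e k ⊗ (𝟙 ⊕ mono (e k))
  Pr-suc e k = ≈-refl

  Pr-cons : ∀ e k → Pr e (suc k) ≈ (𝟙 ⊕ mono (e 0)) ⊗ Pr (e ∘ suc) k
  Pr-cons e zero = R.*-comm _ _
  Pr-cons e (suc k) = ≈-trans (R.*-congʳ (Pr-cons e k)) (R.*-assoc _ _ _)

Growing : (ℕ → ℕ) → Set
Growing e = ∀ i → i < e i

-- Π_i (1 + q^{e i}); for e i > i the factors with i ≥ n do not affect the n-th coefficient
Inf : (ℕ → ℕ) → Ser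
Inf e n = Pr e n n

Pr-stable : ∀ {e} → Growing e → ∀ {K k} → K ≤ k → Pr e (suc k) ≈[ K ] Pr e k
Pr-stable {e} g {K} {k} le = K-trans (K-from (Pr-suc e k)) (K-trans (K-⊗ K-refl (K-⊕ K-refl (K-mono (ℕ.≤-<-trans le (g k)))))
  (K-from (≈-trans (R.*-congˡ (R.+-identityʳ 𝟙)) (R.*-identityʳ _))))

Inf≈Pr : ∀ {e} → Growing e → ∀ {K k} → K ≤ k → Inf e ≈[ K ] Pr e k
Inf≈Pr {e} g {K} {k} le = pwK λ n l → sym (go n k (ℕ.≤-trans l le))
  where
  go : ∀ n k → n ≤ k → Pr e k n ≡ Pr e n n
  go n k le with ℕ.m≤n⇒m<n∨m≡n le
  ... | inj₂ refl = refl
  go n (suc k) le | inj₁ (s≤s le') = trans (atK (Pr-stable g le') n ℕ.≤-refl) (go n k le')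

Pr-unit : ∀ e → Growing e → ∀ k → Pr e k 0 ≡ true
Pr-unit e g zero = trans (at (Pr-0 e) 0) 𝟙-at-0
Pr-unit e g (suc k) = trans (atK (Pr-stable g {0} {k} z≤n) 0 z≤n) (Pr-unit e g k)

Inf-unit : ∀ {e} → Growing e → Inf e 0 ≡ true
Inf-unit {e} g = Pr-unit e g 0

Inf-cong : ∀ {e e'} → (∀ i → e i ≡ e' i) → Inf e ≈ Inf e'
Inf-cong {e} {e'} h = pw λ n → at (go n) n
  where
  go : ∀ k → Pr e k ≈ Pr e' k
  go zero = ≈-trans (Pr-0 e) (≈-sym (Pr-0 e'))
  go (suc k) = ≈-trans (Pr-suc e k) (≈-trans (R.*-cong (go k) (R.+-congˡ (subst (λ z → mono (e k) ≈ mono z) (h k) ≈-refl))) (≈-sym (Pr-suc e' k)))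

Inf-V : ∀ k .{{_ : NonZero k}} e → Growing e → V k (Inf e) ≈ Inf (λ i → k * e i)
Inf-V k e g = K-to λ K → K-trans (VK K (Inf≈Pr g (ℕ.≤-refl {K}))) (K-trans (K-from (go K)) (K-sym (Inf≈Pr g' ℕ.≤-refl)))
  where
  g' : Growing (λ i → k * e i)
  g' i = ℕ.<-≤-trans (g i) (ℕ.m≤n*m (e i) k)
  V𝟙 : V k 𝟙 ≈ 𝟙
  V𝟙 = ≈-trans (V-cong k (≈-sym mono-0)) (≈-trans (V-mono k 0) (subst (λ z → mono z ≈ 𝟙) (sym (ℕ.*-zeroʳ k)) mono-0))
  go : ∀ n → V k (Pr e n) ≈ Pr (λ i → k * e i) n
  go zero = ≈-trans (V-cong k (Pr-0 e)) (≈-trans V𝟙 (≈-sym (Pr-0 _)))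
  go (suc n) = ≈-trans (V-cong k (Pr-suc e n)) (≈-trans (V-⊗ k _ _) (≈-trans (R.*-cong (go n) (≈-trans (V-⊕ k _ _) (R.+-cong V𝟙 (V-mono k (e n))))) (≈-sym (Pr-suc _ n))))
  VK : ∀ {A B} K → A ≈[ K ] B → V k A ≈[ K ] V k B
  VK {A} {B} K p = pwK λ n le → case n le
    where
    case : ∀ n → n ≤ K → V k A n ≡ V k B n
    case n le with k ∣? n
    ... | no ¬d = trans (V-supp k A n ¬d) (sym (V-supp k B n ¬d))
    ... | yes (divides q refl) rewrite ℕ.*-comm q k = trans (V-* k A q) (trans (atK p q (ℕ.≤-trans (ℕ.m≤n*m q k) le)) (sym (V-* k B q)))

-- Σ_{j+m=n} F j m
opaque
  AS : ℕ → (ℕ → ℕ → Ser) → Ser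
  AS zero F = F 0 0
  AS (suc n) F = F 0 (suc n) ⊕ AS n (λ j m → F (suc j) m)

  AS-cong : ∀ n {F G} → (∀ j m → j + m ≡ n → F j m ≈ G j m) → AS n F ≈ AS n G
  AS-cong zero h = h 0 0 refl
  AS-cong (suc n) h = R.+-cong (h 0 (suc n) refl) (AS-cong n λ j m e → h (suc j) m (cong suc e))

  AS-⊗ : ∀ n A F → A ⊗ AS n F ≈ AS n (λ j m → A ⊗ F j m)
  AS-⊗ zero A F = ≈-refl
  AS-⊗ (suc n) A F = ≈-trans (R.distribˡ _ _ _) (R.+-congˡ (AS-⊗ n A _))

  AS-last : ∀ n F → AS (suc n) F ≈ AS n (λ j m → F j (suc m)) ⊕ F (suc n) 0
  AS-last zero F = ≈-refl
  AS-last (suc n) F = ≈-trans (R.+-congˡ (AS-last n (λ j → F (suc j)))) (≈-sym (R.+-assoc _ _ _))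

  -- The bookkeeping of Pascal's rule: the edge `F 0 m` comes from `P` alone, the edge `F j 0` from
  -- `Q` alone, and the interior from both.
  AS-merge : ∀ n (P Q F : ℕ → ℕ → Ser) → (∀ m → F 0 (suc m) ≈ P 0 (suc m)) → (∀ j → F (suc j) 0 ≈ Q (suc j) 0)
    → (∀ j m → F (suc j) (suc m) ≈ P (suc j) (suc m) ⊕ Q (suc j) (suc m))
    → AS n (λ j m → P j (suc m)) ⊕ AS n (λ j m → Q (suc j) m) ≈ AS (suc n) F
  AS-merge zero P Q F h0 h1 h2 = R.+-cong (≈-sym (h0 0)) (≈-sym (h1 0))
  AS-merge (suc n) P Q F h0 h1 h2 = begin
    (P 0 (2 + n) ⊕ AS n (λ j m → P (suc j) (suc m))) ⊕ AS (suc n) (λ j m → Q (suc j) m)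
      ≈⟨ R.+-congˡ (AS-last n (λ j → Q (suc j))) ⟩
    (P 0 (2 + n) ⊕ AS n (λ j m → P (suc j) (suc m))) ⊕ (AS n (λ j m → Q (suc j) (suc m)) ⊕ Q (2 + n) 0)
      ≈⟨ lem _ _ _ _ ⟩
    P 0 (2 + n) ⊕ ((AS n (λ j m → P (suc j) (suc m)) ⊕ AS n (λ j m → Q (suc j) (suc m))) ⊕ Q (2 + n) 0)
      ≈⟨ R.+-cong (≈-sym (h0 (suc n))) (R.+-cong (≈-trans (AS-⊕ n _ _) (AS-cong n λ j m _ → ≈-sym (h2 j m))) (≈-sym (h1 (suc n)))) ⟩
    F 0 (2 + n) ⊕ (AS n (λ j m → F (suc j) (suc m)) ⊕ F (2 + n) 0) ≈⟨ R.+-congˡ (≈-sym (AS-last n (λ j → F (suc j)))) ⟩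
    AS (2 + n) F ∎
    where
    open ≈R
    lem : ∀ a b c d → (a ⊕ b) ⊕ (c ⊕ d) ≈ a ⊕ ((b ⊕ c) ⊕ d)
    lem = solve 4 (λ a b c d → (a :+ b) :+ (c :+ d) := a :+ ((b :+ c) :+ d)) R.refl
    lem2 : ∀ a b c d → (a ⊕ b) ⊕ (c ⊕ d) ≈ (a ⊕ c) ⊕ (b ⊕ d)
    lem2 = solve 4 (λ a b c d → (a :+ b) :+ (c :+ d) := (a :+ c) :+ (b :+ d)) R.refl
    AS-⊕ : ∀ n F G → AS n F ⊕ AS n G ≈ AS n (λ j m → F j m ⊕ G j m)
    AS-⊕ zero F G = ≈-refl
    AS-⊕ (suc n) F G = ≈-trans (lem2 _ _ _ _) (R.+-congˡ (AS-⊕ n _ _))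

-- Gaussian binomials and the triple product

-- j (j - 1) / 2, so that `tri 1` is 0.
tri : ℕ → ℕ
tri zero = 0
tri (suc j) = tri j + j

mono-≡ : ∀ {a b} → a ≡ b → mono a ≈ mono b
mono-≡ refl = ≈-refl

-- Gaussian binomials [j+m choose j] in Q = q^A and the Jacobi triple product
module Gauss (A : ℕ) where

  gb : ℕ → ℕ → Ser
  gb zero m = 𝟙
  gb (suc j) zero = 𝟙
  gb (suc j) (suc m) = gb j (suc m) ⊕ mono (A * suc j) ⊗ gb (suc j) m

  gb-0 : ∀ j → gb j 0 ≈ 𝟙
  gb-0 zero = ≈-refl
  gb-0 (suc j) = ≈-refl

  -- The product of q^c + Q^i over t ≤ i < t + n. The free variable of the q-binomial theorem is
  -- specialised to q^c, which keeps everything in one variable.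
  Gp : ℕ → ℕ → ℕ → Ser
  Gp c zero t = 𝟙
  Gp c (suc n) t = (mono c ⊕ mono (A * t)) ⊗ Gp c n (suc t)

  T : ℕ → ℕ → ℕ → ℕ → Ser
  T c t j m = mono (A * (tri j + t * j) + c * m) ⊗ gb j m

  private
    shift : ∀ a {b d X} → a + b ≡ d → mono a ⊗ (mono b ⊗ X) ≈ mono d ⊗ X
    shift a {b} e = ≈-trans (≈-sym (R.*-assoc _ _ _)) (R.*-congʳ (≈-trans (mono-+ a b) (mono-≡ e)))

  -- The two summands of the first factor produce the two summands in the recursion of `gb`.
  q-binomial : ∀ c n t → Gp c n t ≈ AS n (T c t)
  q-binomial c zero t = ≈-trans (≈-sym (≈-trans (R.*-congʳ (≈-trans (mono-≡ (lem A t c)) mono-0)) (R.*-identityˡ _))) (AS-0 (T c t))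
    where
    lem : ∀ A t c → A * (0 + t * 0) + c * 0 ≡ 0
    lem = NS.solve-∀
    opaque
      unfolding AS
      AS-0 : ∀ F → F 0 0 ≈ AS 0 F
      AS-0 F = ≈-refl
  q-binomial c (suc n) t = begin
    (mono c ⊕ mono (A * t)) ⊗ Gp c n (suc t) ≈⟨ R.*-congˡ (q-binomial c n (suc t)) ⟩
    (mono c ⊕ mono (A * t)) ⊗ AS n (T c (suc t)) ≈⟨ R.distribʳ _ _ _ ⟩
    mono c ⊗ AS n (T c (suc t)) ⊕ mono (A * t) ⊗ AS n (T c (suc t)) ≈⟨ R.+-cong (AS-⊗ n _ _) (AS-⊗ n _ _) ⟩
    AS n (λ j m → mono c ⊗ T c (suc t) j m) ⊕ AS n (λ j m → mono (A * t) ⊗ T c (suc t) j m)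
      ≈⟨ AS-merge n P Q (T c t) h0 h1 h2 ⟩
    AS (suc n) (T c t) ∎
    where
    open ≈R
    P Q : ℕ → ℕ → Ser
    P j zero = 𝟘
    P j (suc m) = mono c ⊗ T c (suc t) j m
    Q zero m = 𝟘
    Q (suc j) m = mono (A * t) ⊗ T c (suc t) j m
    e0 : ∀ A c t m → c + (A * (0 + suc t * 0) + c * m) ≡ A * (0 + t * 0) + c * suc m
    e0 = NS.solve-∀
    h0 : ∀ m → T c t 0 (suc m) ≈ P 0 (suc m)
    h0 m = ≈-sym (shift c (e0 A c t m))
    e1 : ∀ A c t j x m → A * t + (A * (x + suc t * j) + c * m) ≡ A * ((x + j) + t * suc j) + c * m
    e1 = NS.solve-∀
    h1 : ∀ j → T c t (suc j) 0 ≈ Q (suc j) 0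
    h1 j = ≈-sym (≈-trans (shift (A * t) (e1 A c t j (tri j) 0)) (R.*-congˡ (gb-0 j)))
    e2 : ∀ A c t j x m → (A * (x + j + t * suc j) + c * suc m) + A * suc j ≡ c + (A * (x + j + suc t * suc j) + c * m)
    e2 = NS.solve-∀
    h2 : ∀ j m → T c t (suc j) (suc m) ≈ P (suc j) (suc m) ⊕ Q (suc j) (suc m)
    h2 j m = ≈-trans (R.distribˡ _ _ _) (≈-trans (R.+-cong
      (≈-sym (shift (A * t) (e1 A c t j (tri j) (suc m))))
      (≈-trans (shift _ (e2 A c t j (tri j) m)) (≈-sym (shift c refl)))) (R.+-comm _ _))

  qf : ℕ → Ser
  qf = Pr (λ i → A * suc i)

  -- The step is (1 + x) + x (1 + y) = 1 + x y for x = Q^(j+1) and y = Q^(m+1). The identity gives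
  -- the limit of `gb j m` for large `j` and `m`.
  gb-qf : ∀ j m → gb j m ⊗ (qf j ⊗ qf m) ≈ qf (j + m)
  gb-qf zero m = ≈-trans (R.*-identityˡ _) (≈-trans (R.*-congʳ (Pr-0 _)) (R.*-identityˡ _))
  gb-qf (suc j) zero = ≈-trans (R.*-identityˡ _) (≈-trans (R.*-congˡ (Pr-0 _)) (≈-trans (R.*-identityʳ _) (subst (λ z → qf (suc j) ≈ qf (suc z)) (sym (ℕ.+-identityʳ j)) ≈-refl)))
  gb-qf (suc j) (suc m) = begin
    (gb j (suc m) ⊕ x ⊗ gb (suc j) m) ⊗ (qf (suc j) ⊗ qf (suc m))
      ≈⟨ R.distribʳ _ _ _ ⟩
    gb j (suc m) ⊗ (qf (suc j) ⊗ qf (suc m)) ⊕ (x ⊗ gb (suc j) m) ⊗ (qf (suc j) ⊗ qf (suc m))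
      ≈⟨ R.+-cong (R.*-congˡ (R.*-congʳ (Pr-suc _ j))) (R.*-congˡ (R.*-congˡ (Pr-suc _ m))) ⟩
    gb j (suc m) ⊗ ((qf j ⊗ (𝟙 ⊕ x)) ⊗ qf (suc m)) ⊕ (x ⊗ gb (suc j) m) ⊗ (qf (suc j) ⊗ (qf m ⊗ (𝟙 ⊕ y)))
      ≈⟨ solve 8 (λ g g' p p' s s' x y → g :* ((p :* (con true :+ x)) :* s') :+ (x :* g') :* (p' :* (s :* (con true :+ y)))
           := (g :* (p :* s')) :* (con true :+ x) :+ (g' :* (p' :* s)) :* (x :* (con true :+ y))) R.refl
           (gb j (suc m)) (gb (suc j) m) (qf j) (qf (suc j)) (qf m) (qf (suc m)) x y ⟩
    (gb j (suc m) ⊗ (qf j ⊗ qf (suc m))) ⊗ (𝟙 ⊕ x) ⊕ (gb (suc j) m ⊗ (qf (suc j) ⊗ qf m)) ⊗ (x ⊗ (𝟙 ⊕ y))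
      ≈⟨ R.+-cong (R.*-congʳ (gb-qf j (suc m))) (R.*-congʳ (gb-qf (suc j) m)) ⟩
    qf (j + suc m) ⊗ (𝟙 ⊕ x) ⊕ qf (suc j + m) ⊗ (x ⊗ (𝟙 ⊕ y))
      ≈⟨ R.+-congˡ (R.*-congʳ (subst (λ z → qf (suc j + m) ≈ qf z) (sym (ℕ.+-suc j m)) ≈-refl)) ⟩
    qf (j + suc m) ⊗ (𝟙 ⊕ x) ⊕ qf (j + suc m) ⊗ (x ⊗ (𝟙 ⊕ y))
      ≈⟨ solve 3 (λ p x y → p :* (con true :+ x) :+ p :* (x :* (con true :+ y)) := p :* (con true :+ x :* y)) R.refl (qf (j + suc m)) x y ⟩
    qf (j + suc m) ⊗ (𝟙 ⊕ x ⊗ y) ≈⟨ R.*-congˡ (R.+-congˡ (≈-trans (mono-+ _ _) (mono-≡ (e A j m)))) ⟩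
    qf (j + suc m) ⊗ (𝟙 ⊕ mono (A * suc (j + suc m))) ≈⟨ ≈-sym (Pr-suc _ _) ⟩
    qf (suc (j + suc m)) ∎
    where
    open ≈R
    x = mono (A * suc j)
    y = mono (A * suc m)
    e : ∀ A j m → A * suc j + A * suc m ≡ A * suc (j + suc m)
    e = NS.solve-∀

Pr-cong : ∀ {e e'} → (∀ i → e i ≡ e' i) → ∀ k → Pr e k ≈ Pr e' k
Pr-cong {e} {e'} h zero = ≈-trans (Pr-0 e) (≈-sym (Pr-0 e'))
Pr-cong {e} {e'} h (suc k) = ≈-trans (Pr-suc e k) (≈-trans (R.*-cong (Pr-cong h k) (R.+-congˡ (mono-≡ (h k)))) (≈-sym (Pr-suc e' k)))

opaque
  unfolding AS _⊕_

  -- Recentres the sum at j = N + k, m = N - k. Each step of the induction splits off the two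
  -- outermost terms.
  AS-sumZ : ∀ N F K (φ : ℤ → Bool) → (∀ k → k ≤ N → F (N + k) (N ∸ k) K ≡ φ (+ k)) → (∀ k → suc k ≤ N → F (N ∸ suc k) (N + suc k) K ≡ φ -[1+ k ])
    → AS (N + N) F K ≡ sumZ N φ
  AS-sumZ zero F K φ hp hn = hp 0 z≤n
  AS-sumZ (suc N) F K φ hp hn rewrite ℕ.+-suc N N = begin
    F 0 (2 + (N + N)) K xor AS (suc (N + N)) (λ j → F (suc j)) K
      ≡⟨ cong (F 0 (2 + (N + N)) K xor_) (at (AS-last (N + N) (λ j → F (suc j))) K) ⟩
    F 0 (2 + (N + N)) K xor (AS (N + N) (λ j m → F (suc j) (suc m)) K xor F (2 + (N + N)) 0 K)
      ≡⟨ cong₂ (λ a b → a xor (b xor F (2 + (N + N)) 0 K)) bot (AS-sumZ N _ K φ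
           (λ k le → trans (cong (λ z → F (suc (N + k)) z K) (sym (ℕ.+-∸-assoc 1 le))) (hp k (ℕ.m≤n⇒m≤1+n le)))
           (λ k le → trans (cong (λ z → F z (suc (N + suc k)) K) (sym (ℕ.+-∸-assoc 1 le))) (hn k (ℕ.m≤n⇒m≤1+n le)))) ⟩
    φ -[1+ N ] xor (sumZ N φ xor F (2 + (N + N)) 0 K) ≡⟨ cong (λ z → φ -[1+ N ] xor (sumZ N φ xor z)) top ⟩
    φ -[1+ N ] xor (sumZ N φ xor φ (+ suc N)) ≡⟨ lem (φ -[1+ N ]) (sumZ N φ) (φ (+ suc N)) ⟩
    sumZ N φ xor (φ (+ suc N) xor φ -[1+ N ]) ∎
    where
    open ≡-Reasoning
    top : F (2 + (N + N)) 0 K ≡ φ (+ suc N)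
    top = trans (cong₂ (λ a b → F a b K) (cong suc (sym (ℕ.+-suc N N))) (sym (ℕ.n∸n≡0 N))) (hp (suc N) ℕ.≤-refl)
    bot : F 0 (2 + (N + N)) K ≡ φ -[1+ N ]
    bot = trans (cong₂ (λ a b → F a b K) (sym (ℕ.n∸n≡0 N)) (cong suc (sym (ℕ.+-suc N N)))) (hn N ℕ.≤-refl)
    lem : ∀ a b c → a xor (b xor c) ≡ b xor (c xor a)
    lem a b c = trans (xor-comm a (b xor c)) (xor-assoc b c a)

-- A y (y - 1) / 2 + B y for y ∈ ℤ, where B' = A - B
jt : ℕ → ℕ → ℕ → ℤ → ℕ
jt A B B' (+ k) = A * tri k + B * k
jt A B B' -[1+ k ] = A * tri (suc k) + B' * suc k

tri-+ : ∀ m k → tri (m + k) ≡ tri m + (m * k + tri k)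
tri-+ m zero = trans (cong tri (ℕ.+-identityʳ m)) (sym (trans (cong (λ z → tri m + (z + 0)) (ℕ.*-zeroʳ m)) (ℕ.+-identityʳ _)))
tri-+ m (suc k) = trans (cong tri (ℕ.+-suc m k)) (trans (cong (ℕ._+ (m + k)) (tri-+ m k)) (lem m k (tri m) (tri k)))
  where
  lem : ∀ m k x y → x + (m * k + y) + (m + k) ≡ x + (m * suc k + (y + k))
  lem = NS.solve-∀

tri-sq : ∀ k → k * k ≡ (tri k + tri k) + k
tri-sq zero = refl
tri-sq (suc k) = trans (lem1 k) (trans (cong (ℕ._+ (k + k + 1)) (tri-sq k)) (lem2 k (tri k)))
  where
  lem1 : ∀ k → suc k * suc k ≡ k * k + (k + k + 1)
  lem1 = NS.solve-∀
  lem2 : ∀ k t → t + t + k + (k + k + 1) ≡ (t + k) + (t + k) + suc k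
  lem2 = NS.solve-∀

module Jacobi (A B B' : ℕ) (A≡ : A ≡ B' + B) (0<B : 0 < B) (0<B' : 0 < B') where
  open Gauss A

  private
    0<A : 0 < A
    0<A = subst (0 <_) (sym A≡) (ℕ.<-≤-trans 0<B' (ℕ.m≤m+n B' B))

    instance
      nzA : NonZero A
      nzA = ℕ.>-nonZero 0<A

    -- The factors beyond the middle: there q^c is the lower power and comes out of each of them.
    Gp-high : ∀ c n t b → A * t ≡ c + b → Gp c n t ≈ mono (c * n) ⊗ Pr (λ i → A * i + b) n
    Gp-high c zero t b e = ≈-sym (≈-trans (R.*-cong (≈-trans (mono-≡ (ℕ.*-zeroʳ c)) mono-0) (Pr-0 _)) (R.*-identityˡ _))
    Gp-high c (suc n) t b e = begin
      (mono c ⊕ mono (A * t)) ⊗ Gp c n (suc t)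
        ≈⟨ R.*-cong (R.+-congˡ (≈-trans (mono-≡ e) (≈-sym (mono-+ c b)))) (Gp-high c n (suc t) (A + b) (trans (ℕ.*-suc A t) (trans (cong (A ℕ.+_) e) (l1 A c b)))) ⟩
      (mono c ⊕ mono c ⊗ mono b) ⊗ (mono (c * n) ⊗ Pr (λ i → A * i + (A + b)) n)
        ≈⟨ solve 4 (λ x y z p → (x :+ x :* y) :* (z :* p) := (x :* z) :* ((con true :+ y) :* p)) R.refl (mono c) (mono b) (mono (c * n)) (Pr (λ i → A * i + (A + b)) n) ⟩
      (mono c ⊗ mono (c * n)) ⊗ ((𝟙 ⊕ mono b) ⊗ Pr (λ i → A * i + (A + b)) n)
        ≈⟨ R.*-cong (≈-trans (mono-+ _ _) (mono-≡ (sym (ℕ.*-suc c n)))) (R.*-cong (R.+-congˡ (mono-≡ (cong (ℕ._+ b) (sym (ℕ.*-zeroʳ A))))) (Pr-cong (λ i → l2 A i b) n)) ⟩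
      mono (c * suc n) ⊗ ((𝟙 ⊕ mono (A * 0 + b)) ⊗ Pr (λ i → A * suc i + b) n) ≈⟨ R.*-congˡ (≈-sym (Pr-cons _ n)) ⟩
      _ ∎
      where
      open ≈R
      l1 : ∀ A c b → A + (c + b) ≡ c + (A + b)
      l1 = NS.solve-∀
      l2 : ∀ A i b → A * i + (A + b) ≡ A * suc i + b
      l2 = NS.solve-∀

    Gp-shift : ∀ c n t → Gp (A + c) n (suc t) ≈ mono (A * n) ⊗ Gp c n t
    Gp-shift c zero t = ≈-sym (≈-trans (R.*-identityʳ _) (≈-trans (mono-≡ (ℕ.*-zeroʳ A)) mono-0))
    Gp-shift c (suc n) t = begin
      (mono (A + c) ⊕ mono (A * suc t)) ⊗ Gp (A + c) n (2 + t)
        ≈⟨ R.*-cong (R.+-cong (≈-sym (mono-+ A c)) (≈-trans (mono-≡ (ℕ.*-suc A t)) (≈-sym (mono-+ A _)))) (Gp-shift c n (suc t)) ⟩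
      (mono A ⊗ mono c ⊕ mono A ⊗ mono (A * t)) ⊗ (mono (A * n) ⊗ Gp c n (suc t))
        ≈⟨ solve 5 (λ a x y z g → (a :* x :+ a :* y) :* (z :* g) := (a :* z) :* ((x :+ y) :* g)) R.refl (mono A) (mono c) (mono (A * t)) (mono (A * n)) (Gp c n (suc t)) ⟩
      (mono A ⊗ mono (A * n)) ⊗ ((mono c ⊕ mono (A * t)) ⊗ Gp c n (suc t)) ≈⟨ R.*-congʳ (≈-trans (mono-+ _ _) (mono-≡ (sym (ℕ.*-suc A n)))) ⟩
      mono (A * suc n) ⊗ Gp c (suc n) t ∎
      where open ≈R

    -- The factors below the middle: q^c + Q^i = Q^i (1 + q^(A (n - i) + B')) for c = A n + B'. They
    -- appear in reverse order, so the first factor of `Gp` becomes the last of `Pr`, and `Gp-shift`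
    -- handles the others.
    Gp-low : ∀ n → Gp (A * n + B') (suc n) 0 ≈ mono (A * tri (suc n)) ⊗ Pr (λ i → A * i + B') (suc n)
    Gp-low zero = begin
      (mono (A * 0 + B') ⊕ mono (A * 0)) ⊗ 𝟙 ≈⟨ R.*-identityʳ _ ⟩
      mono (A * 0 + B') ⊕ mono (A * 0) ≈⟨ R.+-congˡ (≈-trans (mono-≡ (ℕ.*-zeroʳ A)) mono-0) ⟩
      mono (A * 0 + B') ⊕ 𝟙 ≈⟨ solve 1 (λ x → x :+ con true := con true :* (con true :* (con true :+ x))) R.refl (mono (A * 0 + B')) ⟩
      𝟙 ⊗ (𝟙 ⊗ (𝟙 ⊕ mono (A * 0 + B'))) ≈⟨ ≈-sym (R.*-cong (≈-trans (mono-≡ (ℕ.*-zeroʳ A)) mono-0) (≈-trans (Pr-suc _ 0) (R.*-congʳ (Pr-0 _)))) ⟩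
      _ ∎
      where open ≈R
    Gp-low (suc n) = begin
      (mono (A * suc n + B') ⊕ mono (A * 0)) ⊗ Gp (A * suc n + B') (suc n) 1
        ≈⟨ R.*-cong (R.+-congˡ (≈-trans (mono-≡ (ℕ.*-zeroʳ A)) mono-0)) (Gp-≡ (l1 A n B') (suc n) 1) ⟩
      (mono (A * suc n + B') ⊕ 𝟙) ⊗ Gp (A + (A * n + B')) (suc n) 1
        ≈⟨ R.*-congˡ (≈-trans (Gp-shift _ (suc n) 0) (R.*-congˡ (Gp-low n))) ⟩
      (mono (A * suc n + B') ⊕ 𝟙) ⊗ (mono (A * suc n) ⊗ (mono (A * tri (suc n)) ⊗ P))
        ≈⟨ solve 4 (λ x y z p → (x :+ con true) :* (y :* (z :* p)) := (z :* y) :* (p :* (con true :+ x))) R.refl (mono (A * suc n + B')) (mono (A * suc n)) (mono (A * tri (suc n))) P ⟩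
      (mono (A * tri (suc n)) ⊗ mono (A * suc n)) ⊗ (P ⊗ (𝟙 ⊕ mono (A * suc n + B')))
        ≈⟨ R.*-cong (≈-trans (mono-+ _ _) (mono-≡ (sym (ℕ.*-distribˡ-+ A (tri (suc n)) (suc n))))) (≈-sym (Pr-suc _ (suc n))) ⟩
      _ ∎
      where
      open ≈R
      P = Pr (λ i → A * i + B') (suc n)
      l1 : ∀ A n b → A * suc n + b ≡ A + (A * n + b)
      l1 = NS.solve-∀
      Gp-≡ : ∀ {c c'} → c ≡ c' → ∀ n t → Gp c n t ≈ Gp c' n t
      Gp-≡ refl n t = ≈-refl

    Gp-split : ∀ c n n' t → Gp c (n + n') t ≈ Gp c n t ⊗ Gp c n' (t + n)
    Gp-split c zero n' t = ≈-sym (≈-trans (R.*-identityˡ _) (subst (λ z → Gp c n' z ≈ Gp c n' t) (sym (ℕ.+-identityʳ t)) ≈-refl))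
    Gp-split c (suc n) n' t = ≈-trans (R.*-congˡ (≈-trans (Gp-split c n n' (suc t)) (R.*-congˡ (subst (λ z → Gp c n' (suc (t + n)) ≈ Gp c n' z) (sym (ℕ.+-suc t n)) ≈-refl))))
      (≈-sym (R.*-assoc _ _ _))

    gφ : Growing (λ i → A * suc i)
    gφ i = ℕ.m≤n*m (suc i) A

    gb' : ∀ {b} → 0 < b → Growing (λ i → A * i + b)
    gb' {b} lt i = subst (_≤ A * i + b) (ℕ.+-comm i 1) (ℕ.+-mono-≤ (ℕ.m≤n*m i A) lt)

    φ : Ser
    φ = Inf (λ i → A * suc i)

    -- φ · [j+m choose j] = 1 up to order min j m
    φ-gb : ∀ {K} j m → K ≤ j → K ≤ m → φ ⊗ gb j m ≈[ K ] 𝟙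
    φ-gb {K} j m lj lm = unit-cancelK φ (Inf-unit gφ) (K-trans
      (K-from (solve 2 (λ p g → p :* (p :* g) := g :* (p :* p)) R.refl φ (gb j m)))
      (K-trans (K-⊗ K-refl (K-⊗ (Inf≈Pr gφ lj) (Inf≈Pr gφ lm)))
      (K-trans (K-from (gb-qf j m)) (K-trans (K-sym (Inf≈Pr gφ (ℕ.≤-trans lj (ℕ.m≤m+n j m)))) (K-from (≈-sym (R.*-identityʳ φ)))))))

    e : ℤ → ℕ
    e = jt A B B'

    e-big : ∀ x → ∣ x ∣ ≤ e x
    e-big (+ k) = ℕ.≤-trans (ℕ.m≤n*m k B {{ℕ.>-nonZero 0<B}}) (ℕ.m≤n+m (B * k) _)
    e-big -[1+ k ] = ℕ.≤-trans (ℕ.m≤n*m (suc k) B' {{ℕ.>-nonZero 0<B'}}) (ℕ.m≤n+m (B' * suc k) _)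

    module At (κ : ℕ) where
      -- For the coefficient `κ`, 2 `N` factors suffice: since N = 2 κ + 1, a term with exponent at
      -- most `κ` has `j` and `m` at least `κ`, where `φ-gb` applies. The choice of `c` makes Q^i
      -- the lower power in q^c + Q^i exactly for i < N.
      n = κ + κ
      N = suc n
      c = A * n + B'
      s = A * tri N + c * N
      PB = Pr (λ i → A * i + B) N
      PB' = Pr (λ i → A * i + B') N

      cB : A * N ≡ c + B
      cB = trans (ℕ.*-suc A n) (trans (cong (ℕ._+ A * n) A≡) (l (A * n) B' B))
        where
        l : ∀ x y z → y + z + x ≡ x + y + z
        l = NS.solve-∀

      whole : mono s ⊗ (φ ⊗ (PB' ⊗ PB)) ≈ AS (N + N) (λ j m → φ ⊗ T c 0 j m)
      whole = begin
        mono s ⊗ (φ ⊗ (PB' ⊗ PB)) ≈⟨ R.*-congʳ (≈-sym (mono-+ _ _)) ⟩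
        (mono (A * tri N) ⊗ mono (c * N)) ⊗ (φ ⊗ (PB' ⊗ PB))
          ≈⟨ solve 5 (λ a b p x y → (a :* b) :* (p :* (x :* y)) := p :* ((a :* x) :* (b :* y))) R.refl (mono (A * tri N)) (mono (c * N)) φ PB' PB ⟩
        φ ⊗ ((mono (A * tri N) ⊗ PB') ⊗ (mono (c * N) ⊗ PB)) ≈⟨ R.*-congˡ (R.*-cong (≈-sym (Gp-low n)) (≈-sym (Gp-high c N N B cB))) ⟩
        φ ⊗ (Gp c N 0 ⊗ Gp c N N) ≈⟨ R.*-congˡ (≈-sym (Gp-split c N N 0)) ⟩
        φ ⊗ Gp c (N + N) 0 ≈⟨ R.*-congˡ (q-binomial c (N + N) 0) ⟩
        φ ⊗ AS (N + N) (T c 0) ≈⟨ AS-⊗ (N + N) φ _ ⟩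
        _ ∎
        where open ≈R

      term : ∀ j m x → A * (tri j + 0) + c * m ≡ s + x → (x ≤ κ → κ ≤ j × κ ≤ m) → (φ ⊗ T c 0 j m) (s + κ) ≡ mono x κ
      term j m x eq h = begin
        (φ ⊗ T c 0 j m) (s + κ) ≡⟨ at (≈-trans (R.*-congˡ (R.*-congʳ (≈-trans (mono-≡ eq) (≈-sym (mono-+ s x)))))
          (solve 4 (λ p a b g → p :* ((a :* b) :* g) := a :* (b :* (p :* g))) R.refl φ (mono s) (mono x) (gb j m))) (s + κ) ⟩
        (mono s ⊗ (mono x ⊗ (φ ⊗ gb j m))) (s + κ) ≡⟨ mono-⊗-hi s _ κ ⟩
        (mono x ⊗ (φ ⊗ gb j m)) κ ≡⟨ last ⟩
        mono x κ ∎
        where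
        open ≡-Reasoning
        last : (mono x ⊗ (φ ⊗ gb j m)) κ ≡ mono x κ
        last with x ℕ.≤? κ
        ... | yes le = trans (atK (K-⊗ K-refl (φ-gb j m (proj₁ (h le)) (proj₂ (h le)))) κ ℕ.≤-refl) (at (R.*-identityʳ (mono x)) κ)
        ... | no ¬le = trans (mono-⊗-lo x _ κ (ℕ.≰⇒> ¬le)) (sym (mono-no x κ λ { refl → ¬le ℕ.≤-refl }))

      pos : ∀ k → k ≤ N → A * (tri (N + k) + 0) + c * (N ∸ k) ≡ s + e (+ k)
      pos k le = begin
        A * (tri (N + k) + 0) + c * M ≡⟨ cong (λ z → A * (z + 0) + c * M) (tri-+ N k) ⟩
        A * (tri N + (N * k + tri k) + 0) + c * M ≡⟨ l1 A c (tri N) N k (tri k) M ⟩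
        A * tri N + A * N * k + A * tri k + c * M ≡⟨ cong (λ z → A * tri N + z * k + A * tri k + c * M) cB ⟩
        A * tri N + (c + B) * k + A * tri k + c * M ≡⟨ l2 (A * tri N) c B k (A * tri k) M ⟩
        A * tri N + c * (k + M) + (A * tri k + B * k) ≡⟨ cong (λ z → A * tri N + c * z + (A * tri k + B * k)) (ℕ.m+[n∸m]≡n le) ⟩
        _ ∎
        where
        open ≡-Reasoning
        M = N ∸ k
        l1 : ∀ A c t N k u M → A * (t + (N * k + u) + 0) + c * M ≡ A * t + A * N * k + A * u + c * M
        l1 = NS.solve-∀
        l2 : ∀ t c B k u M → t + (c + B) * k + u + c * M ≡ t + c * (k + M) + (u + B * k)
        l2 = NS.solve-∀

      -- with N = M + k; both sides are increased by A M k + A tri k, so that no subtraction occurs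
      neg : ∀ k → k ≤ N → A * (tri (N ∸ k) + 0) + c * (N + k) ≡ s + (A * tri k + B' * k)
      neg k le = ℕ.+-cancelʳ-≡ (A * M * k + A * tri k) _ _ (begin
        A * (tri M + 0) + c * (N + k) + (A * M * k + A * tri k) ≡⟨ l1 A c (tri M) N k (tri k) M ⟩
        A * (tri M + (M * k + tri k)) + c * N + c * k ≡⟨ cong (λ z → A * z + c * N + c * k) (trans (sym (tri-+ M k)) (cong tri (ℕ.m∸n+n≡m le))) ⟩
        s + c * k ≡⟨ cong (s ℕ.+_) ck ⟩
        s + (A * tri k + B' * k + (A * M * k + A * tri k)) ≡⟨ sym (ℕ.+-assoc s _ _) ⟩
        _ ∎)
        where
        open ≡-Reasoning
        M = N ∸ k
        l1 : ∀ A c t N k u M → A * (t + 0) + c * (N + k) + (A * M * k + A * u) ≡ A * (t + (M * k + u)) + c * N + c * k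
        l1 = NS.solve-∀
        l2 : ∀ A B' M k → A * (M + k) * k + B' * k ≡ B' * k + A * M * k + A * (k * k)
        l2 = NS.solve-∀
        l3 : ∀ A B' M k u → B' * k + A * M * k + A * (u + u + k) ≡ A * u + B' * k + (A * M * k + A * u) + A * k
        l3 = NS.solve-∀
        l4 : ∀ A n B' k → (A * n + B') * k + A * k ≡ A * suc n * k + B' * k
        l4 = NS.solve-∀
        ck : c * k ≡ A * tri k + B' * k + (A * M * k + A * tri k)
        ck = ℕ.+-cancelʳ-≡ (A * k) _ _ (trans (l4 A n B' k) (trans (cong (λ z → A * z * k + B' * k) (sym (ℕ.m∸n+n≡m le)))
          (trans (l2 A B' M k) (trans (cong (λ z → B' * k + A * M * k + A * z) (tri-sq k)) (l3 A B' M k (tri k))))))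

      far : ∀ k x → k ≤ x → x ≤ κ → κ ≤ N ∸ k × κ ≤ N + k
      far k x kx xκ = ℕ.≤-trans (subst (_≤ κ + κ ∸ k) (ℕ.m+n∸n≡m κ κ) (ℕ.∸-monoʳ-≤ (κ + κ) (ℕ.≤-trans kx xκ))) (ℕ.∸-monoˡ-≤ k (ℕ.n≤1+n n))
                    , ℕ.≤-trans (ℕ.m≤m+n κ κ) (ℕ.≤-trans (ℕ.n≤1+n n) (ℕ.m≤m+n N k))

      result : (φ ⊗ (PB' ⊗ PB)) κ ≡ sumZ N (λ x → mono (e x) κ)
      result = trans (sym (mono-⊗-hi s _ κ)) (trans (at whole (s + κ)) (AS-sumZ N _ (s + κ) _
        (λ k le → term (N + k) (N ∸ k) (e (+ k)) (pos k le) λ xκ → let (p , r) = far k (e (+ k)) (e-big (+ k)) xκ in r , p)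
        (λ k le → term (N ∸ suc k) (N + suc k) (e -[1+ k ]) (neg (suc k) le) λ xκ → far (suc k) (e -[1+ k ]) (e-big -[1+ k ]) xκ)))

      κ≤N : κ ≤ N
      κ≤N = ℕ.≤-trans (ℕ.m≤m+n κ κ) (ℕ.n≤1+n n)

      final : (φ ⊗ (Inf (λ i → A * i + B') ⊗ Inf (λ i → A * i + B))) κ ≡ Gen 0 e (λ _ → true) κ
      final = trans (atK (K-⊗ K-refl (K-⊗ (Inf≈Pr (gb' 0<B') κ≤N) (Inf≈Pr (gb' 0<B) κ≤N))) κ ℕ.≤-refl)
        (trans result (sym (Gen-box 0 e (λ _ → true) N κ (λ x _ → e-big x) κ≤N)))

  triple-product : Inf (λ i → A * suc i) ⊗ (Inf (λ i → A * i + B') ⊗ Inf (λ i → A * i + B)) ≈ Gen 0 (jt A B B') (λ _ → true)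
  triple-product = pw At.final

  jt-big : ∀ x → ∣ x ∣ ≤ jt A B B' x
  jt-big = e-big

-- The pentagonal series and a cubic identity

Inf-merge₂ : ∀ {e₀ e e'} → Growing e₀ → Growing e → Growing e' → (∀ i → e₀ (i * 2) ≡ e i) → (∀ i → e₀ (suc (i * 2)) ≡ e' i) → Inf e₀ ≈ Inf e ⊗ Inf e'
Inf-merge₂ {e₀} {e} {e'} g₀ g g' h h' = K-to λ K → K-trans (Inf≈Pr g₀ (ℕ.m≤m*n K 2)) (K-trans (K-from (go K)) (K-sym (K-⊗ (Inf≈Pr g ℕ.≤-refl) (Inf≈Pr g' ℕ.≤-refl))))
  where
  go : ∀ n → Pr e₀ (n * 2) ≈ Pr e n ⊗ Pr e' n
  go zero = ≈-trans (Pr-0 _) (≈-sym (≈-trans (R.*-cong (Pr-0 _) (Pr-0 _)) (R.*-identityˡ _)))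
  go (suc n) = ≈-trans (≈-trans (Pr-suc _ _) (R.*-cong (≈-trans (Pr-suc _ _) (R.*-cong (go n) (R.+-congˡ (mono-≡ (h n))))) (R.+-congˡ (mono-≡ (h' n)))))
    (≈-trans (solve 4 (λ p q x y → ((p :* q) :* x) :* y := (p :* x) :* (q :* y)) R.refl (Pr e n) (Pr e' n) (𝟙 ⊕ mono (e n)) (𝟙 ⊕ mono (e' n)))
    (≈-sym (R.*-cong (Pr-suc _ _) (Pr-suc _ _))))

Inf-merge₃ : ∀ {e₀ e e' e''} → Growing e₀ → Growing e → Growing e' → Growing e''
  → (∀ i → e₀ (i * 3) ≡ e i) → (∀ i → e₀ (suc (i * 3)) ≡ e' i) → (∀ i → e₀ (2 + i * 3) ≡ e'' i) → Inf e₀ ≈ Inf e ⊗ (Inf e' ⊗ Inf e'')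
Inf-merge₃ {e₀} {e} {e'} {e''} g₀ g g' g'' h h' h'' = K-to λ K → K-trans (Inf≈Pr g₀ (ℕ.m≤m*n K 3))
  (K-trans (K-from (go K)) (K-sym (K-⊗ (Inf≈Pr g ℕ.≤-refl) (K-⊗ (Inf≈Pr g' ℕ.≤-refl) (Inf≈Pr g'' ℕ.≤-refl)))))
  where
  go : ∀ n → Pr e₀ (n * 3) ≈ Pr e n ⊗ (Pr e' n ⊗ Pr e'' n)
  go zero = ≈-trans (Pr-0 _) (≈-sym (≈-trans (R.*-cong (Pr-0 _) (R.*-cong (Pr-0 _) (Pr-0 _))) (≈-trans (R.*-identityˡ _) (R.*-identityˡ _))))
  go (suc n) = ≈-trans (≈-trans (Pr-suc _ _) (R.*-cong (≈-trans (Pr-suc _ _) (R.*-cong (≈-trans (Pr-suc _ _) (R.*-cong (go n) (R.+-congˡ (mono-≡ (h n))))) (R.+-congˡ (mono-≡ (h' n))))) (R.+-congˡ (mono-≡ (h'' n)))))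
    (≈-trans (solve 6 (λ p q r x y z → (((p :* (q :* r)) :* x) :* y) :* z := (p :* x) :* ((q :* y) :* (r :* z))) R.refl (Pr e n) (Pr e' n) (Pr e'' n) (𝟙 ⊕ mono (e n)) (𝟙 ⊕ mono (e' n)) (𝟙 ⊕ mono (e'' n)))
    (≈-sym (R.*-cong (Pr-suc _ _) (R.*-cong (Pr-suc _ _) (Pr-suc _ _)))))

f₁ : Ser
f₁ = Inf suc

lin-grow : ∀ a b .{{_ : NonZero a}} .{{_ : NonZero b}} → Growing (λ i → a * i + b)
lin-grow a b i = subst (_≤ a * i + b) (ℕ.+-comm i 1) (ℕ.+-mono-≤ (ℕ.m≤n*m i a) (ℕ.>-nonZero⁻¹ b))

mul-grow : ∀ a .{{_ : NonZero a}} → Growing (λ i → a * suc i)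
mul-grow a i = ℕ.m≤n*m (suc i) a

module J3 = Jacobi 3 1 2 refl (s≤s z≤n) (s≤s z≤n)
module J6 = Jacobi 6 1 5 refl (s≤s z≤n) (s≤s z≤n)

pentagonal : f₁ ≈ Gen 0 (jt 3 1 2) (λ _ → true)
pentagonal = ≈-trans (Inf-merge₃ (λ i → ℕ.≤-refl) (lin-grow 3 1) (lin-grow 3 2) (mul-grow 3) h1 h2 h3)
  (≈-trans (solve 3 (λ a b c → a :* (b :* c) := c :* (b :* a)) R.refl (Inf (λ i → 3 * i + 1)) (Inf (λ i → 3 * i + 2)) (Inf (λ i → 3 * suc i))) J3.triple-product)
  where
  h1 : ∀ i → suc (i * 3) ≡ 3 * i + 1
  h1 = NS.solve-∀
  h2 : ∀ i → suc (suc (i * 3)) ≡ 3 * i + 2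
  h2 = NS.solve-∀
  h3 : ∀ i → suc (2 + i * 3) ≡ 3 * suc i
  h3 = NS.solve-∀

-- The sum of q^(y (3 y - 2)) over y ∈ ℤ, whose exponents are the generalised octagonal numbers.
ψ : Ser
ψ = Gen 0 (jt 6 1 5) (λ _ → true)

-- Modulo 2 the odd factors of `f₁` multiply to its inverse, because the even ones give f₁(q²) =
-- f₁². The same holds for `V 3 f₁` and the odd multiples of 3. Dividing, the factors with exponent
-- prime to 6 multiply to f₃ / f₁, and ψ is f₆ = f₃² times these.
f₁ψ : f₁ ⊗ ψ ≈ V 3 f₁ ⊗ (V 3 f₁ ⊗ V 3 f₁)
f₁ψ = begin
  f₁ ⊗ ψ ≈⟨ R.*-congˡ (≈-sym J6.triple-product) ⟩
  f₁ ⊗ (Inf (λ i → 6 * suc i) ⊗ (b ⊗ a)) ≈⟨ R.*-congˡ (R.*-congʳ f6) ⟩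
  f₁ ⊗ ((f₃ ⊗ f₃) ⊗ (b ⊗ a)) ≈⟨ solve 4 (λ f g a b → f :* ((g :* g) :* (b :* a)) := ((a :* b) :* f) :* (g :* g)) R.refl f₁ f₃ a b ⟩
  ((a ⊗ b) ⊗ f₁) ⊗ (f₃ ⊗ f₃) ≈⟨ R.*-congʳ (≈-sym f₃O) ⟩
  f₃ ⊗ (f₃ ⊗ f₃) ∎
  where
  open ≈R
  a = Inf (λ i → 6 * i + 1)
  t = Inf (λ i → 6 * i + 3)
  b = Inf (λ i → 6 * i + 5)
  f₃ = V 3 f₁
  f₃-Inf : f₃ ≈ Inf (λ i → 3 * suc i)
  f₃-Inf = Inf-V 3 suc (λ i → ℕ.≤-refl)
  f6 : Inf (λ i → 6 * suc i) ≈ f₃ ⊗ f₃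
  f6 = ≈-sym (≈-trans (sq-V f₃) (≈-trans (V-cong 2 f₃-Inf) (≈-trans (Inf-V 2 _ (mul-grow 3)) (Inf-cong h))))
    where
    h : ∀ i → 2 * (3 * suc i) ≡ 6 * suc i
    h i = sym (ℕ.*-assoc 2 3 (suc i))
  f2 : Inf (λ i → 2 * suc i) ≈ f₁ ⊗ f₁
  f2 = ≈-sym (≈-trans (sq-V f₁) (Inf-V 2 suc (λ i → ℕ.≤-refl)))
  f₁-split : f₁ ≈ (a ⊗ (t ⊗ b)) ⊗ (f₁ ⊗ f₁)
  f₁-split = ≈-trans (Inf-merge₂ (λ i → ℕ.≤-refl) (lin-grow 2 1) (mul-grow 2) h1 h2)
    (R.*-cong (Inf-merge₃ (lin-grow 2 1) (lin-grow 6 1) (lin-grow 6 3) (lin-grow 6 5) k1 k2 k3) f2)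
    where
    h1 : ∀ i → suc (i * 2) ≡ 2 * i + 1
    h1 = NS.solve-∀
    h2 : ∀ i → suc (suc (i * 2)) ≡ 2 * suc i
    h2 = NS.solve-∀
    k1 : ∀ i → 2 * (i * 3) + 1 ≡ 6 * i + 1
    k1 = NS.solve-∀
    k2 : ∀ i → 2 * suc (i * 3) + 1 ≡ 6 * i + 3
    k2 = NS.solve-∀
    k3 : ∀ i → 2 * (2 + i * 3) + 1 ≡ 6 * i + 5
    k3 = NS.solve-∀
  f₃-split : f₃ ≈ t ⊗ (f₃ ⊗ f₃)
  f₃-split = ≈-trans f₃-Inf (≈-trans (Inf-merge₂ (mul-grow 3) (lin-grow 6 3) (mul-grow 6) h1 h2) (R.*-congˡ f6))
    where
    h1 : ∀ i → 3 * suc (i * 2) ≡ 6 * i + 3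
    h1 = NS.solve-∀
    h2 : ∀ i → 3 * suc (suc (i * 2)) ≡ 6 * suc i
    h2 = NS.solve-∀
  u₁ : f₁ 0 ≡ true
  u₁ = Inf-unit {suc} (λ i → ℕ.≤-refl)
  u₃ : f₃ 0 ≡ true
  u₃ = trans (at f₃-Inf 0) (Inf-unit (mul-grow 3))
  one₁ : 𝟙 ≈ (a ⊗ (t ⊗ b)) ⊗ f₁
  one₁ = unit-cancel f₁ u₁ (≈-trans (R.*-identityʳ f₁) (≈-trans f₁-split
    (solve 2 (λ x f → x :* (f :* f) := f :* (x :* f)) R.refl (a ⊗ (t ⊗ b)) f₁)))
  one₃ : 𝟙 ≈ t ⊗ f₃
  one₃ = unit-cancel f₃ u₃ (≈-trans (R.*-identityʳ f₃) (≈-trans f₃-split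
    (solve 2 (λ x f → x :* (f :* f) := f :* (x :* f)) R.refl t f₃)))
  f₃O : f₃ ≈ (a ⊗ b) ⊗ f₁
  f₃O = ≈-trans (≈-sym (R.*-identityʳ f₃)) (≈-trans (R.*-congˡ one₁)
    (≈-trans (solve 5 (λ g a t b f → g :* ((a :* (t :* b)) :* f) := (t :* g) :* ((a :* b) :* f)) R.refl f₃ a t b f₁)
    (≈-trans (R.*-congʳ (≈-sym one₃)) (R.*-identityˡ _))))

-- Theta series of residue classes

-- How a product series becomes a theta series: the map `g` turns the exponents s + k e into the
-- quadratic form `w`.
mono-V-Gen : ∀ s k .{{_ : NonZero k}} {m e C₀ m' w C} (g : VV m → VV m')
  → (∀ x → C₀ x ≡ true → InB m (e x) x) → (∀ x → C x ≡ true → InB m' (w x) x)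
  → (∀ y → C₀ y ≡ true → C (g y) ≡ true × w (g y) ≡ s + k * e y)
  → (∀ y y' → g y ≡ g y' → y ≡ y')
  → (∀ x → C x ≡ true → ∃ λ y → C₀ y ≡ true × g y ≡ x)
  → mono s ⊗ V k (Gen m e C₀) ≈ Gen m' w C
mono-V-Gen s k {m} {e} {C₀} {m'} {w} {C} g b b' h1 h2 h3 = pw go
  where
  wx : ∀ x → C x ≡ true → ∃ λ y → w x ≡ s + k * e y
  wx x cx with h3 x cx
  ... | y , c₀ , refl = y , proj₂ (h1 y c₀)
  go' : ∀ j → V k (Gen m e C₀) j ≡ Gen m' w C (s + j)
  go' j with k ∣? j
  ... | no ¬d = trans (V-supp k _ j ¬d) (sym (Gen-zero (s + j) λ x cx eq → let (y , p) = wx x cx in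
          ¬d (divides (e y) (trans (ℕ.+-cancelˡ-≡ s _ _ (trans (sym eq) p)) (ℕ.*-comm k (e y))))))
  ... | yes (divides q refl) = trans (trans (cong (V k (Gen m e C₀)) (ℕ.*-comm q k)) (V-* k _ q)) (sym (Gen-bij {C = C} g (s + q * k) q b' b
          (λ y c₀ eq → let (p , r) = h1 y c₀ in p , trans r (cong (s ℕ.+_) (trans (cong (k *_) eq) (ℕ.*-comm k q))))
          (λ y y' _ _ → h2 y y')
          (λ x cx eq → let (y , c₀ , gy) = h3 x cx in y , c₀ ,
             ℕ.*-cancelˡ-≡ (e y) q k (ℕ.+-cancelˡ-≡ s _ _ (trans (sym (proj₂ (h1 y c₀))) (trans (cong w gy) (trans eq (cong (s ℕ.+_) (ℕ.*-comm q k)))))) , gy)))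
  go : ∀ n → (mono s ⊗ V k (Gen m e C₀)) n ≡ Gen m' w C n
  go n with ℕ.<-≤-connex n s
  ... | inj₁ lt = trans (mono-⊗-lo s _ n lt) (sym (Gen-zero n λ x cx eq → let (y , p) = wx x cx in
          ℕ.<⇒≱ lt (subst (s ≤_) (trans (sym p) eq) (ℕ.m≤m+n s _))))
  ... | inj₂ ge = subst (λ z → (mono s ⊗ V k (Gen m e C₀)) z ≡ Gen m' w C z) (ℕ.m+[n∸m]≡n ge) (trans (mono-⊗-hi s _ (n ∸ s)) (go' (n ∸ s)))

sq : ℤ → ℕ
sq x = ∣ x ∣ * ∣ x ∣

sq-+ : ∀ x → + sq x ≡ x ℤ.* x
sq-+ (+ n) = ℤ.pos-* n n
sq-+ -[1+ n ] = refl

sq-big : ∀ x → ∣ x ∣ ≤ sq x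
sq-big x = go ∣ x ∣
  where
  go : ∀ n → n ≤ n * n
  go zero = z≤n
  go (suc n) = ℕ.m≤m*n (suc n) (suc n)

ℤ-+-cancelˡ : ∀ r a b → r ℤ.+ a ≡ r ℤ.+ b → a ≡ b
ℤ-+-cancelˡ r a b e = trans (lem r a) (trans (cong (λ z → z ℤ.- r) e) (sym (lem r b)))
  where
  lem : ∀ r a → a ≡ (r ℤ.+ a) ℤ.- r
  lem = ZS.solve-∀

cls : ℕ → ℤ → ℤ → Bool
cls L c x = does (L ∣? ∣ x ℤ.- c ∣)

cls-elim : ∀ L c x → cls L c x ≡ true → ∃ λ q → x ≡ c ℤ.+ q ℤ.* + L
cls-elim L c x t with ZDS.∣ᵤ⇒∣ {+ L} {x ℤ.- c} (does-true (L ∣? ∣ x ℤ.- c ∣) t)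
... | ZDS.divides q eq = q , trans (lem x c) (cong (λ z → c ℤ.+ z) eq)
  where
  lem : ∀ x c → x ≡ c ℤ.+ (x ℤ.- c)
  lem = ZS.solve-∀

cls-intro : ∀ L c x q → x ≡ c ℤ.+ q ℤ.* + L → cls L c x ≡ true
cls-intro L c x q refl = dec-true (L ∣? _) (ZDS.∣⇒∣ᵤ {+ L} (ZDS.divides q (lem c (q ℤ.* + L))))
  where
  lem : ∀ c z → c ℤ.+ z ℤ.- c ≡ z
  lem = ZS.solve-∀

private
  toℤ-sq : ∀ k → + k ℤ.* + k ≡ + tri k ℤ.+ + tri k ℤ.+ + k
  toℤ-sq k = trans (sym (ℤ.pos-* k k)) (trans (cong +_ (tri-sq k)) (trans (ℤ.pos-+ (tri k + tri k) k) (cong (λ z → z ℤ.+ + k) (ℤ.pos-+ (tri k) (tri k)))))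

  cast : ∀ s m A t B k → + (s + m * (A * t + B * k)) ≡ + s ℤ.+ + m ℤ.* (+ A ℤ.* + t ℤ.+ + B ℤ.* + k)
  cast s m A t B k = trans (ℤ.pos-+ s _) (cong (λ z → + s ℤ.+ z) (trans (ℤ.pos-* m _) (cong (λ z → + m ℤ.* z) (trans (ℤ.pos-+ (A * t) _) (cong₂ ℤ._+_ (ℤ.pos-* A t) (ℤ.pos-* B k))))))

-- Completing the square: the hypotheses compare the coefficients of (r + y d)². For negative `y`
-- change the sign of `d`, which exchanges `B` and `B'`.
square-jt : ∀ s m A B B' (r d : ℤ) → r ℤ.* r ≡ + s → + 2 ℤ.* (d ℤ.* d) ≡ + m ℤ.* + A
  → d ℤ.* d ℤ.+ + 2 ℤ.* (r ℤ.* d) ≡ + m ℤ.* + B → d ℤ.* d ℤ.- + 2 ℤ.* (r ℤ.* d) ≡ + m ℤ.* + B'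
  → ∀ y → sq (r ℤ.+ y ℤ.* d) ≡ s + m * jt A B B' y
square-jt s m A B B' r d hs hA hB hB' (+ k) = ℤ.+-injective (begin
  + sq (r ℤ.+ + k ℤ.* d) ≡⟨ sq-+ (r ℤ.+ + k ℤ.* d) ⟩
  (r ℤ.+ + k ℤ.* d) ℤ.* (r ℤ.+ + k ℤ.* d) ≡⟨ l1 r d (+ k) ⟩
  r ℤ.* r ℤ.+ + 2 ℤ.* (r ℤ.* d) ℤ.* + k ℤ.+ (d ℤ.* d) ℤ.* (+ k ℤ.* + k) ≡⟨ cong (λ z → r ℤ.* r ℤ.+ + 2 ℤ.* (r ℤ.* d) ℤ.* + k ℤ.+ (d ℤ.* d) ℤ.* z) (toℤ-sq k) ⟩
  r ℤ.* r ℤ.+ + 2 ℤ.* (r ℤ.* d) ℤ.* + k ℤ.+ (d ℤ.* d) ℤ.* (+ tri k ℤ.+ + tri k ℤ.+ + k) ≡⟨ l2 r (d ℤ.* d) (r ℤ.* d) (+ k) (+ tri k) ⟩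
  r ℤ.* r ℤ.+ (+ 2 ℤ.* (d ℤ.* d) ℤ.* + tri k ℤ.+ (d ℤ.* d ℤ.+ + 2 ℤ.* (r ℤ.* d)) ℤ.* + k)
    ≡⟨ cong₂ ℤ._+_ hs (cong₂ (λ a b → a ℤ.* + tri k ℤ.+ b ℤ.* + k) hA hB) ⟩
  + s ℤ.+ (+ m ℤ.* + A ℤ.* + tri k ℤ.+ + m ℤ.* + B ℤ.* + k) ≡⟨ l3 (+ s) (+ m) (+ A) (+ tri k) (+ B) (+ k) ⟩
  + s ℤ.+ + m ℤ.* (+ A ℤ.* + tri k ℤ.+ + B ℤ.* + k) ≡⟨ sym (cast s m A (tri k) B k) ⟩
  _ ∎)
  where
  open ≡-Reasoning
  l1 : ∀ r d k → (r ℤ.+ k ℤ.* d) ℤ.* (r ℤ.+ k ℤ.* d) ≡ r ℤ.* r ℤ.+ + 2 ℤ.* (r ℤ.* d) ℤ.* k ℤ.+ (d ℤ.* d) ℤ.* (k ℤ.* k)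
  l1 = ZS.solve-∀
  l2 : ∀ r D E k t → r ℤ.* r ℤ.+ + 2 ℤ.* E ℤ.* k ℤ.+ D ℤ.* (t ℤ.+ t ℤ.+ k) ≡ r ℤ.* r ℤ.+ (+ 2 ℤ.* D ℤ.* t ℤ.+ (D ℤ.+ + 2 ℤ.* E) ℤ.* k)
  l2 = ZS.solve-∀
  l3 : ∀ s m A t B k → s ℤ.+ (m ℤ.* A ℤ.* t ℤ.+ m ℤ.* B ℤ.* k) ≡ s ℤ.+ m ℤ.* (A ℤ.* t ℤ.+ B ℤ.* k)
  l3 = ZS.solve-∀
square-jt s m A B B' r d hs hA hB hB' -[1+ k ] = trans (cong (λ z → sq (r ℤ.+ z)) (flip (+ suc k) d))
  (square-jt s m A B' B r (ℤ.- d) hs (trans (cong (λ z → + 2 ℤ.* z) (dd d)) hA) (trans (e1 r d) hB') (trans (e2 r d) hB) (+ suc k))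
  where
  flip : ∀ k d → ℤ.- k ℤ.* d ≡ k ℤ.* ℤ.- d
  flip = ZS.solve-∀
  dd : ∀ d → ℤ.- d ℤ.* ℤ.- d ≡ d ℤ.* d
  dd = ZS.solve-∀
  e1 : ∀ r d → ℤ.- d ℤ.* ℤ.- d ℤ.+ + 2 ℤ.* (r ℤ.* ℤ.- d) ≡ d ℤ.* d ℤ.- + 2 ℤ.* (r ℤ.* d)
  e1 = ZS.solve-∀
  e2 : ∀ r d → ℤ.- d ℤ.* ℤ.- d ℤ.- + 2 ℤ.* (r ℤ.* ℤ.- d) ≡ d ℤ.* d ℤ.+ + 2 ℤ.* (r ℤ.* d)
  e2 = ZS.solve-∀

Θ₁ : ℕ → ℤ → Ser
Θ₁ L c = Gen 0 sq (cls L c)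

jt-class : ∀ s m .{{_ : NonZero m}} e L .{{_ : NonZero L}} r d → (d ≡ + L) ⊎ (d ≡ ℤ.- + L)
  → (∀ x → ∣ x ∣ ≤ e x) → (∀ y → sq (r ℤ.+ y ℤ.* d) ≡ s + m * e y)
  → mono s ⊗ V m (Gen 0 e (λ _ → true)) ≈ Θ₁ L r
jt-class s m e L r d hd b h = mono-V-Gen s m g (λ x _ → b x) (λ x _ → sq-big x)
  (λ y _ → incl y hd , h y)
  (λ y y' eq → ℤ.*-cancelʳ-≡ y y' d {{nz hd}} (ℤ-+-cancelˡ r _ _ eq))
  (λ x cx → let (q , eq) = cls-elim L r x cx in surj x q eq hd)
  where
  g : ℤ → ℤ
  g y = r ℤ.+ y ℤ.* d
  flip : ∀ y d → y ℤ.* ℤ.- d ≡ ℤ.- y ℤ.* d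
  flip = ZS.solve-∀
  flip' : ∀ y d → y ℤ.* d ≡ ℤ.- y ℤ.* ℤ.- d
  flip' = ZS.solve-∀
  incl : ∀ y → (d ≡ + L) ⊎ (d ≡ ℤ.- + L) → cls L r (g y) ≡ true
  incl y (inj₁ e) = cls-intro L r (g y) y (cong (λ z → r ℤ.+ y ℤ.* z) e)
  incl y (inj₂ e) = cls-intro L r (g y) (ℤ.- y) (cong (λ z → r ℤ.+ z) (trans (cong (y ℤ.*_) e) (flip y (+ L))))
  nz : (d ≡ + L) ⊎ (d ≡ ℤ.- + L) → ℤ.NonZero d
  nz (inj₁ refl) = it
    where
    it : ℕ.NonZero L
    it = ℕ.>-nonZero (ℕ.>-nonZero⁻¹ L)
  nz (inj₂ refl) = subst ℕ.NonZero (sym (ℤ.∣-i∣≡∣i∣ (+ L))) (ℕ.>-nonZero (ℕ.>-nonZero⁻¹ L))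
  surj : ∀ x q → x ≡ r ℤ.+ q ℤ.* + L → (d ≡ + L) ⊎ (d ≡ ℤ.- + L) → ∃ λ y → true ≡ true × g y ≡ x
  surj x q eq (inj₁ e) = q , refl , trans (cong (λ z → r ℤ.+ q ℤ.* z) e) (sym eq)
  surj x q eq (inj₂ e) = ℤ.- q , refl , trans (cong (λ z → r ℤ.+ z) (trans (cong (ℤ.- q ℤ.*_) e) (sym (flip' q (+ L))))) (sym eq)

E₁ : Ser
E₁ = mono 1 ⊗ V 24 f₁

-- 24 (3 y (y - 1) / 2 + y) + 1 = (1 - 6 y)², hence the step -6.
E₁-Θ : E₁ ≈ Θ₁ 6 (+ 1)
E₁-Θ = ≈-trans (R.*-congˡ (V-cong 24 pentagonal)) (jt-class 1 24 (jt 3 1 2) 6 (+ 1) -[1+ 5 ] (inj₂ refl) J3.jt-big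
  (square-jt 1 24 3 1 2 (+ 1) -[1+ 5 ] refl refl refl refl))

-- 1 + 3 y (3 y - 2) = (1 - 3 y)².
θψ : mono 1 ⊗ V 3 ψ ≈ Θ₁ 3 (+ 1)
θψ = jt-class 1 3 (jt 6 1 5) 3 (+ 1) -[1+ 2 ] (inj₂ refl) J6.jt-big (square-jt 1 3 6 1 5 (+ 1) -[1+ 2 ] refl refl refl refl)

-- the theta form of f₁ ψ = f₃³
E₁-cube : E₁ ⊗ V 8 (Θ₁ 3 (+ 1)) ≈ V 3 E₁ ⊗ (V 3 E₁ ⊗ V 3 E₁)
E₁-cube = begin
  (mono 1 ⊗ V 24 f₁) ⊗ V 8 (Θ₁ 3 (+ 1)) ≈⟨ R.*-congˡ (≈-trans (V-cong 8 (≈-sym θψ)) (≈-trans (V-⊗ 8 _ _) (R.*-cong (V-mono 8 1) (V-V 8 3 ψ)))) ⟩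
  (mono 1 ⊗ V 24 f₁) ⊗ (mono 8 ⊗ V 24 ψ) ≈⟨ solve 4 (λ a b c d → (a :* b) :* (c :* d) := (a :* c) :* (b :* d)) R.refl (mono 1) (V 24 f₁) (mono 8) (V 24 ψ) ⟩
  (mono 1 ⊗ mono 8) ⊗ (V 24 f₁ ⊗ V 24 ψ) ≈⟨ R.*-cong (mono-+ 1 8) (≈-trans (≈-sym (V-⊗ 24 f₁ ψ)) (≈-trans (V-cong 24 f₁ψ) (≈-trans (V-⊗ 24 _ _) (R.*-cong (V-V 24 3 f₁) (≈-trans (V-⊗ 24 _ _) (R.*-cong (V-V 24 3 f₁) (V-V 24 3 f₁))))))) ⟩
  mono 9 ⊗ (V 72 f₁ ⊗ (V 72 f₁ ⊗ V 72 f₁)) ≈⟨ R.*-congʳ (≈-sym (≈-trans (R.*-congˡ (mono-+ 3 3)) (mono-+ 3 6))) ⟩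
  (mono 3 ⊗ (mono 3 ⊗ mono 3)) ⊗ (V 72 f₁ ⊗ (V 72 f₁ ⊗ V 72 f₁)) ≈⟨ solve 2 (λ a b → (a :* (a :* a)) :* (b :* (b :* b)) := (a :* b) :* ((a :* b) :* (a :* b))) R.refl (mono 3) (V 72 f₁) ⟩
  (mono 3 ⊗ V 72 f₁) ⊗ ((mono 3 ⊗ V 72 f₁) ⊗ (mono 3 ⊗ V 72 f₁)) ≈⟨ ≈-sym (R.*-cong v3 (R.*-cong v3 v3)) ⟩
  _ ∎
  where
  open ≈R
  v3 : V 3 E₁ ≈ mono 3 ⊗ V 72 f₁
  v3 = ≈-trans (V-⊗ 3 _ _) (R.*-cong (V-mono 3 1) (V-V 3 24 f₁))

-- Integer vectors and similitudes

infixl 6 _⊞_ _⊟_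
_⊞_ _⊟_ : ∀ {m} → VV m → VV m → VV m
_⊞_ {zero} x y = x ℤ.+ y
_⊞_ {suc m} (x , x') (y , y') = x ⊞ y , x' ⊞ y'
_⊟_ {zero} x y = x ℤ.- y
_⊟_ {suc m} (x , x') (y , y') = x ⊟ y , x' ⊟ y'

sc : ∀ {m} → ℤ → VV m → VV m
sc {zero} k x = k ℤ.* x
sc {suc m} k (x , y) = sc k x , sc k y

ip : ∀ {m} → VV m → VV m → ℤ
ip {zero} x y = x ℤ.* y
ip {suc m} (x , x') (y , y') = ip x y ℤ.+ ip x' y'

nm : ∀ m → VV m → ℕ
nm zero x = sq x
nm (suc m) p = nm m (proj₁ p) + nm m (proj₂ p)

nm-ip : ∀ m x → + nm m x ≡ ip x x
nm-ip zero x = sq-+ x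
nm-ip (suc m) (x , y) = trans (ℤ.pos-+ (nm m x) (nm m y)) (cong₂ ℤ._+_ (nm-ip m x) (nm-ip m y))

nm-big : ∀ m x → InB m (nm m x) x
nm-big zero x = sq-big x
nm-big (suc m) (x , y) = InB-mono m (ℕ.m≤m+n _ _) x (nm-big m x) , InB-mono m (ℕ.m≤n+m _ _) y (nm-big m y)

v-⊞⊞ : ∀ {m} (a b c d : VV m) → (a ⊞ b) ⊞ (c ⊞ d) ≡ (a ⊞ c) ⊞ (b ⊞ d)
v-⊞⊞ {zero} = λ a b c d → lem a b c d
  where
  lem : ∀ a b c d → (a ℤ.+ b) ℤ.+ (c ℤ.+ d) ≡ (a ℤ.+ c) ℤ.+ (b ℤ.+ d)
  lem = ZS.solve-∀
v-⊞⊞ {suc m} _ _ _ _ = cong₂ _,_ (v-⊞⊞ _ _ _ _) (v-⊞⊞ _ _ _ _)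

v-⊞⊟ : ∀ {m} (a b c d : VV m) → (a ⊞ b) ⊟ (c ⊞ d) ≡ (a ⊟ c) ⊞ (b ⊟ d)
v-⊞⊟ {zero} = λ a b c d → lem a b c d
  where
  lem : ∀ a b c d → (a ℤ.+ b) ℤ.- (c ℤ.+ d) ≡ (a ℤ.- c) ℤ.+ (b ℤ.- d)
  lem = ZS.solve-∀
v-⊞⊟ {suc m} _ _ _ _ = cong₂ _,_ (v-⊞⊟ _ _ _ _) (v-⊞⊟ _ _ _ _)

v-cancel₁ : ∀ {m} (x a b : VV m) → (x ⊞ a) ⊟ (a ⊟ b) ≡ x ⊞ b
v-cancel₁ {zero} = λ x a b → lem x a b
  where
  lem : ∀ x a b → (x ℤ.+ a) ℤ.- (a ℤ.- b) ≡ x ℤ.+ b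
  lem = ZS.solve-∀
v-cancel₁ {suc m} _ _ _ = cong₂ _,_ (v-cancel₁ _ _ _) (v-cancel₁ _ _ _)

v-cancel₂ : ∀ {m} (x a b : VV m) → (x ⊟ a) ⊞ (a ⊞ b) ≡ x ⊞ b
v-cancel₂ {zero} = λ x a b → lem x a b
  where
  lem : ∀ x a b → (x ℤ.- a) ℤ.+ (a ℤ.+ b) ≡ x ℤ.+ b
  lem = ZS.solve-∀
v-cancel₂ {suc m} _ _ _ = cong₂ _,_ (v-cancel₂ _ _ _) (v-cancel₂ _ _ _)

sc-1 : ∀ {m} (x : VV m) → sc (+ 1) x ≡ x
sc-1 {zero} = ℤ.*-identityˡ
sc-1 {suc m} (x , y) = cong₂ _,_ (sc-1 x) (sc-1 y)

sc-suc : ∀ {m} k (x : VV m) → x ⊞ sc k x ≡ sc (+ 1 ℤ.+ k) x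
sc-suc {zero} = λ k x → lem k x
  where
  lem : ∀ k x → x ℤ.+ k ℤ.* x ≡ (+ 1 ℤ.+ k) ℤ.* x
  lem = ZS.solve-∀
sc-suc {suc m} k (x , y) = cong₂ _,_ (sc-suc k x) (sc-suc k y)

sc-⊞ : ∀ {m} k (x y : VV m) → sc k (x ⊞ y) ≡ sc k x ⊞ sc k y
sc-⊞ {zero} = ℤ.*-distribˡ-+
sc-⊞ {suc m} k _ _ = cong₂ _,_ (sc-⊞ k _ _) (sc-⊞ k _ _)

sc-⊟ : ∀ {m} k (x y : VV m) → sc k (x ⊟ y) ≡ sc k x ⊟ sc k y
sc-⊟ {zero} = λ k x y → lem k x y
  where
  lem : ∀ k x y → k ℤ.* (x ℤ.- y) ≡ k ℤ.* x ℤ.- k ℤ.* y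
  lem = ZS.solve-∀
sc-⊟ {suc m} k _ _ = cong₂ _,_ (sc-⊟ k _ _) (sc-⊟ k _ _)

sc-sc : ∀ {m} j k (x : VV m) → sc j (sc k x) ≡ sc (j ℤ.* k) x
sc-sc {zero} j k x = sym (ℤ.*-assoc j k x)
sc-sc {suc m} j k _ = cong₂ _,_ (sc-sc j k _) (sc-sc j k _)

sc-inj : ∀ {m} k .{{_ : ℤ.NonZero k}} (x y : VV m) → sc k x ≡ sc k y → x ≡ y
sc-inj {zero} k x y e = ℤ.*-cancelˡ-≡ k x y e
sc-inj {suc m} k (x , x') (y , y') e = cong₂ _,_ (sc-inj k x y (cong proj₁ e)) (sc-inj k x' y' (cong proj₂ e))

ip-⊞ : ∀ {m} (x y z : VV m) → ip (x ⊞ y) z ≡ ip x z ℤ.+ ip y z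
ip-⊞ {zero} x y z = ℤ.*-distribʳ-+ z x y
ip-⊞ {suc m} (x , x') (y , y') (z , z') = trans (cong₂ ℤ._+_ (ip-⊞ x y z) (ip-⊞ x' y' z')) (lem (ip x z) (ip y z) (ip x' z') (ip y' z'))
  where
  lem : ∀ a b c d → a ℤ.+ b ℤ.+ (c ℤ.+ d) ≡ a ℤ.+ c ℤ.+ (b ℤ.+ d)
  lem = ZS.solve-∀

ip-⊟ : ∀ {m} (x y z : VV m) → ip (x ⊟ y) z ≡ ip x z ℤ.- ip y z
ip-⊟ {zero} = λ x y z → lem x y z
  where
  lem : ∀ x y z → (x ℤ.- y) ℤ.* z ≡ x ℤ.* z ℤ.- y ℤ.* z
  lem = ZS.solve-∀
ip-⊟ {suc m} (x , x') (y , y') (z , z') = trans (cong₂ ℤ._+_ (ip-⊟ x y z) (ip-⊟ x' y' z')) (lem (ip x z) (ip y z) (ip x' z') (ip y' z'))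
  where
  lem : ∀ a b c d → a ℤ.- b ℤ.+ (c ℤ.- d) ≡ a ℤ.+ c ℤ.- (b ℤ.+ d)
  lem = ZS.solve-∀

ip-comm : ∀ {m} (x y : VV m) → ip x y ≡ ip y x
ip-comm {zero} = ℤ.*-comm
ip-comm {suc m} (x , x') (y , y') = cong₂ ℤ._+_ (ip-comm x y) (ip-comm x' y')

ip-sc : ∀ {m} k (x y : VV m) → ip x (sc k y) ≡ k ℤ.* ip x y
ip-sc {zero} = λ k x y → lem k x y
  where
  lem : ∀ k x y → x ℤ.* (k ℤ.* y) ≡ k ℤ.* (x ℤ.* y)
  lem = ZS.solve-∀
ip-sc {suc m} k (x , x') (y , y') = trans (cong₂ ℤ._+_ (ip-sc k x y) (ip-sc k x' y')) (sym (ℤ.*-distribˡ-+ k (ip x y) (ip x' y')))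

-- Integer matrices with A Aᵗ = Aᵗ A = k, given by the action of both. They multiply the norm by
-- `k`.
record Similitude (m k : ℕ) (A Aᵗ : VV m → VV m) : Set where
  field
    A-⊞ : ∀ x y → A (x ⊞ y) ≡ A x ⊞ A y
    Aᵗ-⊞ : ∀ x y → Aᵗ (x ⊞ y) ≡ Aᵗ x ⊞ Aᵗ y
    A-sc : ∀ j x → A (sc j x) ≡ sc j (A x)
    Aᵗ-sc : ∀ j x → Aᵗ (sc j x) ≡ sc j (Aᵗ x)
    AᵗA : ∀ x → Aᵗ (A x) ≡ sc (+ k) x
    AAᵗ : ∀ x → A (Aᵗ x) ≡ sc (+ k) x
    adjoint : ∀ x y → ip (A x) y ≡ ip x (Aᵗ y)

  private
    to-ℕ : ∀ B Bᵗ → (∀ x y → ip (B x) y ≡ ip x (Bᵗ y)) → (∀ x → Bᵗ (B x) ≡ sc (+ k) x) → ∀ x → nm m (B x) ≡ k * nm m x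
    to-ℕ B Bᵗ adj h x = ℤ.+-injective (trans (nm-ip m (B x)) (trans (adj x (B x)) (trans (cong (ip x) (h x)) (trans (ip-sc (+ k) x x)
      (trans (cong (λ z → + k ℤ.* z) (sym (nm-ip m x))) (sym (ℤ.pos-* k (nm m x))))))))

  nm-A : ∀ x → nm m (A x) ≡ k * nm m x
  nm-A = to-ℕ A Aᵗ adjoint AᵗA

  nm-Aᵗ : ∀ x → nm m (Aᵗ x) ≡ k * nm m x
  nm-Aᵗ = to-ℕ Aᵗ A (λ x y → trans (ip-comm (Aᵗ x) y) (trans (sym (adjoint y x)) (ip-comm (A y) x))) AAᵗ

transpose : ∀ {m k A Aᵗ} → Similitude m k A Aᵗ → Similitude m k Aᵗ A
transpose S = record { A-⊞ = X.Aᵗ-⊞ ; Aᵗ-⊞ = X.A-⊞ ; A-sc = X.Aᵗ-sc ; Aᵗ-sc = X.A-sc ; AᵗA = X.AAᵗ ; AAᵗ = X.AᵗA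
  ; adjoint = λ x y → trans (ip-comm _ y) (trans (sym (X.adjoint y x)) (ip-comm _ x)) }
  where
  module X = Similitude S

-- the block matrices [[1, M], [-Mᵗ, 1]] raise the multiplier by one and double the dimension
M Mᵗ : ∀ k → VV k → VV k
M zero x = x
M (suc k) p = proj₁ p ⊞ M k (proj₂ p) , proj₂ p ⊟ Mᵗ k (proj₁ p)
Mᵗ zero x = x
Mᵗ (suc k) p = proj₁ p ⊟ M k (proj₂ p) , proj₂ p ⊞ Mᵗ k (proj₁ p)

-- In the product of the block matrix with its transpose the diagonal blocks are 1 + (k + 1), and
-- the off-diagonal ones cancel.
M-similitude : ∀ k → Similitude k (suc k) (M k) (Mᵗ k)
M-similitude zero = record { A-⊞ = λ _ _ → refl ; Aᵗ-⊞ = λ _ _ → refl ; A-sc = λ _ _ → refl ; Aᵗ-sc = λ _ _ → refl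
  ; AᵗA = λ x → sym (sc-1 x) ; AAᵗ = λ x → sym (sc-1 x) ; adjoint = λ _ _ → refl }
M-similitude (suc k) = record
  { A-⊞ = λ (x , x') (y , y') → cong₂ _,_ (trans (cong ((x ⊞ y) ⊞_) (X.A-⊞ x' y')) (v-⊞⊞ x y (M k x') (M k y')))
                                          (trans (cong ((x' ⊞ y') ⊟_) (X.Aᵗ-⊞ x y)) (v-⊞⊟ x' y' (Mᵗ k x) (Mᵗ k y)))
  ; Aᵗ-⊞ = λ (x , x') (y , y') → cong₂ _,_ (trans (cong ((x ⊞ y) ⊟_) (X.A-⊞ x' y')) (v-⊞⊟ x y (M k x') (M k y')))
                                          (trans (cong ((x' ⊞ y') ⊞_) (X.Aᵗ-⊞ x y)) (v-⊞⊞ x' y' (Mᵗ k x) (Mᵗ k y)))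
  ; A-sc = λ j (x , y) → cong₂ _,_ (trans (cong (sc j x ⊞_) (X.A-sc j y)) (sym (sc-⊞ j x _))) (trans (cong (sc j y ⊟_) (X.Aᵗ-sc j x)) (sym (sc-⊟ j y _)))
  ; Aᵗ-sc = λ j (x , y) → cong₂ _,_ (trans (cong (sc j x ⊟_) (X.A-sc j y)) (sym (sc-⊟ j x _))) (trans (cong (sc j y ⊞_) (X.Aᵗ-sc j x)) (sym (sc-⊞ j y _)))
  ; AᵗA = λ (x , y) → cong₂ _,_
      (trans (cong ((x ⊞ M k y) ⊟_) (trans (M-⊟ y (Mᵗ k x)) (cong (M k y ⊟_) (X.AAᵗ x)))) (trans (v-cancel₁ x (M k y) _) (sc-suc (+ suc k) x)))
      (trans (cong ((y ⊟ Mᵗ k x) ⊞_) (trans (X.Aᵗ-⊞ x (M k y)) (cong (Mᵗ k x ⊞_) (X.AᵗA y)))) (trans (v-cancel₂ y (Mᵗ k x) _) (sc-suc (+ suc k) y)))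
  ; AAᵗ = λ (x , y) → cong₂ _,_
      (trans (cong ((x ⊟ M k y) ⊞_) (trans (X.A-⊞ y (Mᵗ k x)) (cong (M k y ⊞_) (X.AAᵗ x)))) (trans (v-cancel₂ x (M k y) _) (sc-suc (+ suc k) x)))
      (trans (cong ((y ⊞ Mᵗ k x) ⊟_) (trans (Mᵗ-⊟ x (M k y)) (cong (Mᵗ k x ⊟_) (X.AᵗA y)))) (trans (v-cancel₁ y (Mᵗ k x) _) (sc-suc (+ suc k) y)))
  ; adjoint = λ (x , y) (x' , y') → trans
      (cong₂ ℤ._+_ (trans (ip-⊞ x (M k y) x') (cong (λ z → ip x x' ℤ.+ z) (X.adjoint y x')))
        (trans (ip-⊟ y (Mᵗ k x) y') (cong (λ z → ip y y' ℤ.- z) (trans (ip-comm (Mᵗ k x) y') (sym (X.adjoint y' x))))))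
      (trans (lem (ip x x') (ip y (Mᵗ k x')) (ip y y') (ip (M k y') x))
      (sym (cong₂ ℤ._+_ (trans (ip-comm x _) (trans (ip-⊟ x' (M k y') x) (cong (λ z → z ℤ.- ip (M k y') x) (ip-comm x' x))))
        (trans (ip-comm y _) (trans (ip-⊞ y' (Mᵗ k x') y) (cong₂ ℤ._+_ (ip-comm y' y) (ip-comm _ y)))))))
  }
  where
  module X = Similitude (M-similitude k)
  lem : ∀ a b c d → a ℤ.+ b ℤ.+ (c ℤ.- d) ≡ a ℤ.- d ℤ.+ (c ℤ.+ b)
  lem = ZS.solve-∀
  neg : ∀ {m} (x y : VV m) → x ⊟ y ≡ x ⊞ sc (ℤ.- + 1) y
  neg {zero} = λ x y → l x y
    where
    l : ∀ x y → x ℤ.- y ≡ x ℤ.+ ℤ.- + 1 ℤ.* y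
    l = ZS.solve-∀
  neg {suc m} (x , x') (y , y') = cong₂ _,_ (neg x y) (neg x' y')
  M-⊟ : ∀ x y → M k (x ⊟ y) ≡ M k x ⊟ M k y
  M-⊟ x y = trans (cong (M k) (neg x y)) (trans (X.A-⊞ x _) (trans (cong (M k x ⊞_) (X.A-sc _ y)) (sym (neg (M k x) (M k y)))))
  Mᵗ-⊟ : ∀ x y → Mᵗ k (x ⊟ y) ≡ Mᵗ k x ⊟ Mᵗ k y
  Mᵗ-⊟ x y = trans (cong (Mᵗ k) (neg x y)) (trans (X.Aᵗ-⊞ x _) (trans (cong (Mᵗ k x ⊞_) (X.Aᵗ-sc _ y)) (sym (neg (Mᵗ k x) (Mᵗ k y)))))

-- U and V on theta series

Θ : ∀ m → (VV m → Bool) → Ser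
Θ m C = Gen m (nm m) C

clsV : ∀ m → ℕ → VV m → VV m → Bool
clsV zero L c x = cls L c x
clsV (suc m) L c x = clsV m L (proj₁ c) (proj₁ x) ∧ clsV m L (proj₂ c) (proj₂ x)

∧-elim : ∀ {a b} → a ∧ b ≡ true → a ≡ true × b ≡ true
∧-elim {true} {true} _ = refl , refl

clsV-elim : ∀ m L c x → clsV m L c x ≡ true → ∃ λ z → x ≡ c ⊞ sc (+ L) z
clsV-elim zero L c x t = let (q , e) = cls-elim L c x t in q , trans e (cong (λ z → c ℤ.+ z) (ℤ.*-comm q (+ L)))
clsV-elim (suc m) L c x t = let (t1 , t2) = ∧-elim {clsV m L (proj₁ c) (proj₁ x)} t
                                (z , e) = clsV-elim m L _ _ t1 ; (z' , e') = clsV-elim m L _ _ t2 in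
  (z , z') , cong₂ _,_ e e'

clsV-intro : ∀ m L c x z → x ≡ c ⊞ sc (+ L) z → clsV m L c x ≡ true
clsV-intro zero L c x z e = cls-intro L c x z (trans e (cong (λ z → c ℤ.+ z) (ℤ.*-comm (+ L) z)))
clsV-intro (suc m) L c x z e = cong₂ _∧_ (clsV-intro m L _ _ _ (cong proj₁ e)) (clsV-intro m L _ _ _ (cong proj₂ e))

⇔-≡ : ∀ {a b : Bool} → (a ≡ true → b ≡ true) → (b ≡ true → a ≡ true) → a ≡ b
⇔-≡ {true} f g = sym (f refl)
⇔-≡ {false} {true} f g = g refl
⇔-≡ {false} {false} f g = refl

module _ {m k A Aᵗ} .{{_ : NonZero k}} (S : Similitude m k A Aᵗ) where
  open Similitude S
  -- If A x = k y then x = Aᵗ y, because Aᵗ A = k. So `Aᵗ` maps the points of `C ∘ Aᵗ` bijectively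
  -- to those of `C` and multiplies norms by `k`.
  U-Θ : ∀ C → (∀ x → C x ≡ true → ∃ λ y → A x ≡ sc (+ k) y) → U k (Θ m C) ≈ Θ m (C ∘ Aᵗ)
  U-Θ C h = pw λ n → Gen-bij {C = C} Aᵗ (k * n) n (λ x _ → nm-big m x) (λ x _ → nm-big m x)
    (λ y c e → c , trans (nm-Aᵗ y) (cong (k *_) e))
    (λ y y' _ _ e → sc-inj (+ k) y y' (trans (sym (AAᵗ y)) (trans (cong A e) (AAᵗ y'))))
    (λ x c e → let (y , p) = h x c
                   q : Aᵗ y ≡ x
                   q = sc-inj (+ k) (Aᵗ y) x (trans (sym (Aᵗ-sc (+ k) y)) (trans (cong Aᵗ (sym p)) (AᵗA x)))
       in y , trans (cong C q) c , ℕ.*-cancelˡ-≡ _ _ k (trans (sym (nm-Aᵗ y)) (trans (cong (nm m) q) e)) , q)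

module _ {m k A Aᵗ} .{{_ : NonZero k}} (S : Similitude m k A Aᵗ) where
  open Similitude S
  -- The norm k |z|² is that of y = A z, and Aᵗ y = k z detects whether z lies in the class. The
  -- proof takes the section again, by `U-Θ` for the transpose.
  V-Θ : ∀ L c → V k (Θ m (clsV m L c)) ≈ Θ m (λ y → clsV m (k * L) (sc (+ k) c) (Aᵗ y))
  V-Θ L c = ≈-trans (V-cong k (≈-sym sec)) (V-U k sup)
    where
    C' : VV m → Bool
    C' y = clsV m (k * L) (sc (+ k) c) (Aᵗ y)
    div : ∀ y → C' y ≡ true → ∃ λ z → Aᵗ y ≡ sc (+ k) (c ⊞ sc (+ L) z)
    div y t = let (z , e) = clsV-elim m (k * L) _ _ t in z , trans e (sym (trans (sc-⊞ (+ k) c _) (cong (sc (+ k) c ⊞_)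
      (trans (sc-sc (+ k) (+ L) z) (cong (λ w → sc w z) (sym (ℤ.pos-* k L)))))))
    same : ∀ z → C' (A z) ≡ clsV m L c z
    same z = ⇔-≡ (λ t → let (w , e) = div (A z) t in clsV-intro m L c z w (sc-inj (+ k) z _ (trans (sym (AᵗA z)) e)))
      (λ t → let (w , e) = clsV-elim m L c z t in clsV-intro m (k * L) (sc (+ k) c) _ w (trans (AᵗA z) (trans (cong (sc (+ k)) e)
        (trans (sc-⊞ (+ k) c _) (cong (sc (+ k) c ⊞_) (trans (sc-sc (+ k) (+ L) w) (cong (λ v → sc v w) (sym (ℤ.pos-* k L)))))))))
    sup : Supp k (Θ m C')
    sup n ¬d = Gen-zero n λ y t e → let (z , p) = div y t
                                        q : y ≡ A (c ⊞ sc (+ L) z)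
                                        q = sc-inj (+ k) y _ (trans (sym (AAᵗ y)) (trans (cong A p) (A-sc (+ k) _)))
      in ¬d (divides (nm m (c ⊞ sc (+ L) z)) (trans (sym e) (trans (cong (nm m) q) (trans (nm-A _) (ℕ.*-comm k _)))))
    sec : U k (Θ m C') ≈ Θ m (clsV m L c)
    sec = ≈-trans (U-Θ (transpose S) C' (λ y t → let (z , e) = div y t in c ⊞ sc (+ L) z , e)) (Gen-cong same)

opaque
  unfolding Gen

  -- x and -x cancel
  Θ₁-0 : ∀ L → Θ₁ L (+ 0) ≈ 𝟙
  Θ₁-0 L = pw λ n → trans (go n (λ x → cls L (+ 0) x ∧ mono (sq x) n) λ k → cong (_∧ mono (sq -[1+ k ]) n) (cong (λ z → does (L ∣? z)) (e k)))
    (trans (cong (_∧ mono 0 n) (dec-true (L ∣? 0) (divides 0 refl))) (at mono-0 n))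
    where
    e : ∀ k → ∣ + suc k ℤ.- + 0 ∣ ≡ ∣ -[1+ k ] ℤ.- + 0 ∣
    e k = cong suc (ℕ.+-identityʳ k)
    go : ∀ n (φ : ℤ → Bool) → (∀ k → φ (+ suc k) ≡ φ -[1+ k ]) → sumZ n φ ≡ φ (+ 0)
    go zero φ h = refl
    go (suc n) φ h = trans (cong₂ _xor_ (go n φ h) (trans (cong (_xor φ -[1+ n ]) (h n)) (xor-same (φ -[1+ n ])))) (xor-identityʳ _)

Θ₁-neg : ∀ L c → Θ₁ L (ℤ.- c) ≈ Θ₁ L c
Θ₁-neg L c = pw λ n → Gen-bij {C = cls L (ℤ.- c)} ℤ.-_ n n (λ x _ → sq-big x) (λ x _ → sq-big x)
  (λ y t e → incl c y t , trans (cong₂ _*_ (ℤ.∣-i∣≡∣i∣ y) (ℤ.∣-i∣≡∣i∣ y)) e)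
  (λ y y' _ _ e → ℤ.neg-injective e)
  (λ x t e → ℤ.- x , subst (λ z → cls L z (ℤ.- x) ≡ true) (ℤ.neg-involutive c) (incl (ℤ.- c) x t) , trans (cong₂ _*_ (ℤ.∣-i∣≡∣i∣ x) (ℤ.∣-i∣≡∣i∣ x)) e , ℤ.neg-involutive x)
  where
  incl : ∀ c y → cls L c y ≡ true → cls L (ℤ.- c) (ℤ.- y) ≡ true
  incl c y t = let (q , e) = cls-elim L c y t in cls-intro L (ℤ.- c) (ℤ.- y) (ℤ.- q) (trans (cong ℤ.-_ e) (lem c q (+ L)))
    where
    lem : ∀ c q L → ℤ.- (c ℤ.+ q ℤ.* L) ≡ ℤ.- c ℤ.+ ℤ.- q ℤ.* L
    lem = ZS.solve-∀

Θ₁-shift : ∀ L c q → Θ₁ L (c ℤ.+ q ℤ.* + L) ≈ Θ₁ L c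
Θ₁-shift L c q = Gen-cong λ x → ⇔-≡
  (λ t → let (p , e) = cls-elim L _ x t in cls-intro L c x (q ℤ.+ p) (trans e (l1 c q p (+ L))))
  (λ t → let (p , e) = cls-elim L c x t in cls-intro L _ x (p ℤ.- q) (trans e (l2 c q p (+ L))))
  where
  l1 : ∀ c q p L → c ℤ.+ q ℤ.* L ℤ.+ p ℤ.* L ≡ c ℤ.+ (q ℤ.+ p) ℤ.* L
  l1 = ZS.solve-∀
  l2 : ∀ c q p L → c ℤ.+ p ℤ.* L ≡ c ℤ.+ q ℤ.* L ℤ.+ (p ℤ.- q) ℤ.* L
  l2 = ZS.solve-∀

nm-sc : ∀ m k x → nm m (sc (+ k) x) ≡ k * (k * nm m x)
nm-sc zero k x = trans (cong₂ _*_ (ℤ.abs-* (+ k) x) (ℤ.abs-* (+ k) x)) (lem k ∣ x ∣)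
  where
  lem : ∀ k x → k * x * (k * x) ≡ k * (k * (x * x))
  lem = NS.solve-∀
nm-sc (suc m) k (x , y) = trans (cong₂ _+_ (nm-sc m k x) (nm-sc m k y)) (lem k (nm m x) (nm m y))
  where
  lem : ∀ k a b → k * (k * a) + k * (k * b) ≡ k * (k * (a + b))
  lem = NS.solve-∀

-- k |x|² = |A x|² = k² |y|².
Θ-supp : ∀ {m k A Aᵗ} .{{_ : NonZero k}} → Similitude m k A Aᵗ → ∀ C → (∀ x → C x ≡ true → ∃ λ y → A x ≡ sc (+ k) y) → Supp k (Θ m C)
Θ-supp {m} {k} S C h n ¬d = Gen-zero n λ x t e → let (y , p) = h x t in
  ¬d (divides (nm m y) (trans (sym e) (trans (ℕ.*-cancelˡ-≡ _ _ k (trans (sym (Similitude.nm-A S x)) (trans (cong (nm m) p) (nm-sc m k y)))) (ℕ.*-comm k _))))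

-- X^(2^m). For a theta series it is again one, on ℤ^(2^m); for every series it is X(q^(2^m)) modulo
-- 2.
pw2 : ℕ → Ser → Ser
pw2 zero X = X
pw2 (suc m) X = pw2 m X ⊗ pw2 m X

diag : ∀ m → ℤ → VV m
diag zero c = c
diag (suc m) c = diag m c , diag m c

pw2-cong : ∀ m {X Y} → X ≈ Y → pw2 m X ≈ pw2 m Y
pw2-cong zero p = p
pw2-cong (suc m) p = R.*-cong (pw2-cong m p) (pw2-cong m p)

pw2-Θ : ∀ m L c → pw2 m (Θ₁ L c) ≈ Θ m (clsV m L (diag m c))
pw2-Θ zero L c = ≈-refl
pw2-Θ (suc m) L c = ≈-trans (R.*-cong (pw2-Θ m L c) (pw2-Θ m L c)) (Gen-⊗ m (nm m) (nm m) _ _ (λ x _ → nm-big m x) (λ x _ → nm-big m x))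

pw2-V : ∀ m k .{{_ : NonZero k}} X → pw2 m (V k X) ≈ V k (pw2 m X)
pw2-V zero k X = ≈-refl
pw2-V (suc m) k X = ≈-trans (R.*-cong (pw2-V m k X) (pw2-V m k X)) (≈-sym (V-⊗ k _ _))

Periodic : ∀ {m} → ℕ → (VV m → Bool) → Set
Periodic L C = ∀ x z → C (x ⊞ sc (+ L) z) ≡ C x

clsV-periodic : ∀ m {L L'} c → L ∣ L' → Periodic {m} L' (clsV m L c)
clsV-periodic m {L} {L'} c (divides d eq) x z = ⇔-≡
  (λ t → let (w , e) = clsV-elim m L c _ t in clsV-intro m L c x (w ⊟ sc (+ d) z) (back x (sc (+ L') z) c (sc (+ L) w) (sc (+ L) (w ⊟ sc (+ d) z)) e (trans (sc-⊟ (+ L) w _) (cong (sc (+ L) w ⊟_) dz))))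
  (λ t → let (w , e) = clsV-elim m L c _ t in clsV-intro m L c _ (w ⊞ sc (+ d) z) (trans (cong (_⊞ sc (+ L') z) e) (trans (as c _ _) (cong (c ⊞_) (trans (cong (sc (+ L) w ⊞_) (sym dz)) (sym (sc-⊞ (+ L) w _)))))))
  where
  dz : sc (+ L) (sc (+ d) z) ≡ sc (+ L') z
  dz = trans (sc-sc (+ L) (+ d) z) (cong (λ v → sc v z) (trans (sym (ℤ.pos-* L d)) (cong +_ (trans (ℕ.*-comm L d) (sym eq)))))
  as : ∀ {m} (x y z : VV m) → x ⊞ y ⊞ z ≡ x ⊞ (y ⊞ z)
  as {zero} = ℤ.+-assoc
  as {suc m} _ _ _ = cong₂ _,_ (as _ _ _) (as _ _ _)
  back : ∀ {m} (x l c w v : VV m) → x ⊞ l ≡ c ⊞ w → v ≡ w ⊟ l → x ≡ c ⊞ v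
  back {zero} x l c w v e e' = trans (l1 x l) (trans (cong (λ z → z ℤ.- l) e) (trans (l2 c w l) (cong (λ z → c ℤ.+ z) (sym e'))))
    where
    l1 : ∀ x l → x ≡ x ℤ.+ l ℤ.- l
    l1 = ZS.solve-∀
    l2 : ∀ c w l → c ℤ.+ w ℤ.- l ≡ c ℤ.+ (w ℤ.- l)
    l2 = ZS.solve-∀
  back {suc m} _ _ _ _ _ e e' = cong₂ _,_ (back _ _ _ _ _ (cong proj₁ e) (cong proj₁ e')) (back _ _ _ _ _ (cong proj₂ e) (cong proj₂ e'))

periodic-∘ : ∀ {m k A Aᵗ} → Similitude m k A Aᵗ → ∀ {L C} → Periodic L C → Periodic L (C ∘ Aᵗ)
periodic-∘ S {L} {C} p x z = trans (cong C (trans (X.Aᵗ-⊞ x _) (cong (_ ⊞_) (X.Aᵗ-sc (+ L) z)))) (p _ _)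
  where
  module X = Similitude S

-- Abstracts from `Θ m`, so that an induction on the dimension can absorb a condition on half of the
-- coordinates into the functional.
record Additive (m : ℕ) (T : (VV m → Bool) → Ser) : Set where
  field
    T-cong : ∀ {C C'} → (∀ x → C x ≡ C' x) → T C ≈ T C'
    T-xor : ∀ C C' → T (λ x → C x xor C' x) ≈ T C ⊕ T C'
    T-false : T (λ _ → false) ≈ 𝟘

Θ-additive : ∀ m → Additive m (Θ m)
Θ-additive m = record { T-cong = Gen-cong ; T-xor = λ _ _ → Gen-xor ; T-false = Gen-false }

-- Polynomials in the theta series of modulus Λ

module Thetas (Λ : ℕ) .{{nzΛ : NonZero Λ}} where

  t : Fin Λ → Ser
  t i = Θ₁ Λ (+ toℕ i)

  red : ℤ → Fin Λ
  red c = fromℕ< (n%ℕd<d c Λ)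

  t-red : ∀ c → Θ₁ Λ c ≈ t (red c)
  t-red c = subst (λ z → Θ₁ Λ z ≈ t (red c)) (sym (trans (a≡a%ℕn+[a/ℕn]*n c Λ) (cong (λ z → z ℤ.+ (c /ℕ Λ) ℤ.* + Λ) (cong +_ (sym (Fin.toℕ-fromℕ< _))))))
    (Θ₁-shift Λ (+ toℕ (red c)) (c /ℕ Λ))

  mon : List (Fin Λ) → Ser
  mon [] = 𝟙
  mon (c ∷ cs) = t c ⊗ mon cs

  -- polynomials of degree at most n in the theta series t
  data R≤ (n : ℕ) (X : Ser) : Set where
    R-zero : X ≈ 𝟘 → R≤ n X
    R-add : ∀ {Y} cs → length cs ≤ n → X ≈ mon cs ⊕ Y → R≤ n Y → R≤ n X

  R-resp : ∀ {n X Y} → X ≈ Y → R≤ n X → R≤ n Y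
  R-resp p (R-zero e) = R-zero (≈-trans (≈-sym p) e)
  R-resp p (R-add cs l e r) = R-add cs l (≈-trans (≈-sym p) e) r

  R-weaken : ∀ {n n' X} → n ≤ n' → R≤ n X → R≤ n' X
  R-weaken le (R-zero e) = R-zero e
  R-weaken le (R-add cs l e r) = R-add cs (ℕ.≤-trans l le) e (R-weaken le r)

  R-mon : ∀ cs → R≤ (length cs) (mon cs)
  R-mon cs = R-add cs ℕ.≤-refl (≈-sym (R.+-identityʳ _)) (R-zero ≈-refl)

  R-𝟙 : R≤ 0 𝟙
  R-𝟙 = R-mon []

  R-t : ∀ i → R≤ 1 (t i)
  R-t i = R-resp (R.*-identityʳ _) (R-mon (i ∷ []))

  R-⊕ : ∀ {n X Y} → R≤ n X → R≤ n Y → R≤ n (X ⊕ Y)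
  R-⊕ (R-zero e) q = R-resp (≈-sym (≈-trans (R.+-congʳ e) (R.+-identityˡ _))) q
  R-⊕ (R-add cs l e r) q = R-add cs l (≈-trans (R.+-congʳ e) (R.+-assoc _ _ _)) (R-⊕ r q)

  mon-++ : ∀ cs ds → mon (cs List.++ ds) ≈ mon cs ⊗ mon ds
  mon-++ [] ds = ≈-sym (R.*-identityˡ _)
  mon-++ (c ∷ cs) ds = ≈-trans (R.*-congˡ (mon-++ cs ds)) (≈-sym (R.*-assoc _ _ _))

  R-linear : ∀ {n n'} (Op : Ser → Ser) → (∀ {X Y} → X ≈ Y → Op X ≈ Op Y) → (∀ X Y → Op (X ⊕ Y) ≈ Op X ⊕ Op Y) → Op 𝟘 ≈ 𝟘
    → (∀ cs → length cs ≤ n → R≤ n' (Op (mon cs))) → ∀ {X} → R≤ n X → R≤ n' (Op X)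
  R-linear Op oc oa o0 h (R-zero e) = R-zero (≈-trans (oc e) o0)
  R-linear Op oc oa o0 h (R-add cs l e r) = R-resp (≈-sym (≈-trans (oc e) (oa _ _))) (R-⊕ (h cs l) (R-linear Op oc oa o0 h r))

  R-⊗ : ∀ {n n' X Y} → R≤ n X → R≤ n' Y → R≤ (n + n') (X ⊗ Y)
  R-⊗ {n} {n'} {X} {Y} rX rY = R-linear (_⊗ Y) R.*-congʳ (λ A B → R.distribʳ Y A B) (R.zeroˡ Y)
    (λ cs l → R-linear (mon cs ⊗_) R.*-congˡ (R.distribˡ (mon cs)) (R.zeroʳ (mon cs))
      (λ ds l' → R-resp (mon-++ cs ds) (R-weaken (subst (_≤ n + n') (sym (LP.length-++ cs)) (ℕ.+-mono-≤ l l')) (R-mon (cs List.++ ds)))) rY) rX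

  private
    module _ {n : ℕ} where
      -- Collects the residues below `j` for j = 0, ..., Λ.
      base : ∀ T → Additive 0 T → (∀ c → R≤ n (T (cls Λ c))) → ∀ C → Periodic Λ C → R≤ n (T C)
      base T ad h C p = R-resp (T-cong λ x → trans (cong (C x ∧_) (dec-true (x %ℕ Λ ℕ.<? Λ) (n%ℕd<d x Λ))) (∧-identityʳ (C x))) (go Λ)
        where
        open Additive ad
        lt : ℕ → ℤ → Bool
        lt j x = does (x %ℕ Λ ℕ.<? j)
        val : ∀ x → C x ≡ C (+ (x %ℕ Λ))
        val x = trans (cong C (trans (a≡a%ℕn+[a/ℕn]*n x Λ) (cong (λ z → + (x %ℕ Λ) ℤ.+ z) (ℤ.*-comm (x /ℕ Λ) (+ Λ))))) (p _ (x /ℕ Λ))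
        step : ∀ j b → C (+ j) ≡ b → ∀ x → C x ∧ lt (suc j) x ≡ (C x ∧ lt j x) xor (b ∧ does (x %ℕ Λ ℕ.≟ j))
        step j b e x with ℕ.<-cmp (x %ℕ Λ) j
        ... | tri< a ¬b _ = trans (cong (C x ∧_) (trans (dec-true (x %ℕ Λ ℕ.<? suc j) (ℕ.m<n⇒m<1+n a)) (sym (dec-true (x %ℕ Λ ℕ.<? j) a))))
                (sym (trans (cong (λ z → (C x ∧ lt j x) xor (b ∧ z)) (dec-false (x %ℕ Λ ℕ.≟ j) ¬b)) (trans (cong ((C x ∧ lt j x) xor_) (∧-zeroʳ b)) (xor-identityʳ _))))
        ... | tri≈ ¬a refl _ = trans (cong (C x ∧_) (dec-true (x %ℕ Λ ℕ.<? suc j) ℕ.≤-refl)) (trans (cong (_∧ true) (trans (val x) e))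
                (sym (trans (cong₂ (λ y z → (C x ∧ y) xor (b ∧ z)) (dec-false (x %ℕ Λ ℕ.<? j) ¬a) (dec-true (x %ℕ Λ ℕ.≟ j) refl)) (cong (_xor (b ∧ true)) (∧-zeroʳ (C x))))))
        ... | tri> ¬a ¬b c = trans (cong (C x ∧_) (dec-false (x %ℕ Λ ℕ.<? suc j) λ { (s≤s q) → ℕ.<⇒≱ c q })) (trans (∧-zeroʳ (C x))
                (sym (trans (cong₂ (λ y z → (C x ∧ y) xor (b ∧ z)) (dec-false (x %ℕ Λ ℕ.<? j) ¬a) (dec-false (x %ℕ Λ ℕ.≟ j) ¬b)) (cong₂ _xor_ (∧-zeroʳ (C x)) (∧-zeroʳ b)))))
        point : ∀ j b → R≤ n (T (λ x → b ∧ does (x %ℕ Λ ℕ.≟ j)))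
        point j false = R-zero T-false
        point j true with j ℕ.<? Λ
        ... | no ¬l = R-zero (≈-trans (T-cong λ x → dec-false (x %ℕ Λ ℕ.≟ j) λ { refl → ¬l (n%ℕd<d x Λ) }) T-false)
        ... | yes l = R-resp (T-cong λ x → ⇔-≡
                (λ q → let (k , e) = cls-elim Λ (+ j) x q in dec-true (x %ℕ Λ ℕ.≟ j) (trans (cong (_%ℕ Λ) e) (mod-shift j k l)))
                (λ q → cls-intro Λ (+ j) x (x /ℕ Λ) (trans (a≡a%ℕn+[a/ℕn]*n x Λ) (cong (λ z → + z ℤ.+ (x /ℕ Λ) ℤ.* + Λ) (does-true (x %ℕ Λ ℕ.≟ j) q))))) (h (+ j))
          where
          mod-shift : ∀ j k → j < Λ → (+ j ℤ.+ k ℤ.* + Λ) %ℕ Λ ≡ j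
          mod-shift j k l = uniq (+ j ℤ.+ k ℤ.* + Λ) j k l refl
            where
            uniq : ∀ x j k → j < Λ → x ≡ + j ℤ.+ k ℤ.* + Λ → x %ℕ Λ ≡ j
            uniq x j k l e = ℤ-mod-unique (x %ℕ Λ) j (x /ℕ Λ) k (n%ℕd<d x Λ) l (trans (sym (a≡a%ℕn+[a/ℕn]*n x Λ)) e)
              where
              close : ∀ r r' (z : ℤ) → r < Λ → r' < Λ → + r ℤ.- + r' ≡ z ℤ.* + Λ → r ≡ r'
              close r r' z lr lr' e = ℤ.+-injective (ℤ.i-j≡0⇒i≡j (+ r) (+ r') (ℤ.∣i∣≡0⇒i≡0 (small ∣ + r ℤ.- + r' ∣ b (divides ∣ z ∣ (trans (cong ∣_∣ e) (ℤ.abs-* z (+ Λ)))))))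
                where
                b : ∣ + r ℤ.- + r' ∣ < Λ
                b = subst (_< Λ) (cong ∣_∣ (sym (ℤ.m-n≡m⊖n r r'))) (ℕ.≤-<-trans (ℤ.∣m⊝n∣≤m⊔n r r') (ℕ.⊔-lub lr lr'))
                small : ∀ n → n < Λ → Λ ∣ n → n ≡ 0
                small zero _ _ = refl
                small (suc n) lt d = ⊥-elim (ℕ.<⇒≱ lt (ND.∣⇒≤ d))
              ℤ-mod-unique : ∀ r r' a b → r < Λ → r' < Λ → + r ℤ.+ a ℤ.* + Λ ≡ + r' ℤ.+ b ℤ.* + Λ → r ≡ r'
              ℤ-mod-unique r r' a b lr lr' e = close r r' (b ℤ.- a) lr lr' (trans (l1 (+ r) (+ r') a (+ Λ)) (trans (cong (λ z → z ℤ.- + r' ℤ.- a ℤ.* + Λ) e) (l2 (+ r') a b (+ Λ))))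
                where
                l1 : ∀ r r' a L → r ℤ.- r' ≡ r ℤ.+ a ℤ.* L ℤ.- r' ℤ.- a ℤ.* L
                l1 = ZS.solve-∀
                l2 : ∀ r' a b L → r' ℤ.+ b ℤ.* L ℤ.- r' ℤ.- a ℤ.* L ≡ (b ℤ.- a) ℤ.* L
                l2 = ZS.solve-∀
        go : ∀ j → R≤ n (T (λ x → C x ∧ lt j x))
        go zero = R-zero (≈-trans (T-cong λ x → trans (cong (C x ∧_) (dec-false (x %ℕ Λ ℕ.<? 0) λ ())) (∧-zeroʳ (C x))) T-false)
        go (suc j) = R-resp (≈-sym (≈-trans (T-cong (step j (C (+ j)) refl)) (T-xor _ _))) (R-⊕ (go j) (point j (C (+ j))))

  -- A periodic set is a disjoint union of classes. Once the class of the first half of the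
  -- coordinates is fixed, periodicity makes `C` a condition on the second half alone.
  R-periodic : ∀ {n} m T → Additive m T → (∀ c → R≤ n (T (clsV m Λ c))) → ∀ C → Periodic Λ C → R≤ n (T C)
  R-periodic zero T ad h C p = base T ad h C p
  R-periodic (suc m) T ad h C p = R-periodic m (λ A → T (λ q → A (proj₁ q) ∧ C q))
    (record { T-cong = λ e → T-cong λ q → cong (_∧ C q) (e (proj₁ q))
            ; T-xor = λ A B → ≈-trans (T-cong λ q → ∧-distribʳ-xor (C q) (A (proj₁ q)) (B (proj₁ q))) (T-xor _ _) ; T-false = T-false })
    (λ c → R-resp (T-cong λ q → fix c q) (R-periodic m (λ D → T (λ q → clsV m Λ c (proj₁ q) ∧ D (proj₂ q)))
      (record { T-cong = λ e → T-cong λ q → cong (clsV m Λ c (proj₁ q) ∧_) (e (proj₂ q))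
              ; T-xor = λ A B → ≈-trans (T-cong λ q → ∧-distribˡ-xor (clsV m Λ c (proj₁ q)) (A (proj₂ q)) (B (proj₂ q))) (T-xor _ _)
              ; T-false = ≈-trans (T-cong λ q → ∧-zeroʳ (clsV m Λ c (proj₁ q))) T-false })
      (λ c' → h (c , c')) (λ y → C (c , y)) (λ y z → trans (cong (λ w → C (w , y ⊞ sc (+ Λ) z)) (sym (⊞-sc-0 c))) (p (c , y) (diag m (+ 0) , z)))))
    -- `C` has moved into the functional, so the indicator left over for the first half is constant.
    (λ _ → true) (λ _ _ → refl)
    where
    open Additive ad
    ⊞-sc-0 : ∀ {m} (c : VV m) → c ⊞ sc (+ Λ) (diag m (+ 0)) ≡ c
    ⊞-sc-0 {zero} c = trans (cong (λ z → c ℤ.+ z) (ℤ.*-zeroʳ (+ Λ))) (ℤ.+-identityʳ c)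
    ⊞-sc-0 {suc m} (c , c') = cong₂ _,_ (⊞-sc-0 c) (⊞-sc-0 c')
    fix : ∀ c q → clsV m Λ c (proj₁ q) ∧ C (c , proj₂ q) ≡ clsV m Λ c (proj₁ q) ∧ C q
    fix c (x , y) with clsV m Λ c x in eq
    ... | false = refl
    ... | true = let (z , e) = clsV-elim m Λ c x eq in trans (sym (p (c , y) (z , diag m (+ 0)))) (cong C (cong₂ _,_ (sym e) (⊞-sc-0 y)))

  R-Θ : ∀ m C → Periodic Λ C → R≤ (2 ℕ.^ m) (Θ m C)
  R-Θ m C p = R-periodic m (Θ m) (Θ-additive m) (cl m) C p
    where
    cl : ∀ m c → R≤ (2 ℕ.^ m) (Θ m (clsV m Λ c))
    cl zero c = R-resp (≈-sym (t-red c)) (R-t (red c))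
    cl (suc m) (c , c') = R-resp (Gen-⊗ m (nm m) (nm m) _ _ (λ x _ → nm-big m x) (λ x _ → nm-big m x))
      (subst (λ z → R≤ z (Θ m (clsV m Λ c) ⊗ Θ m (clsV m Λ c'))) (cong (2 ℕ.^ m ℕ.+_) (sym (ℕ.+-identityʳ _))) (R-⊗ (cl m c) (cl m c')))

-- The sections U₂ and U₃ of monomials

private
  no-div : ∀ k r n z → 0 < r → r < k → + (k * n) ≡ + r ℤ.+ + k ℤ.* z → ⊥
  no-div k r n z 0<r r<k e = ℕ.<⇒≱ r<k (ND.∣⇒≤ {{ℕ.>-nonZero 0<r}} (divides ∣ + n ℤ.- z ∣ (trans (cong ∣_∣ (trans (l (+ r) (+ k) z) (trans (cong (λ w → w ℤ.- + k ℤ.* z) (trans (sym e) (ℤ.pos-* k n))) (l2 (+ k) (+ n) z)))) (ℤ.abs-* (+ n ℤ.- z) (+ k)))))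
    where
    l : ∀ r k z → r ≡ r ℤ.+ k ℤ.* z ℤ.- k ℤ.* z
    l = ZS.solve-∀
    l2 : ∀ k n z → k ℤ.* n ℤ.- k ℤ.* z ≡ (n ℤ.- z) ℤ.* k
    l2 = ZS.solve-∀

module Operators (Λ : ℕ) .{{nzΛ : NonZero Λ}} (2∣Λ : 2 ∣ Λ) (3∣Λ : 3 ∣ Λ) where
  open Thetas Λ public

  private
    -- As `k` divides `Λ`, the divisibility of A x by `k` depends only on the class of x, so `U-Θ`
    -- applies as soon as it holds for the representative `c`.
    transform : ∀ {m k A Aᵗ} .{{_ : NonZero k}} → Similitude m k A Aᵗ → k ∣ Λ → ∀ c w → A c ≡ sc (+ k) w
      → Supp k (Θ m (clsV m Λ c)) × R≤ (2 ℕ.^ m) (U k (Θ m (clsV m Λ c)))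
    transform {m} {k} {A} {Aᵗ} S (divides d Λ≡) c w e = Θ-supp S _ h
      , R-resp (≈-sym (U-Θ S _ h)) (R-Θ m _ (periodic-∘ S (clsV-periodic m c ND.∣-refl)))
      where
      module X = Similitude S
      h : ∀ x → clsV m Λ c x ≡ true → ∃ λ y → A x ≡ sc (+ k) y
      h x t = let (z , p) = clsV-elim m Λ c x t in w ⊞ sc (+ d) (A z) ,
        trans (cong A p) (trans (X.A-⊞ c _) (trans (cong₂ _⊞_ e (trans (X.A-sc (+ Λ) z) (trans (cong (λ v → sc v (A z)) (trans (cong +_ (trans Λ≡ (ℕ.*-comm d k))) (ℤ.pos-* k d))) (sym (sc-sc (+ k) (+ d) (A z)))))) (sym (sc-⊞ (+ k) w _))))

    Θ₁² : ∀ a b → Θ₁ Λ a ⊗ Θ₁ Λ b ≈ Θ 1 (clsV 1 Λ (a , b))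
    Θ₁² a b = Gen-⊗ 0 sq sq _ _ (λ x _ → sq-big x) (λ x _ → sq-big x)

    Θ₁⁴ : ∀ a b c d → (Θ₁ Λ a ⊗ Θ₁ Λ b) ⊗ (Θ₁ Λ c ⊗ Θ₁ Λ d) ≈ Θ 2 (clsV 2 Λ ((a , b) , (c , d)))
    Θ₁⁴ a b c d = ≈-trans (R.*-cong (Θ₁² a b) (Θ₁² c d)) (Gen-⊗ 1 (nm 1) (nm 1) _ _ (λ x _ → nm-big 1 x) (λ x _ → nm-big 1 x))

    fold : ∀ {k n X Y} → X ≈ Y → Supp k X × R≤ n (U k X) → Supp k Y × R≤ n (U k Y)
    fold {k} p (s , r) = Supp-resp p s , R-resp (U-cong k p) r

    -- `M 1` sends (a, b) to (a + b, b - a), and both entries are even if the sum is.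
    pair₂ : ∀ a b u → a ℤ.+ b ≡ + 2 ℤ.* u → Supp 2 (Θ₁ Λ a ⊗ Θ₁ Λ b) × R≤ 2 (U 2 (Θ₁ Λ a ⊗ Θ₁ Λ b))
    pair₂ a b u e = fold (≈-sym (Θ₁² a b)) (transform (M-similitude 1) 2∣Λ (a , b) (u , u ℤ.- a)
      (cong₂ _,_ e (trans (l1 a b) (trans (cong (λ z → z ℤ.- + 2 ℤ.* a) e) (l2 u a)))))
      where
      l1 : ∀ a b → b ℤ.- a ≡ a ℤ.+ b ℤ.- + 2 ℤ.* a
      l1 = ZS.solve-∀
      l2 : ∀ u a → + 2 ℤ.* u ℤ.- + 2 ℤ.* a ≡ + 2 ℤ.* (u ℤ.- a)
      l2 = ZS.solve-∀

    ⊗Θ₀ : ∀ X → X ⊗ Θ₁ Λ (+ 0) ≈ X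
    ⊗Θ₀ X = ≈-trans (R.*-congˡ (Θ₁-0 Λ)) (R.*-identityʳ X)

    -- The second variable is supplied by the class 0, whose theta series is 1.
    even₂ : ∀ u → Supp 2 (Θ₁ Λ (+ 2 ℤ.* u)) × R≤ 2 (U 2 (Θ₁ Λ (+ 2 ℤ.* u)))
    even₂ u = fold (⊗Θ₀ _) (pair₂ (+ 2 ℤ.* u) (+ 0) u (ℤ.+-identityʳ _))

    zero₃ : ∀ u → Supp 3 (Θ₁ Λ (+ 3 ℤ.* u)) × R≤ 4 (U 3 (Θ₁ Λ (+ 3 ℤ.* u)))
    zero₃ u = fold (≈-trans (≈-sym (Θ₁⁴ a (+ 0) (+ 0) (+ 0))) (≈-trans (R.*-cong (⊗Θ₀ _) (≈-trans (⊗Θ₀ _) (Θ₁-0 Λ))) (R.*-identityʳ _)))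
      (transform (M-similitude 2) 3∣Λ ((a , + 0) , (+ 0 , + 0)) ((u , + 0) , (ℤ.- u , ℤ.- u))
        (cong₂ _,_ (cong₂ _,_ (ℤ.+-identityʳ a) refl) (cong₂ _,_ (l1 u) (l2 u))))
      where
      a = + 3 ℤ.* u
      l1 : ∀ u → + 0 ℤ.- (+ 3 ℤ.* u ℤ.- + 0) ≡ + 3 ℤ.* ℤ.- u
      l1 = ZS.solve-∀
      l2 : ∀ u → + 0 ℤ.- (+ 0 ℤ.+ + 3 ℤ.* u) ≡ + 3 ℤ.* ℤ.- u
      l2 = ZS.solve-∀

    -- `M 2` sends (a, 0, b, c) to (a + b + c, c - b, b - a, c - a). All entries are divisible by 3
    -- if a, b and c are 1 modulo 3; the class 0 fills the fourth place.
    triple₃ : ∀ u v w → let X = Θ₁ Λ (+ 1 ℤ.+ + 3 ℤ.* u) ⊗ (Θ₁ Λ (+ 1 ℤ.+ + 3 ℤ.* v) ⊗ Θ₁ Λ (+ 1 ℤ.+ + 3 ℤ.* w)) in Supp 3 X × R≤ 4 (U 3 X)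
    triple₃ u v w = fold (≈-trans (≈-sym (Θ₁⁴ a (+ 0) b c)) (R.*-congʳ (⊗Θ₀ _)))
      (transform (M-similitude 2) 3∣Λ ((a , + 0) , (b , c)) ((+ 1 ℤ.+ u ℤ.+ v ℤ.+ w , w ℤ.- v) , (v ℤ.- u , w ℤ.- u))
        (cong₂ _,_ (cong₂ _,_ (l1 u v w) (l2 v w)) (cong₂ _,_ (l3 u v) (l4 u w))))
      where
      a = + 1 ℤ.+ + 3 ℤ.* u
      b = + 1 ℤ.+ + 3 ℤ.* v
      c = + 1 ℤ.+ + 3 ℤ.* w
      l1 : ∀ u v w → + 1 ℤ.+ + 3 ℤ.* u ℤ.+ (+ 1 ℤ.+ + 3 ℤ.* v ℤ.+ (+ 1 ℤ.+ + 3 ℤ.* w)) ≡ + 3 ℤ.* (+ 1 ℤ.+ u ℤ.+ v ℤ.+ w)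
      l1 = ZS.solve-∀
      l2 : ∀ v w → + 0 ℤ.+ (+ 1 ℤ.+ + 3 ℤ.* w ℤ.- (+ 1 ℤ.+ + 3 ℤ.* v)) ≡ + 3 ℤ.* (w ℤ.- v)
      l2 = ZS.solve-∀
      l3 : ∀ u v → + 1 ℤ.+ + 3 ℤ.* v ℤ.- (+ 1 ℤ.+ + 3 ℤ.* u ℤ.- + 0) ≡ + 3 ℤ.* (v ℤ.- u)
      l3 = ZS.solve-∀
      l4 : ∀ u w → + 1 ℤ.+ + 3 ℤ.* w ℤ.- (+ 0 ℤ.+ (+ 1 ℤ.+ + 3 ℤ.* u)) ≡ + 3 ℤ.* (w ℤ.- u)
      l4 = ZS.solve-∀

    sq-res : ∀ k u x → k ∣ Λ → cls Λ (+ 1 ℤ.+ + k ℤ.* u) x ≡ true → ∃ λ z → + sq x ≡ + 1 ℤ.+ + k ℤ.* z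
    sq-res k u x (divides d e) t = let (q , p) = cls-elim Λ _ x t
                                       y = u ℤ.+ q ℤ.* + d
                                       x≡ : x ≡ + 1 ℤ.+ + k ℤ.* y
                                       x≡ = trans p (trans (cong (λ z → + 1 ℤ.+ + k ℤ.* u ℤ.+ q ℤ.* z) (trans (cong +_ e) (ℤ.pos-* d k))) (l1 (+ k) u q (+ d)))
      in + 2 ℤ.* y ℤ.+ + k ℤ.* (y ℤ.* y) , trans (sq-+ x) (trans (cong₂ ℤ._*_ x≡ x≡) (l2 (+ k) y))
      where
      l1 : ∀ k u q d → + 1 ℤ.+ k ℤ.* u ℤ.+ q ℤ.* (d ℤ.* k) ≡ + 1 ℤ.+ k ℤ.* (u ℤ.+ q ℤ.* d)
      l1 = ZS.solve-∀
      l2 : ∀ k y → (+ 1 ℤ.+ k ℤ.* y) ℤ.* (+ 1 ℤ.+ k ℤ.* y) ≡ + 1 ℤ.+ k ℤ.* (+ 2 ℤ.* y ℤ.+ k ℤ.* (y ℤ.* y))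
      l2 = ZS.solve-∀

    -- A factor left without partners contributes nothing: its exponents are 1 modulo `k`.
    kill-one : ∀ k u → 1 < k → k ∣ Λ → U k (Θ₁ Λ (+ 1 ℤ.+ + k ℤ.* u)) ≈ 𝟘
    kill-one k u 1<k d = pw λ n → trans (Gen-zero (k * n) λ x t e → let (z , p) = sq-res k u x d t in no-div k 1 n z (s≤s z≤n) 1<k (trans (cong +_ (sym e)) p)) (sym (𝟘-at n))

    kill-two : ∀ u v → U 3 (Θ₁ Λ (+ 1 ℤ.+ + 3 ℤ.* u) ⊗ Θ₁ Λ (+ 1 ℤ.+ + 3 ℤ.* v)) ≈ 𝟘
    kill-two u v = ≈-trans (U-cong 3 (Θ₁² _ _)) (pw λ n → trans (Gen-zero (3 * n) λ (x , y) t e →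
      let (t1 , t2) = ∧-elim t ; (z , p) = sq-res 3 u x 3∣Λ t1 ; (w , q) = sq-res 3 v y 3∣Λ t2 in
      no-div 3 2 n (z ℤ.+ w) (s≤s z≤n) ℕ.≤-refl (trans (cong +_ (sym e)) (trans (ℤ.pos-+ (sq x) (sq y)) (trans (cong₂ ℤ._+_ p q) (l z w))))) (sym (𝟘-at n)))
      where
      l : ∀ z w → + 1 ℤ.+ + 3 ℤ.* z ℤ.+ (+ 1 ℤ.+ + 3 ℤ.* w) ≡ + 2 ℤ.+ + 3 ℤ.* (z ℤ.+ w)
      l = ZS.solve-∀

    class₂ : ∀ i → (∃ λ u → t i ≈ Θ₁ Λ (+ 2 ℤ.* u)) ⊎ (∃ λ u → t i ≈ Θ₁ Λ (+ 1 ℤ.+ + 2 ℤ.* u))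
    class₂ i = go (toℕ i ℕ.% 2) (toℕ i ℕ./ 2) (ℕM.m%n<n (toℕ i) 2) (ℕM.m≡m%n+[m/n]*n (toℕ i) 2)
      where
      go : ∀ r q → r < 2 → toℕ i ≡ r + q * 2 → (∃ λ u → t i ≈ Θ₁ Λ (+ 2 ℤ.* u)) ⊎ (∃ λ u → t i ≈ Θ₁ Λ (+ 1 ℤ.+ + 2 ℤ.* u))
      go 0 q _ e = inj₁ (+ q , subst (λ z → t i ≈ Θ₁ Λ z) (trans (cong +_ (trans e (ℕ.*-comm q 2))) (ℤ.pos-* 2 q)) ≈-refl)
      go 1 q _ e = inj₂ (+ q , subst (λ z → t i ≈ Θ₁ Λ z) (trans (cong +_ (trans e (cong suc (ℕ.*-comm q 2)))) (cong (λ z → + 1 ℤ.+ z) (ℤ.pos-* 2 q))) ≈-refl)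
      go (suc (suc _)) q (s≤s (s≤s ())) e

    class₃ : ∀ i → (∃ λ u → t i ≈ Θ₁ Λ (+ 3 ℤ.* u)) ⊎ (∃ λ u → t i ≈ Θ₁ Λ (+ 1 ℤ.+ + 3 ℤ.* u))
    class₃ i = go (toℕ i ℕ.% 3) (toℕ i ℕ./ 3) (ℕM.m%n<n (toℕ i) 3) (ℕM.m≡m%n+[m/n]*n (toℕ i) 3)
      where
      go : ∀ r q → r < 3 → toℕ i ≡ r + q * 3 → (∃ λ u → t i ≈ Θ₁ Λ (+ 3 ℤ.* u)) ⊎ (∃ λ u → t i ≈ Θ₁ Λ (+ 1 ℤ.+ + 3 ℤ.* u))
      go 0 q _ e = inj₁ (+ q , subst (λ z → t i ≈ Θ₁ Λ z) (trans (cong +_ (trans e (ℕ.*-comm q 3))) (ℤ.pos-* 3 q)) ≈-refl)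
      go 1 q _ e = inj₂ (+ q , subst (λ z → t i ≈ Θ₁ Λ z) (trans (cong +_ (trans e (cong suc (ℕ.*-comm q 3)))) (cong (λ z → + 1 ℤ.+ z) (ℤ.pos-* 3 q))) ≈-refl)
      -- The class 2 is -1 modulo 3, and the reflection x → -x turns it into 1.
      go 2 q _ e = inj₂ (ℤ.- + 1 ℤ.+ ℤ.- + q , ≈-trans (≈-sym (Θ₁-neg Λ (+ toℕ i))) (subst (λ z → Θ₁ Λ (ℤ.- + toℕ i) ≈ Θ₁ Λ z)
        (trans (cong (λ z → ℤ.- + z) e) (trans (cong ℤ.-_ (trans (ℤ.pos-+ 2 (q * 3)) (cong (λ z → + 2 ℤ.+ z) (ℤ.pos-* q 3)))) (l (+ q)))) ≈-refl))
        where
        l : ∀ q → ℤ.- (+ 2 ℤ.+ q ℤ.* + 3) ≡ + 1 ℤ.+ + 3 ℤ.* (ℤ.- + 1 ℤ.+ ℤ.- q)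
        l = ZS.solve-∀
      go (suc (suc (suc _))) q (s≤s (s≤s (s≤s ()))) e

    U-mul : ∀ k .{{_ : NonZero k}} {n n' X Y} → Supp k X × R≤ n (U k X) → R≤ n' (U k Y) → R≤ (n + n') (U k (X ⊗ Y))
    U-mul k {Y = Y} (s , r) r' = R-resp (≈-sym (U-Supp-⊗ k Y s)) (R-⊗ r r')

    U-𝟙 : ∀ k .{{_ : NonZero k}} → U k 𝟙 ≈ 𝟙
    U-𝟙 k = ≈-trans (U-cong k (≈-sym (V𝟙 k))) (UV k 𝟙)
      where
      V𝟙 : ∀ k .{{_ : NonZero k}} → V k 𝟙 ≈ 𝟙
      V𝟙 k = ≈-trans (V-cong k (≈-sym mono-0)) (≈-trans (V-mono k 0) (≈-trans (mono-≡ (ℕ.*-zeroʳ k)) mono-0))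

  -- U₂ of a monomial: even classes factor out, odd classes are paired off.
  U₂-short : ∀ cs → R≤ (2 * length cs) (U 2 (mon cs)) × (∀ u → R≤ (2 + 2 * length cs) (U 2 (Θ₁ Λ (+ 1 ℤ.+ + 2 ℤ.* u) ⊗ mon cs)))
  U₂-short [] = R-resp (≈-sym (U-𝟙 2)) R-𝟙 , λ u → R-zero (≈-trans (U-cong 2 (R.*-identityʳ _)) (kill-one 2 u (s≤s (s≤s z≤n)) 2∣Λ))
  U₂-short (c ∷ cs) with U₂-short cs | class₂ c
  ... | r , h | inj₁ (v , e) = R-weaken (ℕ.≤-reflexive (l (length cs))) (R-resp (U-cong 2 (R.*-congʳ (≈-sym e))) (U-mul 2 (even₂ v) r))
      , λ u → R-weaken (ℕ.≤-reflexive (l' (length cs))) (R-resp (U-cong 2 (≈-trans (solve 3 (λ x y z → y :* (x :* z) := x :* (y :* z)) R.refl (Θ₁ Λ (+ 1 ℤ.+ + 2 ℤ.* u)) (Θ₁ Λ (+ 2 ℤ.* v)) (mon cs)) (R.*-congˡ (R.*-congʳ (≈-sym e)))))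
          (U-mul 2 (even₂ v) (h u)))
    where
    l : ∀ n → 2 + 2 * n ≡ 2 * suc n
    l = NS.solve-∀
    l' : ∀ n → 2 + (2 + 2 * n) ≡ 2 + 2 * suc n
    l' = NS.solve-∀
  ... | r , h | inj₂ (v , e) = R-weaken (ℕ.≤-reflexive (l (length cs))) (R-resp (U-cong 2 (R.*-congʳ (≈-sym e))) (h v))
      , λ u → R-weaken (ℕ.≤-trans (ℕ.≤-reflexive (l (length cs))) (ℕ.m≤n+m _ 2)) (R-resp (U-cong 2 (≈-trans (R.*-assoc _ _ _) (R.*-congˡ (R.*-congʳ (≈-sym e)))))
          (U-mul 2 (pair₂ (+ 1 ℤ.+ + 2 ℤ.* u) (+ 1 ℤ.+ + 2 ℤ.* v) (+ 1 ℤ.+ u ℤ.+ v) (l2 u v)) r))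
    where
    l : ∀ n → 2 + 2 * n ≡ 2 * suc n
    l = NS.solve-∀
    l2 : ∀ u v → + 1 ℤ.+ + 2 ℤ.* u ℤ.+ (+ 1 ℤ.+ + 2 ℤ.* v) ≡ + 2 ℤ.* (+ 1 ℤ.+ u ℤ.+ v)
    l2 = ZS.solve-∀

  -- The three parts hold zero, one or two factors of class 1 modulo 3 that wait for a third. A
  -- complete triple factors out of `U 3`, as does a class 0 modulo 3, and an incomplete triple at
  -- the end gives 0. The degree may grow; `U 2` reduces it later.
  U₃-mon : ∀ cs → R≤ (4 * length cs) (U 3 (mon cs)) × (∀ u → R≤ (4 + 4 * length cs) (U 3 (Θ₁ Λ (+ 1 ℤ.+ + 3 ℤ.* u) ⊗ mon cs)))
    × (∀ u v → R≤ (8 + 4 * length cs) (U 3 ((Θ₁ Λ (+ 1 ℤ.+ + 3 ℤ.* u) ⊗ Θ₁ Λ (+ 1 ℤ.+ + 3 ℤ.* v)) ⊗ mon cs)))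
  U₃-mon [] = R-resp (≈-sym (U-𝟙 3)) R-𝟙 , (λ u → R-zero (≈-trans (U-cong 3 (R.*-identityʳ _)) (kill-one 3 u (s≤s (s≤s z≤n)) 3∣Λ)))
    , λ u v → R-zero (≈-trans (U-cong 3 (R.*-identityʳ _)) (kill-two u v))
  U₃-mon (c ∷ cs) with U₃-mon cs | class₃ c
  ... | r , h , h' | inj₁ (w , e) = go (R.*-congʳ (≈-sym e)) (length cs) r
      , (λ u → R-weaken (ℕ.≤-reflexive (l (length cs))) (R-resp (U-cong 3 (move (Θ₁ Λ (+ 1 ℤ.+ + 3 ℤ.* u)))) (U-mul 3 (zero₃ w) (h u))))
      , λ u v → R-weaken (ℕ.≤-reflexive (l' (length cs))) (R-resp (U-cong 3 (move (Θ₁ Λ (+ 1 ℤ.+ + 3 ℤ.* u) ⊗ Θ₁ Λ (+ 1 ℤ.+ + 3 ℤ.* v)))) (U-mul 3 (zero₃ w) (h' u v)))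
    where
    move : ∀ x → Θ₁ Λ (+ 3 ℤ.* w) ⊗ (x ⊗ mon cs) ≈ x ⊗ (t c ⊗ mon cs)
    move x = ≈-trans (solve 3 (λ x y z → y :* (x :* z) := x :* (y :* z)) R.refl x (Θ₁ Λ (+ 3 ℤ.* w)) (mon cs)) (R.*-congˡ (R.*-congʳ (≈-sym e)))
    l0 : ∀ n → 4 + 4 * n ≡ 4 * suc n
    l0 = NS.solve-∀
    l : ∀ n → 4 + (4 + 4 * n) ≡ 4 + 4 * suc n
    l = NS.solve-∀
    l' : ∀ n → 4 + (8 + 4 * n) ≡ 8 + 4 * suc n
    l' = NS.solve-∀
    go : ∀ {X} → Θ₁ Λ (+ 3 ℤ.* w) ⊗ mon cs ≈ X → ∀ n → R≤ (4 * n) (U 3 (mon cs)) → R≤ (4 * suc n) (U 3 X)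
    go p n r = R-weaken (ℕ.≤-reflexive (l0 n)) (R-resp (U-cong 3 p) (U-mul 3 (zero₃ w) r))
  ... | r , h , h' | inj₂ (w , e) = R-weaken (ℕ.≤-reflexive (l0 (length cs))) (R-resp (U-cong 3 (R.*-congʳ (≈-sym e))) (h w))
      , (λ u → R-weaken (ℕ.≤-reflexive (l (length cs))) (R-resp (U-cong 3 (≈-trans (R.*-assoc _ _ _) (R.*-congˡ (R.*-congʳ (≈-sym e))))) (h' u w)))
      , λ u v → R-weaken (ℕ.≤-trans (ℕ.≤-reflexive (l0 (length cs))) (ℕ.m≤n+m _ 8)) (R-resp (U-cong 3 (≈-trans
          (solve 4 (λ x y z s → (x :* (y :* z)) :* s := (x :* y) :* (z :* s)) R.refl (Θ₁ Λ (+ 1 ℤ.+ + 3 ℤ.* u)) (Θ₁ Λ (+ 1 ℤ.+ + 3 ℤ.* v)) (Θ₁ Λ (+ 1 ℤ.+ + 3 ℤ.* w)) (mon cs)) (R.*-congˡ (R.*-congʳ (≈-sym e)))))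
          (U-mul 3 (triple₃ u v w) r))
    where
    l0 : ∀ n → 4 + 4 * n ≡ 4 * suc n
    l0 = NS.solve-∀
    l : ∀ n → 8 + 4 * n ≡ 4 + 4 * suc n
    l = NS.solve-∀

  private
    mon-remove : ∀ cs i → mon cs ≈ t (lookup cs i) ⊗ mon (removeAt cs i)
    mon-remove (c ∷ cs) Fin.zero = ≈-refl
    mon-remove (c ∷ cs) (Fin.suc i) = ≈-trans (R.*-congˡ (mon-remove cs i)) (solve 3 (λ x y z → x :* (y :* z) := y :* (x :* z)) R.refl (t c) (t (lookup cs i)) (mon (removeAt cs i)))

    lookup-remove : ∀ (cs : List (Fin Λ)) i j → i Fin.< j → ∃ λ i' → lookup (removeAt cs j) i' ≡ lookup cs i
    lookup-remove (c ∷ cs) Fin.zero (Fin.suc j) lt = zero-case cs j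
      where
      zero-case : ∀ cs (j : Fin (length cs)) → ∃ λ i' → lookup (c ∷ removeAt cs j) i' ≡ c
      zero-case cs j = Fin.zero , refl
    lookup-remove (c ∷ cs) (Fin.suc i) (Fin.suc j) (s≤s lt) = let (i' , e) = lookup-remove cs i j lt in Fin.suc i' , e

    length-remove : ∀ (cs : List (Fin Λ)) i → suc (length (removeAt cs i)) ≡ length cs
    length-remove (c ∷ cs) Fin.zero = refl
    length-remove (c ∷ cs) (Fin.suc i) = cong suc (length-remove cs i)

  -- A monomial of degree larger than Λ contains the square of a generator, and U₂ (X² Y) = X U₂ Y.
  U₂-mon : ∀ b cs → length cs ≤ b + b + Λ → R≤ (b + 2 * Λ) (U 2 (mon cs))
  U₂-mon b cs le with length cs ℕ.≤? Λ
  ... | yes l = R-weaken (ℕ.≤-trans (ℕ.*-monoʳ-≤ 2 l) (ℕ.m≤n+m _ b)) (proj₁ (U₂-short cs))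
  U₂-mon zero cs le | no ¬l = ⊥-elim (¬l le)
  U₂-mon (suc b) cs le | no ¬l with Fin.pigeonhole (ℕ.≰⇒> ¬l) (lookup cs)
  ... | i , j , i<j , e with lookup-remove cs i j i<j
  ... | i' , e' = R-resp (≈-sym main) (R-⊗ (R-t (lookup cs j)) (U₂-mon b ds le'))
    where
    ds = removeAt (removeAt cs j) i'
    le' : length ds ≤ b + b + Λ
    le' = ℕ.≤-pred (ℕ.≤-pred (subst (_≤ 2 + (b + b + Λ)) (sym (trans (cong suc (length-remove (removeAt cs j) i')) (length-remove cs j)))
      (subst (length cs ≤_) (cong (λ z → suc (z + Λ)) (ℕ.+-suc b b)) le)))
    main : U 2 (mon cs) ≈ t (lookup cs j) ⊗ U 2 (mon ds)
    main = ≈-trans (U-cong 2 (≈-trans (mon-remove cs j) (≈-trans (R.*-congˡ (≈-trans (mon-remove (removeAt cs j) i') (R.*-congʳ (subst (λ z → t (lookup (removeAt cs j) i') ≈ t z) (trans e' e) ≈-refl))))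
      (≈-trans (≈-sym (R.*-assoc _ _ _)) (R.*-congʳ (sq-V _)))))) (U-V-⊗ 2 _ _)

  U₂-R : ∀ b {X} → R≤ (b + b + Λ) X → R≤ (b + 2 * Λ) (U 2 X)
  U₂-R b = R-linear (U 2) (U-cong 2) (U-⊕ 2) (U-𝟘 2) (U₂-mon b)

  U₃-R : ∀ {n X} → R≤ n X → R≤ (4 * n) (U 3 X)
  U₃-R {n} = R-linear (U 3) (U-cong 3) (U-⊕ 3) (U-𝟘 3) (λ cs l → R-weaken (ℕ.*-monoʳ-≤ 4 l) (proj₁ (U₃-mon cs)))

-- Smooth numbers and their ratios

data Smooth : ℕ → Set where
  one-smooth : Smooth 1
  2-smooth : ∀ {m} → Smooth m → Smooth (2 * m)
  3-smooth : ∀ {m} → Smooth m → Smooth (3 * m)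

Smooth-* : ∀ {m n} → Smooth m → Smooth n → Smooth (m * n)
Smooth-* {n = n} one-smooth s = subst Smooth (sym (ℕ.+-identityʳ n)) s
Smooth-* {n = n} (2-smooth {m} r) s = subst Smooth (sym (ℕ.*-assoc 2 m n)) (2-smooth (Smooth-* r s))
Smooth-* {n = n} (3-smooth {m} r) s = subst Smooth (sym (ℕ.*-assoc 3 m n)) (3-smooth (Smooth-* r s))

Smooth-^ : ∀ {m} j → Smooth m → Smooth (m ℕ.^ j)
Smooth-^ zero s = one-smooth
Smooth-^ (suc j) s = Smooth-* s (Smooth-^ j s)

Smooth>0 : ∀ {m} → Smooth m → 0 < m
Smooth>0 one-smooth = s≤s z≤n
Smooth>0 (2-smooth {m} s) = ℕ.≤-trans (Smooth>0 s) (ℕ.m≤n*m m 2)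
Smooth>0 (3-smooth {m} s) = ℕ.≤-trans (Smooth>0 s) (ℕ.m≤n*m m 3)

private
  prime-step : ∀ p z y → Coprime p z → p ∣ z * y → p ∣ y
  prime-step p z y c d = coprime-divisor c d

  ∣suc⇒∣1 : ∀ {d} n → d ∣ suc n → d ∣ n → d ∣ 1
  ∣suc⇒∣1 {d} n p q = ND.∣m+n∣m⇒∣n {m = n} {n = 1} (subst (d ∣_) (ℕ.+-comm 1 n) p) q

  2∤z : ∀ k → Coprime 2 (suc (6 * k))
  2∤z k {d} (p , q) = ND.∣1⇒≡1 (∣suc⇒∣1 (6 * k) q (∣-trans p (∣-trans (divides 3 refl) (ND.m∣m*n k))))

  3∤z : ∀ k → Coprime 3 (suc (6 * k))
  3∤z k {d} (p , q) = ND.∣1⇒≡1 (∣suc⇒∣1 (6 * k) q (∣-trans p (∣-trans (divides 2 refl) (ND.m∣m*n k))))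

-- 1 + 6 k is prime to 2 and to 3; the prime factors of `m` are removed one by one.
Smooth-cancel : ∀ {m} → Smooth m → ∀ k y → m ∣ suc (6 * k) * y → m ∣ y
Smooth-cancel one-smooth k y d = ND.1∣ y
Smooth-cancel (2-smooth {m} s) k y d with prime-step 2 (suc (6 * k)) y (2∤z k) (∣-trans (ND.m∣m*n m) d)
... | divides q refl = subst (2 * m ∣_) (ℕ.*-comm 2 q) (ND.*-monoʳ-∣ 2 (Smooth-cancel s k q (ND.*-cancelˡ-∣ 2 (subst (2 * m ∣_) (l (suc (6 * k)) q) d))))
  where
  l : ∀ z q → z * (q * 2) ≡ 2 * (z * q)
  l = NS.solve-∀
Smooth-cancel (3-smooth {m} s) k y d with prime-step 3 (suc (6 * k)) y (3∤z k) (∣-trans (ND.m∣m*n m) d)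
... | divides q refl = subst (3 * m ∣_) (ℕ.*-comm 3 q) (ND.*-monoʳ-∣ 3 (Smooth-cancel s k q (ND.*-cancelˡ-∣ 3 (subst (3 * m ∣_) (l (suc (6 * k)) q) d))))
  where
  l : ∀ z q → z * (q * 3) ≡ 3 * (z * q)
  l = NS.solve-∀

module _ where
  -- Going from `k` to k + 1 multiplies by 3 and divides by 2 or by 4, whichever stays in [2^L,
  -- 2^(L+1)). So the exponent of 2 drops by at most 2 each time, which is recorded for later.
  pow-ratio : ∀ L k → 2 * k ≤ L → ∃ λ l → L ≤ l + 2 * k × 2 ℕ.^ L ≤ 2 ℕ.^ l * 3 ℕ.^ k × 2 ℕ.^ l * 3 ℕ.^ k < 2 * 2 ℕ.^ L
  pow-ratio L zero _ = L , ℕ.m≤m+n L 0 , ℕ.≤-reflexive (sym (ℕ.*-identityʳ _)) , subst (_< 2 * 2 ℕ.^ L) (sym (ℕ.*-identityʳ _)) (ℕ.m<m+n (2 ℕ.^ L) (subst (0 <_) (sym (ℕ.+-identityʳ _)) (ℕ.m^n>0 2 L)))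
  pow-ratio L (suc k) le with pow-ratio L k (ℕ.≤-trans (ℕ.*-monoʳ-≤ 2 (ℕ.n≤1+n k)) le)
  ... | zero , a , _ = ⊥-elim (ℕ.<⇒≱ (ℕ.≤-trans (ℕ.*-monoʳ-< 2 (ℕ.n<1+n k)) le) a)
  ... | suc zero , a , _ = ⊥-elim (ℕ.<⇒≱ (subst (_≤ L) (l k) le) a)
    where
    l : ∀ k → 2 * suc k ≡ suc (1 + 2 * k)
    l = NS.solve-∀
  ... | suc (suc l) , a , lo , hi with ℕ.<-≤-connex (2 ℕ.^ suc l * 3 ℕ.^ suc k) (2 * 2 ℕ.^ L)
  ... | inj₁ lt = suc l , ℕ.≤-trans a (ℕ.≤-trans (ℕ.n≤1+n _) (ℕ.≤-reflexive (l1 l k))) , ℕ.*-cancelˡ-≤ 2 (ℕ.≤-trans (ℕ.*-monoʳ-≤ 2 lo) (subst₂ _≤_ (sym (e1 (2 ℕ.^ l) (3 ℕ.^ k))) (sym (e2 (2 ℕ.^ l) (3 ℕ.^ k))) (ℕ.*-monoˡ-≤ (2 ℕ.^ l * 3 ℕ.^ k) (8≤12)))) , lt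
    where
    8≤12 : 8 ≤ 12
    8≤12 = ℕ.m≤m+n 8 4
    l1 : ∀ l k → suc (suc (suc l) + 2 * k) ≡ suc l + 2 * suc k
    l1 = NS.solve-∀
    e1 : ∀ x y → 2 * (2 * (2 * x) * y) ≡ 8 * (x * y)
    e1 = NS.solve-∀
    e2 : ∀ x y → 2 * (2 * x * (3 * y)) ≡ 12 * (x * y)
    e2 = NS.solve-∀
  ... | inj₂ ge = l , ℕ.≤-trans a (ℕ.≤-reflexive (l1 l k)) , ℕ.*-cancelˡ-≤ 2 (subst (2 * 2 ℕ.^ L ≤_) (e1 (2 ℕ.^ l) (3 ℕ.^ k)) ge)
      , ℕ.*-cancelˡ-< 4 _ _ (ℕ.<-≤-trans (subst (_< 3 * (2 * 2 ℕ.^ L)) (e2 (2 ℕ.^ l) (3 ℕ.^ k)) (ℕ.*-monoʳ-< 3 hi)) (subst (_≤ 4 * (2 * 2 ℕ.^ L)) refl (ℕ.*-monoˡ-≤ (2 * 2 ℕ.^ L) (ℕ.n≤1+n 3))))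
    where
    l1 : ∀ l k → suc (suc l) + 2 * k ≡ l + 2 * suc k
    l1 = NS.solve-∀
    e1 : ∀ x y → 2 * x * (3 * y) ≡ 2 * (x * (3 * y))
    e1 = NS.solve-∀
    e2 : ∀ x y → 3 * (2 * (2 * x) * y) ≡ 4 * (x * (3 * y))
    e2 = NS.solve-∀

  2^-smooth : ∀ l → Smooth (2 ℕ.^ l)
  2^-smooth l = Smooth-^ l (2-smooth one-smooth)

  3^-smooth : ∀ l → Smooth (3 ℕ.^ l)
  3^-smooth l = Smooth-^ l (3-smooth one-smooth)

  3∤2^ : ∀ a → ¬ 3 ∣ 2 ℕ.^ a
  3∤2^ zero d = ℕ.<⇒≱ (s≤s (s≤s z≤n)) (ND.∣⇒≤ d)
  3∤2^ (suc a) d = 3∤2^ a (prime-step 3 2 (2 ℕ.^ a) (fromWitness-cop) d)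
    where
    fromWitness-cop : Coprime 3 2
    fromWitness-cop {i} (p , q) = ND.∣1⇒≡1 (∣suc⇒∣1 2 p q)

  exps-unique : ∀ a k a' k' → k < k' → 2 ℕ.^ a * 3 ℕ.^ k ≢ 2 ℕ.^ a' * 3 ℕ.^ k'
  exps-unique a k a' k' lt e = 3∤2^ a (divides (2 ℕ.^ a' * 3 ℕ.^ d) (ℕ.*-cancelʳ-≡ _ _ (3 ℕ.^ k) {{ℕ.m^n≢0 3 k}} (trans e
      (trans (cong (2 ℕ.^ a' *_) (trans (cong (3 ℕ.^_) (sym (ℕ.m+[n∸m]≡n lt))) (trans (cong (3 *_) (ℕ.^-distribˡ-+-* 3 k d)) refl))) (l (2 ℕ.^ a') (3 ℕ.^ k) (3 ℕ.^ d))))))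
    where
    d = k' ∸ suc k
    l : ∀ x y z → x * (3 * (y * z)) ≡ x * z * 3 * y
    l = NS.solve-∀

  maxTo : ∀ n (h : ℕ → ℕ) → ∃ λ b → ∀ k → k ≤ n → h k ≤ b
  maxTo zero h = h 0 , λ { zero _ → ℕ.≤-refl }
  maxTo (suc n) h = let (b , p) = maxTo n h in b + h (suc n) , λ k le → case k le b p
    where
    case : ∀ k → k ≤ suc n → ∀ b → (∀ k → k ≤ n → h k ≤ b) → h k ≤ b + h (suc n)
    case k le b p with ℕ.m≤n⇒m<n∨m≡n le
    ... | inj₁ (s≤s l) = ℕ.≤-trans (p k l) (ℕ.m≤m+n b _)
    ... | inj₂ refl = ℕ.m≤n+m _ b

-- The powers of m₂ / m₁ tend to infinity and grow by a factor below 2 at each step, so the first to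
-- reach `ρ` is below 2 ρ.
ratio-power : ∀ m₁ m₂ ρ → 0 < m₁ → m₁ < m₂ → m₂ < 2 * m₁ → 1 < ρ
  → ∃ λ j → ρ * m₁ ℕ.^ j ≤ m₂ ℕ.^ j × m₂ ℕ.^ j < 2 * (ρ * m₁ ℕ.^ j)
ratio-power m₁ m₂ ρ 0<m lt lt2 1<ρ = find (m₁ * ρ) big
  where
  instance
    nz : NonZero m₁
    nz = ℕ.>-nonZero 0<m
  -- Bernoulli's inequality (1 + 1 / m₁)^j ≥ 1 + j / m₁ without fractions; j = m₁ ρ makes the right
  -- side exceed `ρ`.
  bern : ∀ j → (m₁ + j) * m₁ ℕ.^ j ≤ m₁ * suc m₁ ℕ.^ j
  bern zero = ℕ.≤-reflexive (trans (ℕ.*-identityʳ _) (trans (ℕ.+-identityʳ m₁) (sym (ℕ.*-identityʳ m₁))))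
  bern (suc j) = begin
    (m₁ + suc j) * (m₁ * p) ≤⟨ ℕ.m≤m+n _ (j * p) ⟩
    (m₁ + suc j) * (m₁ * p) + j * p ≡⟨ l m₁ j p ⟩
    suc m₁ * ((m₁ + j) * p) ≤⟨ ℕ.*-monoʳ-≤ (suc m₁) (bern j) ⟩
    suc m₁ * (m₁ * suc m₁ ℕ.^ j) ≡⟨ l2 m₁ (suc m₁ ℕ.^ j) ⟩
    m₁ * (suc m₁ * suc m₁ ℕ.^ j) ∎
    where
    open ℕ.≤-Reasoning
    p = m₁ ℕ.^ j
    l : ∀ m j p → (m + suc j) * (m * p) + j * p ≡ suc m * ((m + j) * p)
    l = NS.solve-∀
    l2 : ∀ m p → suc m * (m * p) ≡ m * (suc m * p)
    l2 = NS.solve-∀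
  big : ρ * m₁ ℕ.^ (m₁ * ρ) ≤ m₂ ℕ.^ (m₁ * ρ)
  big = ℕ.≤-trans (ℕ.*-cancelˡ-≤ m₁ (ℕ.≤-trans (ℕ.≤-trans (ℕ.≤-reflexive (sym (ℕ.*-assoc m₁ ρ _))) (ℕ.*-monoˡ-≤ (m₁ ℕ.^ (m₁ * ρ)) (ℕ.m≤n+m (m₁ * ρ) m₁))) (bern (m₁ * ρ))))
    (ℕ.^-monoˡ-≤ (m₁ * ρ) lt)
  find : ∀ j → ρ * m₁ ℕ.^ j ≤ m₂ ℕ.^ j → ∃ λ j → ρ * m₁ ℕ.^ j ≤ m₂ ℕ.^ j × m₂ ℕ.^ j < 2 * (ρ * m₁ ℕ.^ j)
  find zero p = ⊥-elim (ℕ.<⇒≱ 1<ρ (subst (_≤ 1) (ℕ.*-identityʳ ρ) p))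
  find (suc j) p with ρ * m₁ ℕ.^ j ℕ.≤? m₂ ℕ.^ j
  ... | yes q = find j q
  ... | no ¬q = suc j , p , ℕ.<-≤-trans (ℕ.*-mono-< lt2 (ℕ.≰⇒> ¬q)) (ℕ.≤-reflexive (l m₁ ρ (m₁ ℕ.^ j)))
    where
    l : ∀ m r p → 2 * m * (r * p) ≡ 2 * (r * (m * p))
    l = NS.solve-∀

-- Finitely many polynomials of bounded degree

module Finiteness (Λ : ℕ) .{{nzΛ : NonZero Λ}} where
  open Thetas Λ

  -- padding with the class 0, whose theta series is 1, makes all monomials of degree n
  vmon : ∀ n → (Fin n → Fin Λ) → Ser
  vmon zero c = 𝟙
  vmon (suc n) c = t (c Fin.zero) ⊗ vmon n (c ∘ Fin.suc)

  private
    z : Fin Λ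
    z = red (+ 0)

    pad : ∀ n cs → length cs ≤ n → ∃ λ c → mon cs ≈ vmon n c
    pad zero [] _ = (λ ()) , ≈-refl
    pad (suc n) [] le = let (c , e) = pad n [] z≤n in (λ { Fin.zero → z ; (Fin.suc i) → c i })
      , ≈-trans e (≈-sym (≈-trans (R.*-congʳ (≈-trans (≈-sym (t-red (+ 0))) (Θ₁-0 Λ))) (R.*-identityˡ _)))
    pad (suc n) (x ∷ cs) (s≤s le) = let (c , e) = pad n cs le in (λ { Fin.zero → x ; (Fin.suc i) → c i }) , R.*-congˡ e

    vmon-cong : ∀ n {c c'} → (∀ i → c i ≡ c' i) → vmon n c ≈ vmon n c'
    vmon-cong zero h = ≈-refl
    vmon-cong (suc n) {c} {c'} h = R.*-cong (subst (λ z → t (c Fin.zero) ≈ t z) (h Fin.zero) ≈-refl) (vmon-cong n (h ∘ Fin.suc))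

    bit : Fin 2 → Ser → Ser
    bit Fin.zero X = 𝟘
    bit (Fin.suc _) X = X

    flip : Fin 2 → Fin 2
    flip Fin.zero = Fin.suc Fin.zero
    flip (Fin.suc _) = Fin.zero

    lin : ∀ {J} → (Fin J → Fin 2) → (Fin J → Ser) → Ser
    lin {zero} φ m = 𝟘
    lin {suc J} φ m = bit (φ Fin.zero) (m Fin.zero) ⊕ lin (φ ∘ Fin.suc) (m ∘ Fin.suc)

    lin-≗ : ∀ {J} {φ ψ : Fin J → Fin 2} m → (∀ i → φ i ≡ ψ i) → lin φ m ≈ lin ψ m
    lin-≗ {zero} m h = ≈-refl
    lin-≗ {suc J} {φ} {ψ} m h = R.+-cong (subst (λ z → bit (φ Fin.zero) (m Fin.zero) ≈ bit z (m Fin.zero)) (h Fin.zero) ≈-refl) (lin-≗ _ (h ∘ Fin.suc))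

    lin-0 : ∀ {J} (m : Fin J → Ser) → lin (λ _ → Fin.zero) m ≈ 𝟘
    lin-0 {zero} m = ≈-refl
    lin-0 {suc J} m = ≈-trans (R.+-identityˡ _) (lin-0 (m ∘ Fin.suc))

    toggle : ∀ {J} → Fin J → (Fin J → Fin 2) → Fin J → Fin 2
    toggle Fin.zero φ Fin.zero = flip (φ Fin.zero)
    toggle Fin.zero φ (Fin.suc i) = φ (Fin.suc i)
    toggle (Fin.suc j) φ Fin.zero = φ Fin.zero
    toggle (Fin.suc j) φ (Fin.suc i) = toggle j (φ ∘ Fin.suc) i

    lin-toggle : ∀ {J} j (φ : Fin J → Fin 2) m → lin (toggle j φ) m ≈ m j ⊕ lin φ m
    lin-toggle Fin.zero φ m = ≈-trans (R.+-congʳ (b (φ Fin.zero))) (R.+-assoc _ _ _)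
      where
      b : ∀ x → bit (flip x) (m Fin.zero) ≈ m Fin.zero ⊕ bit x (m Fin.zero)
      b Fin.zero = ≈-sym (R.+-identityʳ _)
      b (Fin.suc _) = ≈-sym (⊕-self _)
    lin-toggle (Fin.suc j) φ m = ≈-trans (R.+-congˡ (lin-toggle j (φ ∘ Fin.suc) (m ∘ Fin.suc)))
      (solve 3 (λ x y z → x :+ (y :+ z) := y :+ (x :+ z)) R.refl (bit (φ Fin.zero) (m Fin.zero)) (m (Fin.suc j)) (lin (φ ∘ Fin.suc) (m ∘ Fin.suc)))

    basis : ∀ n → Fin (Λ ℕ.^ n) → Ser
    basis n j = vmon n (Fin.finToFun {Λ} {n} j)

    span : ∀ {n X} → R≤ n X → ∃ λ φ → X ≈ lin φ (basis n)
    span {n} (R-zero e) = (λ _ → Fin.zero) , ≈-trans e (≈-sym (lin-0 (basis n)))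
    span {n} (R-add cs l e r) = let (φ , p) = span r ; (c , q) = pad n cs l in toggle (Fin.funToFin c) φ
      , ≈-trans e (≈-trans (R.+-cong (≈-trans q (vmon-cong n (λ i → sym (Fin.finToFun-funToFin c i)))) p) (≈-sym (lin-toggle _ φ (basis n))))

  card : ℕ → ℕ
  card n = 2 ℕ.^ (Λ ℕ.^ n)

  -- The number of a coefficient vector on the Λ^n monomials. A series may have several codes,
  -- depending on how it is written, but equal codes force equal series, and the pigeonhole
  -- principle needs no more.
  code : ∀ {n X} → R≤ n X → Fin (card n)
  code r = Fin.funToFin (proj₁ (span r))

  code-≈ : ∀ {n X Y} (r : R≤ n X) (r' : R≤ n Y) → code r ≡ code r' → X ≈ Y
  code-≈ {n} r r' e = ≈-trans (proj₂ (span r)) (≈-trans (lin-≗ (basis n) λ i → trans (sym (Fin.finToFun-funToFin (proj₁ (span r)) i))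
    (trans (cong (λ z → Fin.finToFun z i) e) (Fin.finToFun-funToFin (proj₁ (span r')) i))) (≈-sym (proj₂ (span r'))))

-- Iterated sections with a fixed denominator

module Dynamics (Λ : ℕ) .{{nzΛ : NonZero Λ}} (2∣Λ : 2 ∣ Λ) (3∣Λ : 3 ∣ Λ) where
  open Operators Λ 2∣Λ 3∣Λ
  open Finiteness Λ

  module _ (W B C : Ser) (b c w : ℕ) (rB : R≤ b B) (rC : R≤ c C) (rW : R≤ w (W ⊗ B))
           (BC : B ⊗ C ≈ V 3 (B ⊗ (B ⊗ B))) (cancel : ∀ {X Y} → X ⊗ B ≈ Y ⊗ B → X ≈ Y) where

    private
      -- Quotients with the fixed denominator `B` and a numerator of degree at most `d`.
      𝒳 : ℕ → Ser → Set
      𝒳 d X = R≤ d (X ⊗ B)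

      𝒳-resp : ∀ {d X Y} → X ≈ Y → 𝒳 d X → 𝒳 d Y
      𝒳-resp p = R-resp (R.*-congʳ p)

      -- One more factor `B` makes the denominator a square, that is B(q²), which leaves `U 2` as
      -- `B`.
      clear₂ : ∀ X → U 2 (B ⊗ (X ⊗ B)) ≈ U 2 X ⊗ B
      clear₂ X = ≈-trans (U-cong 2 (≈-trans (solve 2 (λ b x → b :* (x :* b) := (b :* b) :* x) R.refl B X) (R.*-congʳ (sq-V B)))) (≈-trans (U-V-⊗ 2 B X) (R.*-comm _ _))

      𝒳-U₂ : ∀ e d X → d + b ≤ e + e + Λ → 𝒳 d X → 𝒳 (e + 2 * Λ) (U 2 X)
      𝒳-U₂ e d X le r = R-resp (clear₂ X) (U₂-R e (R-weaken (subst (_≤ e + e + Λ) (ℕ.+-comm d b) le) (R-⊗ rB r)))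

      -- The fixed point of d → (d + b) / 2 + 2 Λ, which bounds the effect of `U 2` on the degree.
      d₀ : ℕ
      d₀ = b + 2 * Λ + 2 * Λ

      halve : ∀ j X → 𝒳 (d₀ + (j + j)) X → 𝒳 (d₀ + j) (U 2 X)
      halve j X r = R-weaken (ℕ.≤-reflexive (l2 b Λ j)) (𝒳-U₂ (b + 2 * Λ + j) _ X (ℕ.≤-trans (ℕ.m≤m+n _ Λ) (ℕ.≤-reflexive (l1 b Λ j))) r)
        where
        l1 : ∀ b L j → b + 2 * L + 2 * L + (j + j) + b + L ≡ b + 2 * L + j + (b + 2 * L + j) + L
        l1 = NS.solve-∀
        l2 : ∀ b L j → b + 2 * L + j + 2 * L ≡ b + 2 * L + 2 * L + j
        l2 = NS.solve-∀

      U2-U : ∀ l X → U (2 ℕ.^ l) (U 2 X) ≈ U (2 ℕ.^ suc l) X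
      U2-U l X = U-U (2 ℕ.^ l) 2 X

      U1 : ∀ X → U 1 X ≈ X
      U1 X = pw λ n → cong X (ℕ.+-identityʳ n)

      -- Rounding costs 1: the bound d₀ + 1, weakened to d₀ + 2, is sent back to d₀ + 1.
      d₁ : ℕ
      d₁ = d₀ + 1

      contract : ∀ i X → 𝒳 (d₀ + 2 ℕ.^ i) X → 𝒳 d₁ (U (2 ℕ.^ i) X)
      contract zero X r = 𝒳-resp (≈-sym (U1 X)) r
      contract (suc i) X r = 𝒳-resp (U2-U i X) (contract i (U 2 X) (halve (2 ℕ.^ i) X (R-weaken (ℕ.≤-reflexive (cong (λ z → d₀ + (2 ℕ.^ i + z)) (ℕ.+-identityʳ _))) r)))

      stay : ∀ l X → 𝒳 d₁ X → 𝒳 d₁ (U (2 ℕ.^ l) X)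
      stay zero X r = 𝒳-resp (≈-sym (U1 X)) r
      stay (suc l) X r = 𝒳-resp (U2-U l X) (stay l (U 2 X) (halve 1 X (R-weaken (ℕ.+-monoʳ-≤ d₀ (ℕ.n≤1+n 1)) r)))

      n≤2^n : ∀ n → n ≤ 2 ℕ.^ n
      n≤2^n zero = z≤n
      n≤2^n (suc n) = ℕ.+-mono-≤ (ℕ.m^n>0 2 n) (ℕ.≤-trans (n≤2^n n) (ℕ.m≤m+n _ 0))

      eventually : ∀ n X → 𝒳 n X → ∀ l → n ≤ l → 𝒳 d₁ (U (2 ℕ.^ l) X)
      eventually n X r l le = 𝒳-resp (≈-trans (U-U (2 ℕ.^ (l ∸ n)) (2 ℕ.^ n) X) (U-≡ X (trans (sym (ℕ.^-distribˡ-+-* 2 n (l ∸ n))) (cong (2 ℕ.^_) (ℕ.m+[n∸m]≡n le)))))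
        (stay (l ∸ n) _ (contract n X (R-weaken (ℕ.≤-trans (n≤2^n n) (ℕ.m≤n+m _ d₀)) r)))
        where
        U-≡ : ∀ {j k} X → j ≡ k → U j X ≈ U k X
        U-≡ X refl = ≈-refl

      -- `U 3` turns B C = B(q³)³ into B³. Another factor `B` gives a fourth power, and two
      -- applications of `U 2` reduce it to `B`; hence 12 = 3 · 2 · 2.
      𝒳-U₁₂ : ∀ d X → 𝒳 d X → ∃ λ d' → 𝒳 d' (U 12 X)
      𝒳-U₁₂ d X r = _ , R-resp final (U₂-R (e + 2 * Λ) (R-weaken (grow _) (U₂-R e (R-weaken (grow e) (R-⊗ rB (U₃-R (R-⊗ r rC)))))))
        where
        e = b + 4 * (d + c)
        grow : ∀ n → n ≤ n + n + Λ
        grow n = ℕ.≤-trans (ℕ.m≤m+n n n) (ℕ.m≤m+n _ Λ)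
        B³ : U 3 ((X ⊗ B) ⊗ C) ≈ (B ⊗ (B ⊗ B)) ⊗ U 3 X
        B³ = ≈-trans (U-cong 3 (≈-trans (≈-trans (R.*-assoc _ _ _) (R.*-congˡ BC)) (R.*-comm _ _))) (U-V-⊗ 3 _ X)
        final : U 2 (U 2 (B ⊗ U 3 ((X ⊗ B) ⊗ C))) ≈ U 12 X ⊗ B
        final = begin
          U 2 (U 2 (B ⊗ U 3 ((X ⊗ B) ⊗ C))) ≈⟨ U-cong 2 (U-cong 2 (≈-trans (R.*-congˡ B³) (≈-trans (solve 2 (λ b x → b :* ((b :* (b :* b)) :* x) := (b :* b) :* ((b :* b) :* x)) R.refl B (U 3 X)) (R.*-cong (sq-V B) (R.*-congʳ (sq-V B)))))) ⟩
          U 2 (U 2 (V 2 B ⊗ (V 2 B ⊗ U 3 X))) ≈⟨ U-cong 2 (≈-trans (U-V-⊗ 2 B _) (R.*-congˡ (U-V-⊗ 2 B _))) ⟩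
          U 2 (B ⊗ (B ⊗ U 2 (U 3 X))) ≈⟨ U-cong 2 (≈-trans (≈-sym (R.*-assoc _ _ _)) (R.*-congʳ (sq-V B))) ⟩
          U 2 (V 2 B ⊗ U 2 (U 3 X)) ≈⟨ U-V-⊗ 2 B _ ⟩
          B ⊗ U 2 (U 2 (U 3 X)) ≈⟨ R.*-comm _ _ ⟩
          U 2 (U 2 (U 3 X)) ⊗ B ≈⟨ R.*-congʳ (≈-trans (U-cong 2 (U-U 2 3 X)) (U-U 2 6 X)) ⟩
          U 12 X ⊗ B ∎
          where open ≈R

      twelve : ∀ k → ∃ λ d → 𝒳 d (U (12 ℕ.^ k) W)
      twelve zero = w , 𝒳-resp (≈-sym (U1 W)) rW
      twelve (suc k) = let (d , r) = twelve k ; (d' , r') = 𝒳-U₁₂ d _ r in d' , 𝒳-resp (≈-trans (U-U 12 (12 ℕ.^ k) W) (pw λ n → cong (λ z → W (z * n)) (ℕ.*-comm (12 ℕ.^ k) 12))) r'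

      12^ : ∀ k → 12 ℕ.^ k ≡ 2 ℕ.^ (2 * k) * 3 ℕ.^ k
      12^ k = trans (go k) (cong (ℕ._* 3 ℕ.^ k) (ℕ.^-*-assoc 2 2 k))
        where
        l12 : ∀ x y → 12 * (x * y) ≡ 4 * x * (3 * y)
        l12 = NS.solve-∀
        go : ∀ k → 12 ℕ.^ k ≡ 4 ℕ.^ k * 3 ℕ.^ k
        go zero = refl
        go (suc k) = trans (cong (12 *_) (go k)) (l12 (4 ℕ.^ k) (3 ℕ.^ k))

      -- The degree after k times `U 12` is not controlled, but it is finite, and enough further
      -- applications of `U 2` contract it to `d₁`.
      member : ∀ k l → proj₁ (twelve k) + 2 * k ≤ l → 𝒳 d₁ (U (2 ℕ.^ l * 3 ℕ.^ k) W)
      member k l le = 𝒳-resp (≈-trans (U-U (2 ℕ.^ j) (12 ℕ.^ k) W) (pw λ n → cong (λ z → W (z * n)) e)) (eventually _ _ (proj₂ (twelve k)) j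
          (ℕ.≤-trans (ℕ.≤-reflexive (sym (ℕ.m+n∸n≡m (proj₁ (twelve k)) (2 * k)))) (ℕ.∸-monoˡ-≤ (2 * k) le)))
        where
        j = l ∸ 2 * k
        e : 12 ℕ.^ k * 2 ℕ.^ j ≡ 2 ℕ.^ l * 3 ℕ.^ k
        e = trans (cong (ℕ._* 2 ℕ.^ j) (12^ k)) (trans (l3 (2 ℕ.^ (2 * k)) (3 ℕ.^ k) (2 ℕ.^ j)) (cong (ℕ._* 3 ℕ.^ k)
          (trans (sym (ℕ.^-distribˡ-+-* 2 (2 * k) j)) (cong (2 ℕ.^_) (ℕ.m+[n∸m]≡n (ℕ.≤-trans (ℕ.m≤n+m (2 * k) (proj₁ (twelve k))) le))))))
          where
          l3 : ∀ x y z → x * y * z ≡ x * z * y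
          l3 = NS.solve-∀

      N : ℕ
      N = card d₁

      -- One 2 k is for the powers of 2 inside 12^k; the other allows for the exponent from
      -- `pow-ratio` being as small as L - 2 k.
      bound : ∃ λ L → ∀ k → k ≤ N → proj₁ (twelve k) + 2 * k + 2 * k ≤ L
      bound = maxTo N _

      L : ℕ
      L = proj₁ bound

      rat : ∀ k → k ≤ N → ∃ λ l → L ≤ l + 2 * k × 2 ℕ.^ L ≤ 2 ℕ.^ l * 3 ℕ.^ k × 2 ℕ.^ l * 3 ℕ.^ k < 2 * 2 ℕ.^ L
      rat k le = pow-ratio L k (ℕ.≤-trans (ℕ.m≤n+m (2 * k) (proj₁ (twelve k) + 2 * k)) (proj₂ bound k le))

      module K (i : Fin (suc N)) where
        k = toℕ i
        k≤ : k ≤ N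
        k≤ = ℕ.≤-pred (Fin.toℕ<n i)
        l = proj₁ (rat k k≤)
        m = 2 ℕ.^ l * 3 ℕ.^ k
        lo = proj₁ (proj₂ (proj₂ (rat k k≤)))
        hi = proj₂ (proj₂ (proj₂ (rat k k≤)))
        mem : 𝒳 d₁ (U m W)
        mem = member k l (ℕ.+-cancelʳ-≤ (2 * k) (proj₁ (twelve k) + 2 * k) l (ℕ.≤-trans (proj₂ bound k k≤) (proj₁ (proj₂ (rat k k≤)))))
        sm : Smooth m
        sm = Smooth-* (2^-smooth l) (3^-smooth k)

      collide : (m : Fin (suc N) → ℕ) → (∀ i → 𝒳 d₁ (U (m i) W)) → (∀ i j → i Fin.< j → m i ≢ m j)
        → ∃ λ i → ∃ λ j → m i < m j × U (m i) W ≈ U (m j) W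
      collide m mem ne = order (Fin.pigeonhole (ℕ.n<1+n N) (λ i → code (mem i)))
        where
        order : (∃ λ i → ∃ λ j → i Fin.< j × code (mem i) ≡ code (mem j)) → ∃ λ i → ∃ λ j → m i < m j × U (m i) W ≈ U (m j) W
        order (i , j , i<j , e) = split (ℕ.<-cmp (m i) (m j))
          where
          p : U (m i) W ≈ U (m j) W
          p = cancel (code-≈ (mem i) (mem j) e)
          split : Tri (m i < m j) (m i ≡ m j) (m j < m i) → ∃ λ i → ∃ λ j → m i < m j × U (m i) W ≈ U (m j) W
          split (tri< lt _ _) = i , j , lt , p
          split (tri≈ _ q _) = ⊥-elim (ne i j i<j q)
          split (tri> _ _ gt) = j , i , gt , ≈-sym p

      coincidence : ∃ λ i → ∃ λ j → K.m i < K.m j × U (K.m i) W ≈ U (K.m j) W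
      coincidence = collide K.m K.mem (λ i j i<j → exps-unique (K.l i) (toℕ i) (K.l j) (toℕ j) i<j)

      powers : ∀ m m' → U m W ≈ U m' W → ∀ j → U (m ℕ.^ j) W ≈ U (m' ℕ.^ j) W
      powers m m' p zero = ≈-refl
      powers m m' p (suc j) = begin
        U (m ℕ.^ suc j) W ≈⟨ ≈-sym (U-U (m ℕ.^ j) m W) ⟩
        U (m ℕ.^ j) (U m W) ≈⟨ U-cong (m ℕ.^ j) p ⟩
        U (m ℕ.^ j) (U m' W) ≈⟨ pw (λ n → cong W (lem m' (m ℕ.^ j) n)) ⟩
        U m' (U (m ℕ.^ j) W) ≈⟨ U-cong m' (powers m m' p j) ⟩
        U m' (U (m' ℕ.^ j) W) ≈⟨ pw (λ n → cong W (lem (m' ℕ.^ j) m' n)) ⟩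
        U (m' ℕ.^ j) (U m' W) ≈⟨ U-U (m' ℕ.^ j) m' W ⟩
        U (m' ℕ.^ suc j) W ∎
        where
        open ≈R
        lem : ∀ a b n → a * (b * n) ≡ b * (a * n)
        lem = NS.solve-∀

    recurrence : ∀ ρ → 1 < ρ → ∃ λ m₁ → ∃ λ m₂ → Smooth m₁ × Smooth m₂ × ρ * m₁ ≤ m₂ × m₂ < 2 * (ρ * m₁) × U m₁ W ≈ U m₂ W
    recurrence ρ 1<ρ = boost coincidence
      where
      boost : (∃ λ i → ∃ λ j → K.m i < K.m j × U (K.m i) W ≈ U (K.m j) W) → _
      -- Both multipliers lie in [2^L, 2^(L+1)), so their ratio is below 2, as `ratio-power`
      -- requires.
      boost (i , j , lt , p) = let (e , lo , hi) = ratio-power (K.m i) (K.m j) ρ (Smooth>0 (K.sm i)) lt (ℕ.<-≤-trans (K.hi j) (ℕ.*-monoʳ-≤ 2 (K.lo i))) 1<ρ in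
        K.m i ℕ.^ e , K.m j ℕ.^ e , Smooth-^ e (K.sm i) , Smooth-^ e (K.sm j) , lo , hi , powers (K.m i) (K.m j) p e

-- Reduction of integer series modulo 2

odd? : ℕ → Bool
odd? zero = false
odd? (suc n) = not (odd? n)

par : ℤ → Bool
par z = odd? ∣ z ∣

private
  not-xor : ∀ a b → not (a xor b) ≡ not a xor b
  not-xor true true = refl
  not-xor true false = refl
  not-xor false true = refl
  not-xor false false = refl

  not-xor' : ∀ a b → not a xor not b ≡ a xor b
  not-xor' true true = refl
  not-xor' true false = refl
  not-xor' false true = refl
  not-xor' false false = refl

odd-+ : ∀ m n → odd? (m + n) ≡ odd? m xor odd? n
odd-+ zero n = refl
odd-+ (suc m) n = trans (cong not (odd-+ m n)) (not-xor (odd? m) (odd? n))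

odd-* : ∀ m n → odd? (m * n) ≡ odd? m ∧ odd? n
odd-* zero n = refl
odd-* (suc m) n = trans (odd-+ n (m * n)) (trans (cong (odd? n xor_) (odd-* m n)) (l (odd? m) (odd? n)))
  where
  l : ∀ a b → b xor (a ∧ b) ≡ not a ∧ b
  l true true = refl
  l true false = refl
  l false true = refl
  l false false = refl

par-⊖ : ∀ m n → par (m ℤ.⊖ n) ≡ odd? m xor odd? n
par-⊖ zero zero = refl
par-⊖ zero (suc n) = refl
par-⊖ (suc m) zero = sym (xor-identityʳ _)
par-⊖ (suc m) (suc n) = trans (cong par (ℤ.[1+m]⊖[1+n]≡m⊖n m n)) (trans (par-⊖ m n) (sym (not-xor' (odd? m) (odd? n))))

par-+ : ∀ x y → par (x ℤ.+ y) ≡ par x xor par y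
par-+ (+ m) (+ n) = odd-+ m n
par-+ (+ m) -[1+ n ] = par-⊖ m (suc n)
par-+ -[1+ m ] (+ n) = trans (par-⊖ n (suc m)) (xor-comm (odd? n) _)
par-+ -[1+ m ] -[1+ n ] = trans (cong (λ z → not (not z)) (odd-+ m n)) (l (odd? m) (odd? n))
  where
  l : ∀ a b → not (not (a xor b)) ≡ not a xor not b
  l true true = refl
  l true false = refl
  l false true = refl
  l false false = refl

par-neg : ∀ x → par (ℤ.- x) ≡ par x
par-neg x = cong odd? (ℤ.∣-i∣≡∣i∣ x)

par-* : ∀ x y → par (x ℤ.* y) ≡ par x ∧ par y
par-* x y = trans (cong odd? (ℤ.abs-* x y)) (odd-* ∣ x ∣ ∣ y ∣)

even-dec : ∀ n → does (2 ∣? n) ≡ not (odd? n)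
even-dec zero = dec-true (2 ∣? 0) (divides 0 refl)
even-dec (suc zero) = dec-false (2 ∣? 1) λ { (divides zero ()) ; (divides (suc q) ()) }
even-dec (suc (suc n)) = trans (⇔-≡
  (λ q → dec-true (2 ∣? n) (ND.∣m+n∣m⇒∣n (does-true (2 ∣? suc (suc n)) q) ND.∣-refl))
  (λ q → dec-true (2 ∣? suc (suc n)) (ND.∣m∣n⇒∣m+n ND.∣-refl (does-true (2 ∣? n) q)))) (trans (even-dec n) (cong not (sym (not-not (odd? n)))))
  where
  not-not : ∀ b → not (not b) ≡ b
  not-not true = refl
  not-not false = refl

opaque
  red₂ : D.Series → Ser
  red₂ A n = par (A n)

  red₂-at : ∀ A n → red₂ A n ≡ par (A n)
  red₂-at A n = refl

opaque
  unfolding _⊕_ red₂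

  red-⊛ : ∀ A B → red₂ (A D.⊛ B) ≈ red₂ A ⊗ red₂ B
  red-⊛ A B = pw λ n → go n A B
    where
    sum-cong-≤ : ∀ n {f g : ℕ → ℤ} → (∀ k → k ≤ n → f k ≡ g k) → D.sumTo n f ≡ D.sumTo n g
    sum-cong-≤ zero h = h 0 z≤n
    sum-cong-≤ (suc n) h = cong₂ ℤ._+_ (sum-cong-≤ n λ k le → h k (ℕ.m≤n⇒m≤1+n le)) (h (suc n) ℕ.≤-refl)
    go : ∀ n A B → par (D.sumTo n (λ k → A k ℤ.* B (n ∸ k))) ≡ (red₂ A ⊗ red₂ B) n
    go zero A B = par-* (A 0) (B 0)
    go (suc n) A B = trans (par-+ (D.sumTo n (λ k → A k ℤ.* B (suc n ∸ k))) (A (suc n) ℤ.* B (n ∸ n))) (trans (cong₂ _xor_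
      (trans (cong par (sum-cong-≤ n λ k le → cong (λ z → A k ℤ.* B z) (ℕ.+-∸-assoc 1 le))) (go n A (λ k → B (suc k))))
      (trans (par-* (A (suc n)) (B (n ∸ n))) (cong (λ z → par (A (suc n)) ∧ par (B z)) (ℕ.n∸n≡0 n)))) (sym (⊗-snoc (red₂ A) (red₂ B) n)))

private
  par-if : ∀ c → par (if c then + 1 else + 0) ≡ c
  par-if true = refl
  par-if false = refl

  par-δ : ∀ a b → par (D.δ a b) ≡ does (a ℕ.≟ b)
  par-δ a b = par-if (does (a ℕ.≟ b))

  mono-does : ∀ a n → does (n ℕ.≟ a) ≡ mono a n
  mono-does a n with n ℕ.≟ a
  ... | yes refl = trans (dec-true (a ℕ.≟ a) refl) (sym (mono-yes a))
  ... | no ne = trans (dec-false (n ℕ.≟ a) ne) (sym (mono-no a n (ne ∘ sym)))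

red-one : red₂ D.one ≈ 𝟙
red-one = ≈-trans (pw λ n → trans (red₂-at D.one n) (trans (par-δ n 0) (mono-does 0 n))) mono-0

red-oneMinus : ∀ m → red₂ (D.oneMinus m) ≈ 𝟙 ⊕ mono m
red-oneMinus m = pw λ n → trans (red₂-at (D.oneMinus m) n) (trans (par-+ (D.δ n 0) (ℤ.- D.δ n m)) (trans (cong₂ _xor_ (trans (sym (red₂-at D.one n)) (at red-one n)) (trans (par-neg (D.δ n m)) (trans (par-δ n m) (mono-does m n)))) (sym (⊕-at 𝟙 (mono m) n))))

geo : ℕ → Ser
geo m = red₂ (D.geom m)

private
  geo-at : ∀ m n → geo m n ≡ does (m ∣? n)
  geo-at m n = trans (red₂-at (D.geom m) n) (par-if (does (m ∣? n)))

geo-inv : ∀ m .{{_ : NonZero m}} → (𝟙 ⊕ mono m) ⊗ geo m ≈ 𝟙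
geo-inv m = ≈-trans (≈-trans (R.distribʳ _ _ _) (R.+-congʳ (R.*-identityˡ _))) (pw go)
  where
  go : ∀ n → (geo m ⊕ mono m ⊗ geo m) n ≡ 𝟙 n
  go n with ℕ.<-≤-connex n m
  go zero | inj₁ lt = trans (⊕-at _ _ 0) (trans (cong₂ _xor_ (trans (geo-at m 0) (dec-true (m ∣? 0) (divides 0 refl))) (mono-⊗-lo m _ 0 lt)) (sym 𝟙-at-0))
  go (suc n) | inj₁ lt = trans (⊕-at _ _ (suc n)) (trans (cong₂ _xor_ (trans (geo-at m (suc n)) (dec-false (m ∣? suc n) λ d → ℕ.<⇒≱ lt (ND.∣⇒≤ d))) (mono-⊗-lo m _ (suc n) lt)) (sym (𝟙-at-suc n)))
  go n | inj₂ ge = subst (λ z → (geo m ⊕ mono m ⊗ geo m) z ≡ 𝟙 z) (ℕ.m+[n∸m]≡n ge) (hi (n ∸ m))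
    where
    shift : ∀ k → geo m (m + k) ≡ geo m k
    shift k = trans (geo-at m (m + k)) (trans (⇔-≡
      (λ q → dec-true (m ∣? k) (ND.∣m+n∣m⇒∣n (does-true (m ∣? (m + k)) q) ND.∣-refl))
      (λ q → dec-true (m ∣? (m + k)) (ND.∣m∣n⇒∣m+n ND.∣-refl (does-true (m ∣? k) q)))) (sym (geo-at m k)))
    𝟙-big : ∀ k → 0 < k → 𝟙 k ≡ false
    𝟙-big (suc k) _ = 𝟙-at-suc k
    hi : ∀ k → (geo m ⊕ mono m ⊗ geo m) (m + k) ≡ 𝟙 (m + k)
    hi k = trans (⊕-at _ _ _) (trans (cong₂ _xor_ (shift k) (mono-⊗-hi m _ k)) (trans (xor-same (geo m k)) (sym (𝟙-big (m + k) (ℕ.≤-trans (ℕ.>-nonZero⁻¹ m) (ℕ.m≤m+n m k))))))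

geo-low : ∀ {m K} → K < m → geo m ≈[ K ] 𝟙
geo-low {m} {K} lt = pwK go
  where
  go : ∀ n → n ≤ K → geo m n ≡ 𝟙 n
  go zero le = trans (geo-at m 0) (trans (dec-true (m ∣? 0) (divides 0 refl)) (sym 𝟙-at-0))
  go (suc n) le = trans (geo-at m (suc n)) (trans (dec-false (m ∣? suc n) λ d → ℕ.<⇒≱ (ℕ.≤-<-trans le lt) (ND.∣⇒≤ d)) (sym (𝟙-at-suc n)))

red-prod : ∀ j k → red₂ (D.prodUpTo k (λ i → D.oneMinus (j * i))) ≈ Pr (λ i → j * suc i) k
red-prod j zero = ≈-trans red-one (≈-sym (Pr-0 _))
red-prod j (suc k) = ≈-trans (red-⊛ (D.prodUpTo k (λ i → D.oneMinus (j * i))) (D.oneMinus (j * suc k))) (≈-trans (R.*-cong (red-prod j k) (red-oneMinus _)) (≈-sym (Pr-suc _ k)))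

red-f : ∀ j .{{_ : NonZero j}} → red₂ (D.f j) ≈ V j f₁
red-f j = ≈-trans (pw λ n → trans (trans (red₂-at (D.f j) n) (sym (red₂-at (D.prodUpTo n (λ i → D.oneMinus (j * i))) n))) (at (red-prod j n) n)) (≈-sym (Inf-V j suc (λ i → ℕ.≤-refl)))

PG : ℕ → ℕ → Ser
PG j k = red₂ (D.prodUpTo k (λ i → D.geom (j * i)))

-- The finite products are inverse to each other factor by factor, and both infinite products agree
-- with them up to any given order.
f-finv : ∀ j .{{_ : NonZero j}} → red₂ (D.finv j) ⊗ V j f₁ ≈ 𝟙
f-finv j = K-to λ K → K-trans (K-⊗ (stable K) (K-trans (K-from (Inf-V j suc (λ i → ℕ.≤-refl))) (Inf≈Pr (mul-grow j) (ℕ.≤-refl {K})))) (K-from (inv K))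
  where
  PG-suc : ∀ k → PG j (suc k) ≈ PG j k ⊗ geo (j * suc k)
  PG-suc k = red-⊛ (D.prodUpTo k (λ i → D.geom (j * i))) (D.geom (j * suc k))
  step : ∀ n k → n ≤ k → PG j k n ≡ PG j n n
  step n k le with ℕ.m≤n⇒m<n∨m≡n le
  ... | inj₂ refl = refl
  step n (suc k) le | inj₁ (s≤s l) = trans (at (PG-suc k) n) (trans (atK (K-⊗ (K-refl {PG j k} {n}) (geo-low (ℕ.≤-trans (s≤s l) (ℕ.m≤n*m (suc k) j)))) n ℕ.≤-refl)
    (trans (at (R.*-identityʳ (PG j k)) n) (step n k l)))
  stable : ∀ K → red₂ (D.finv j) ≈[ K ] PG j K
  stable K = pwK λ n le → trans (trans (red₂-at (D.finv j) n) (sym (red₂-at (D.prodUpTo n (λ i → D.geom (j * i))) n))) (sym (step n K le))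
  inv : ∀ k → PG j k ⊗ Pr (λ i → j * suc i) k ≈ 𝟙
  inv zero = ≈-trans (R.*-cong red-one (Pr-0 _)) (R.*-identityˡ _)
  inv (suc k) = ≈-trans (R.*-cong (PG-suc k) (Pr-suc _ k)) (≈-trans (solve 4 (λ a b c d → (a :* b) :* (c :* d) := (a :* c) :* (d :* b)) R.refl (PG j k) (geo (j * suc k)) (Pr (λ i → j * suc i) k) (𝟙 ⊕ mono (j * suc k)))
    (≈-trans (R.*-cong (inv k) (geo-inv (j * suc k) {{ℕ.m*n≢0 j (suc k)}})) (R.*-identityˡ 𝟙)))

powS : Ser → ℕ → Ser
powS X zero = 𝟙
powS X (suc n) = powS X n ⊗ X

powS-cong : ∀ {X Y} n → X ≈ Y → powS X n ≈ powS Y n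
powS-cong zero p = ≈-refl
powS-cong (suc n) p = R.*-cong (powS-cong n p) p

powS-⊗ : ∀ X Y n → powS (X ⊗ Y) n ≈ powS X n ⊗ powS Y n
powS-⊗ X Y zero = ≈-sym (R.*-identityˡ 𝟙)
powS-⊗ X Y (suc n) = ≈-trans (R.*-congʳ (powS-⊗ X Y n)) (solve 4 (λ a b c d → (a :* b) :* (c :* d) := (a :* c) :* (b :* d)) R.refl (powS X n) (powS Y n) X Y)

powS-𝟙 : ∀ n → powS 𝟙 n ≈ 𝟙
powS-𝟙 zero = ≈-refl
powS-𝟙 (suc n) = ≈-trans (R.*-identityʳ _) (powS-𝟙 n)

powS-+ : ∀ X m n → powS X (m + n) ≈ powS X m ⊗ powS X n
powS-+ X zero n = ≈-sym (R.*-identityˡ _)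
powS-+ X (suc m) n = ≈-trans (R.*-congʳ (powS-+ X m n)) (solve 3 (λ a b c → (a :* b) :* c := (a :* c) :* b) R.refl (powS X m) (powS X n) X)

powS-V : ∀ k .{{_ : NonZero k}} X n → V k (powS X n) ≈ powS (V k X) n
powS-V k X zero = ≈-trans (V-cong k (≈-sym mono-0)) (≈-trans (V-mono k 0) (≈-trans (mono-≡ (ℕ.*-zeroʳ k)) mono-0))
powS-V k X (suc n) = ≈-trans (V-⊗ k _ _) (R.*-congʳ (powS-V k X n))

ΠF : ∀ k → (Fin k → Ser) → Ser
ΠF zero P = 𝟙
ΠF (suc k) P = P Fin.zero ⊗ ΠF k (P ∘ Fin.suc)

ΠF-cong : ∀ k {P Q : Fin k → Ser} → (∀ i → P i ≈ Q i) → ΠF k P ≈ ΠF k Q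
ΠF-cong zero h = ≈-refl
ΠF-cong (suc k) h = R.*-cong (h Fin.zero) (ΠF-cong k (h ∘ Fin.suc))

ΠF-⊗ : ∀ k P Q → ΠF k (λ i → P i ⊗ Q i) ≈ ΠF k P ⊗ ΠF k Q
ΠF-⊗ zero P Q = ≈-sym (R.*-identityˡ 𝟙)
ΠF-⊗ (suc k) P Q = ≈-trans (R.*-congˡ (ΠF-⊗ k _ _)) (solve 4 (λ a b c d → (a :* b) :* (c :* d) := (a :* c) :* (b :* d)) R.refl (P Fin.zero) (Q Fin.zero) (ΠF k (P ∘ Fin.suc)) (ΠF k (Q ∘ Fin.suc)))

ΠF-𝟙 : ∀ k → ΠF k (λ _ → 𝟙) ≈ 𝟙
ΠF-𝟙 zero = ≈-refl
ΠF-𝟙 (suc k) = ≈-trans (R.*-identityˡ _) (ΠF-𝟙 k)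

ΠF-V : ∀ j .{{_ : NonZero j}} k P → V j (ΠF k P) ≈ ΠF k (λ i → V j (P i))
ΠF-V j zero P = powS-V j 𝟙 0
ΠF-V j (suc k) P = ≈-trans (V-⊗ j _ _) (R.*-congˡ (ΠF-V j k _))

red-pow : ∀ S n → red₂ (D.pow S n) ≈ powS (red₂ S) n
red-pow S zero = red-one
red-pow S (suc n) = ≈-trans (red-⊛ (D.pow S n) S) (R.*-congʳ (red-pow S n))

red-prodFin : ∀ k P → red₂ (D.prodFin k P) ≈ ΠF k (λ i → red₂ (P i))
red-prodFin zero P = red-one
red-prodFin (suc k) P = ≈-trans (red-⊛ (P Fin.zero) (D.prodFin k (P ∘ Fin.suc))) (R.*-congˡ (red-prodFin k (P ∘ Fin.suc)))

-- The eta-quotient with its denominator cleared; the theta part of the proof knows `F` only through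
-- this relation.
eta-relation : ∀ u (α r : Fin u → ℕ) t (γ s : Fin t → ℕ) → (∀ i → 1 ≤ α i) → (∀ i → 1 ≤ γ i)
  → red₂ (D.etaQuotient u α r t γ s) ⊗ ΠF t (λ i → powS (V (γ i) f₁) (s i)) ≈ ΠF u (λ i → powS (V (α i) f₁) (r i))
eta-relation u α r t γ s hα hγ = begin
  red₂ (D.etaQuotient u α r t γ s) ⊗ B ≈⟨ R.*-congʳ (≈-trans (red-⊛ (D.prodFin u Pα) (D.prodFin t Pγ)) (R.*-cong (red-prodFin u Pα) (red-prodFin t Pγ))) ⟩
  (ΠF u (λ i → red₂ (D.pow (D.f (α i)) (r i))) ⊗ ΠF t (λ i → red₂ (D.pow (D.finv (γ i)) (s i)))) ⊗ B
    ≈⟨ R.*-congʳ (R.*-cong (ΠF-cong u λ i → ≈-trans (red-pow (D.f (α i)) (r i)) (powS-cong (r i) (red-f (α i) {{ℕ.>-nonZero (hα i)}}))) (ΠF-cong t λ i → red-pow (D.finv (γ i)) (s i))) ⟩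
  (A ⊗ ΠF t (λ i → powS (red₂ (D.finv (γ i))) (s i))) ⊗ B ≈⟨ ≈-trans (R.*-assoc _ _ _) (R.*-congˡ (≈-sym (ΠF-⊗ t _ _))) ⟩
  A ⊗ ΠF t (λ i → powS (red₂ (D.finv (γ i))) (s i) ⊗ powS (V (γ i) f₁) (s i))
    ≈⟨ R.*-congˡ (≈-trans (ΠF-cong t λ i → ≈-trans (≈-sym (powS-⊗ _ _ (s i))) (≈-trans (powS-cong (s i) (f-finv (γ i) {{ℕ.>-nonZero (hγ i)}})) (powS-𝟙 (s i)))) (ΠF-𝟙 t)) ⟩
  A ⊗ 𝟙 ≈⟨ R.*-identityʳ A ⟩
  A ∎
  where
  open ≈R
  Pα = λ i → D.pow (D.f (α i)) (r i)
  Pγ = λ i → D.pow (D.finv (γ i)) (s i)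
  A = ΠF u (λ i → powS (V (α i) f₁) (r i))
  B = ΠF t (λ i → powS (V (γ i) f₁) (s i))

-- Cancellation, powers and the series E_k

Regular : Ser → Set
Regular Y = ∀ {A A'} → A ⊗ Y ≈ A' ⊗ Y → A ≈ A'

regular-⊗ : ∀ {X Y} → Regular X → Regular Y → Regular (X ⊗ Y)
regular-⊗ rX rY e = rX (rY (≈-trans (R.*-assoc _ _ _) (≈-trans e (≈-sym (R.*-assoc _ _ _)))))

regular-𝟙 : Regular 𝟙
regular-𝟙 e = ≈-trans (≈-sym (R.*-identityʳ _)) (≈-trans e (R.*-identityʳ _))

regular-pw2 : ∀ m {X} → Regular X → Regular (pw2 m X)
regular-pw2 zero r = r
regular-pw2 (suc m) r = regular-⊗ (regular-pw2 m r) (regular-pw2 m r)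

regular-Π : ∀ k {P} → (∀ i → Regular (P i)) → Regular (ΠF k P)
regular-Π zero h = regular-𝟙
regular-Π (suc k) h = regular-⊗ (h Fin.zero) (regular-Π k (h ∘ Fin.suc))

E : ℕ → Ser
E k = V k E₁

E-mono : ∀ k .{{_ : NonZero k}} → E k ≈ mono k ⊗ V (24 * k) f₁
E-mono k = ≈-trans (V-⊗ k _ _) (R.*-cong (≈-trans (V-mono k 1) (mono-≡ (ℕ.*-identityʳ k))) (≈-trans (V-V k 24 f₁) (pw λ n → cong (λ z → V z f₁ n) (ℕ.*-comm k 24))))

V-unit : ∀ k .{{_ : NonZero k}} {X} → X 0 ≡ true → V k X 0 ≡ true
V-unit k {X} h = trans (cong (V k X) (sym (ℕ.*-zeroʳ k))) (trans (V-* k X 0) h)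

-- q^k times a series with constant term 1.
regular-E : ∀ k .{{_ : NonZero k}} → Regular (E k)
regular-E k {A} {A'} e = mono-⊗-cancel k (≈-trans (R.*-comm _ _) (≈-trans (unit-cancel (V (24 * k) f₁) (V-unit (24 * k) {{ℕ.m*n≢0 24 k}} (Inf-unit {suc} (λ i → ℕ.≤-refl)))
    (≈-trans (re A) (≈-trans e (≈-sym (re A'))))) (R.*-comm _ _)))
  where
  re : ∀ A → V (24 * k) f₁ ⊗ (A ⊗ mono k) ≈ A ⊗ E k
  re A = ≈-trans (solve 3 (λ v a m → v :* (a :* m) := a :* (m :* v)) R.refl (V (24 * k) f₁) A (mono k)) (R.*-congˡ (≈-sym (E-mono k)))

pw2-⊗ : ∀ m X Y → pw2 m (X ⊗ Y) ≈ pw2 m X ⊗ pw2 m Y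
pw2-⊗ zero X Y = ≈-refl
pw2-⊗ (suc m) X Y = ≈-trans (R.*-cong (pw2-⊗ m X Y) (pw2-⊗ m X Y)) (solve 2 (λ a b → (a :* b) :* (a :* b) := (a :* a) :* (b :* b)) R.refl (pw2 m X) (pw2 m Y))

pw2-V₂ : ∀ m X → pw2 m X ≈ V (2 ℕ.^ m) X
pw2-V₂ zero X = ≈-sym (pw λ n → trans (cong (V 1 X) (sym (ℕ.+-identityʳ n))) (V-* 1 X n))
pw2-V₂ (suc m) X = ≈-trans (R.*-cong (pw2-V₂ m X) (pw2-V₂ m X)) (≈-trans (sq-V _) (V-V 2 (2 ℕ.^ m) {{_}} {{ℕ.m^n≢0 2 m}} X))

pw2-powS : ∀ m X → powS X (2 ℕ.^ m) ≈ pw2 m X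
pw2-powS zero X = R.*-identityˡ X
pw2-powS (suc m) X = ≈-trans (powS-+ X (2 ℕ.^ m) _) (R.*-cong (pw2-powS m X) (≈-trans (pw λ n → cong (λ z → powS X z n) (ℕ.+-identityʳ (2 ℕ.^ m))) (pw2-powS m X)))

pw2-pw2 : ∀ m n X → pw2 m (pw2 n X) ≈ pw2 (m + n) X
pw2-pw2 zero n X = ≈-refl
pw2-pw2 (suc m) n X = R.*-cong (pw2-pw2 m n X) (pw2-pw2 m n X)

pw2-𝟙 : ∀ m → pw2 m 𝟙 ≈ 𝟙
pw2-𝟙 zero = ≈-refl
pw2-𝟙 (suc m) = ≈-trans (R.*-cong (pw2-𝟙 m) (pw2-𝟙 m)) (R.*-identityˡ 𝟙)

pw2-pow : ∀ m X n → pw2 m (powS X n) ≈ powS (pw2 m X) n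
pw2-pow m X zero = pw2-𝟙 m
pw2-pow m X (suc n) = ≈-trans (pw2-⊗ m _ _) (R.*-congʳ (pw2-pow m X n))

pw2-Π : ∀ m k P → pw2 m (ΠF k P) ≈ ΠF k (λ i → pw2 m (P i))
pw2-Π m zero P = pw2-𝟙 m
pw2-Π m (suc k) P = ≈-trans (pw2-⊗ m _ _) (R.*-congˡ (pw2-Π m k _))

ΣN : ∀ k → (Fin k → ℕ) → ℕ
ΣN zero P = 0
ΣN (suc k) P = P Fin.zero + ΣN k (P ∘ Fin.suc)

ΠN : ∀ k → (Fin k → ℕ) → ℕ
ΠN zero P = 1
ΠN (suc k) P = P Fin.zero * ΠN k (P ∘ Fin.suc)

≤-ΣN : ∀ k P i → P i ≤ ΣN k P
≤-ΣN (suc k) P Fin.zero = ℕ.m≤m+n _ _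
≤-ΣN (suc k) P (Fin.suc i) = ℕ.≤-trans (≤-ΣN k (P ∘ Fin.suc) i) (ℕ.m≤n+m _ _)

∣-ΠN : ∀ k P i → P i ∣ ΠN k P
∣-ΠN (suc k) P Fin.zero = ND.m∣m*n _
∣-ΠN (suc k) P (Fin.suc i) = ∣-trans (∣-ΠN k (P ∘ Fin.suc) i) (ND.n∣m*n (P Fin.zero))

ΠN>0 : ∀ k P → (∀ i → 1 ≤ P i) → 1 ≤ ΠN k P
ΠN>0 zero P h = ℕ.≤-refl
ΠN>0 (suc k) P h = ℕ.*-mono-≤ (h Fin.zero) (ΠN>0 k (P ∘ Fin.suc) (h ∘ Fin.suc))

mono-powS : ∀ a n → powS (mono a) n ≈ mono (a * n)
mono-powS a zero = ≈-trans (≈-sym mono-0) (mono-≡ (sym (ℕ.*-zeroʳ a)))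
mono-powS a (suc n) = ≈-trans (R.*-congʳ (mono-powS a n)) (≈-trans (mono-+ _ _) (mono-≡ (trans (ℕ.+-comm (a * n) a) (sym (ℕ.*-suc a n)))))

mono-ΠF : ∀ k P → ΠF k (λ i → mono (P i)) ≈ mono (ΣN k P)
mono-ΠF zero P = ≈-sym mono-0
mono-ΠF (suc k) P = ≈-trans (R.*-congˡ (mono-ΠF k _)) (mono-+ _ _)

ΣN-* : ∀ k c P → ΣN k (λ i → c * P i) ≡ c * ΣN k P
ΣN-* zero c P = sym (ℕ.*-zeroʳ c)
ΣN-* (suc k) c P = trans (cong (c * P Fin.zero ℕ.+_) (ΣN-* k c _)) (sym (ℕ.*-distribˡ-+ c _ _))

module Poly∃ (Λ : ℕ) .{{nzΛ : NonZero Λ}} (2∣Λ : 2 ∣ Λ) (3∣Λ : 3 ∣ Λ) where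
  open Operators Λ 2∣Λ 3∣Λ

  -- The degree merely has to exist: it decides how large the multipliers must be, not their ratio.
  InR : Ser → Set
  InR X = ∃ λ d → R≤ d X

  InR-resp : ∀ {X Y} → X ≈ Y → InR X → InR Y
  InR-resp p (d , r) = d , R-resp p r

  InR-⊗ : ∀ {X Y} → InR X → InR Y → InR (X ⊗ Y)
  InR-⊗ (d , r) (d' , r') = d + d' , R-⊗ r r'

  InR-𝟙 : InR 𝟙
  InR-𝟙 = 0 , R-𝟙

  InR-pw2 : ∀ m {X} → InR X → InR (pw2 m X)
  InR-pw2 zero r = r
  InR-pw2 (suc m) r = InR-⊗ (InR-pw2 m r) (InR-pw2 m r)

  InR-powS : ∀ n {X} → InR X → InR (powS X n)
  InR-powS zero r = InR-𝟙
  InR-powS (suc n) r = InR-⊗ (InR-powS n r) r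

  InR-Π : ∀ k {P} → (∀ i → InR (P i)) → InR (ΠF k P)
  InR-Π zero h = InR-𝟙
  InR-Π (suc k) h = InR-⊗ (h Fin.zero) (InR-Π k (h ∘ Fin.suc))

  InR-U₂ : ∀ {X} → InR X → InR (U 2 X)
  InR-U₂ (d , r) = d + 2 * Λ , U₂-R d (R-weaken (ℕ.≤-trans (ℕ.m≤m+n d d) (ℕ.m≤m+n _ Λ)) r)

  InR-U₂^ : ∀ m {X} → InR X → InR (U (2 ℕ.^ m) X)
  InR-U₂^ zero {X} r = InR-resp (pw λ n → cong X (sym (ℕ.+-identityʳ n))) r
  InR-U₂^ (suc m) {X} r = InR-resp (U-U (2 ℕ.^ m) 2 X) (InR-U₂^ m (InR-U₂ r))

  InR-class : ∀ L c → L ∣ Λ → InR (Θ₁ L c)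
  InR-class L c d = 1 , R-Θ 0 (cls L c) (clsV-periodic 0 c d)

  -- 2^(k-1) copies of the scale k embed into the scale 1
  InR-scaled : ∀ μ k L c → suc k * L ∣ Λ → k ≤ μ → InR (pw2 μ (V (suc k) (Θ₁ L c)))
  InR-scaled μ k L c d le = InR-resp (≈-trans (pw2-pw2 (μ ∸ k) k _) (pw λ n → cong (λ z → pw2 z (V (suc k) (Θ₁ L c)) n) (ℕ.m∸n+n≡m le)))
    (InR-pw2 (μ ∸ k) (InR-resp (≈-sym (≈-trans (pw2-V k (suc k) _) (≈-trans (V-cong (suc k) (pw2-Θ k L c)) (V-Θ (M-similitude k) L (diag k c)))))
      (2 ℕ.^ k , R-Θ k _ (periodic-∘ (M-similitude k) (clsV-periodic k (sc (+ suc k) (diag k c)) d)))))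

-- The eta-quotient as a quotient of theta polynomials

module Assembly (u : ℕ) (α r : Fin u → ℕ) (t : ℕ) (γ s : Fin t → ℕ) (hα : ∀ i → 1 ≤ α i) (hγ : ∀ i → 1 ≤ γ i)
                (a b' β : ℕ) .{{nza : NonZero a}} .{{nzβ : NonZero β}}
                (center : β + ΣN u (λ i → α i * r i) ≡ 24 * b' + ΣN t (λ i → γ i * s i)) where

  F : Ser
  F = red₂ (D.etaQuotient u α r t γ s)

  ε : ℤ → ℕ
  ε y = 2 * β * jt (24 * a) (suc (12 * a)) (ℕ.pred (12 * a)) y

  h : Ser
  h = Gen 0 ε (λ _ → true)

  G : Ser
  G = U a (F ⊗ mono b')

  private
    instance
      nz2β : NonZero (2 * β)
      nz2β = ℕ.m*n≢0 2 β
      nz24β : NonZero (24 * β)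
      nz24β = ℕ.m*n≢0 24 β
      nz12a : NonZero (12 * a)
      nz12a = ℕ.m*n≢0 12 a
      nz24βa : NonZero (24 * β * a)
      nz24βa = ℕ.m*n≢0 (24 * β) a
      nzL : NonZero (24 * a * β)
      nzL = ℕ.m*n≢0 (24 * a) β {{ℕ.m*n≢0 24 a}}

    A' = 24 * a

    jt-lin : ∀ B B' → 0 < B → 0 < B' → ∀ y → ∣ y ∣ ≤ jt A' B B' y
    jt-lin B B' p q (+ k) = ℕ.≤-trans (ℕ.m≤n*m k B {{ℕ.>-nonZero p}}) (ℕ.m≤n+m _ _)
    jt-lin B B' p q -[1+ k ] = ℕ.≤-trans (ℕ.m≤n*m (suc k) B' {{ℕ.>-nonZero q}}) (ℕ.m≤n+m _ _)

    0<pred : 0 < ℕ.pred (12 * a)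
    0<pred = ℕ.pred-mono-≤ (ℕ.≤-trans (s≤s (s≤s z≤n)) (ℕ.*-monoʳ-≤ 12 (ℕ.>-nonZero⁻¹ a)))

  ε-big : ∀ y → ∣ y ∣ ≤ ε y
  ε-big y = ℕ.≤-trans (jt-lin _ _ (s≤s z≤n) 0<pred y) (ℕ.m≤n*m _ (2 * β))

  private
    H : Ser
    H = Θ₁ (24 * a * β) (+ β)

    -- (β + 24 a β y)² = β² + 24 β a · ε y.
    h-H : mono (β * β) ⊗ V (24 * β * a) h ≈ H
    h-H = jt-class (β * β) (24 * β * a) ε (24 * a * β) (+ β) (+ (24 * a * β)) (inj₁ refl) ε-big
      λ y → trans (square-jt (β * β) (24 * β * a * (2 * β)) A' (suc (12 * a)) (ℕ.pred (12 * a)) (+ β) (+ (24 * a * β)) (sym (ℤ.pos-* β β)) e1 e2 e3 y)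
        (cong (β * β ℕ.+_) (ℕ.*-assoc (24 * β * a) (2 * β) _))
      where
      aZ = + a
      bZ = + β
      d≡ : + (24 * a * β) ≡ + 24 ℤ.* aZ ℤ.* bZ
      d≡ = trans (ℤ.pos-* (24 * a) β) (cong (λ z → z ℤ.* bZ) (ℤ.pos-* 24 a))
      m≡ : + (24 * β * a * (2 * β)) ≡ + 24 ℤ.* bZ ℤ.* aZ ℤ.* (+ 2 ℤ.* bZ)
      m≡ = trans (ℤ.pos-* (24 * β * a) (2 * β)) (cong₂ ℤ._*_ (trans (ℤ.pos-* (24 * β) a) (cong (λ z → z ℤ.* aZ) (ℤ.pos-* 24 β))) (ℤ.pos-* 2 β))
      e1 : + 2 ℤ.* (+ (24 * a * β) ℤ.* + (24 * a * β)) ≡ + (24 * β * a * (2 * β)) ℤ.* + (24 * a)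
      e1 = trans (cong (λ z → + 2 ℤ.* (z ℤ.* z)) d≡) (trans (l aZ bZ) (sym (cong₂ ℤ._*_ m≡ (ℤ.pos-* 24 a))))
        where
        l : ∀ a b → + 2 ℤ.* (+ 24 ℤ.* a ℤ.* b ℤ.* (+ 24 ℤ.* a ℤ.* b)) ≡ + 24 ℤ.* b ℤ.* a ℤ.* (+ 2 ℤ.* b) ℤ.* (+ 24 ℤ.* a)
        l = ZS.solve-∀
      e2 : + (24 * a * β) ℤ.* + (24 * a * β) ℤ.+ + 2 ℤ.* (+ β ℤ.* + (24 * a * β)) ≡ + (24 * β * a * (2 * β)) ℤ.* + suc (12 * a)
      e2 = trans (cong (λ z → z ℤ.* z ℤ.+ + 2 ℤ.* (+ β ℤ.* z)) d≡) (trans (l aZ bZ) (sym (cong₂ ℤ._*_ m≡ (cong (λ z → + 1 ℤ.+ z) (ℤ.pos-* 12 a)))))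
        where
        l : ∀ a b → + 24 ℤ.* a ℤ.* b ℤ.* (+ 24 ℤ.* a ℤ.* b) ℤ.+ + 2 ℤ.* (b ℤ.* (+ 24 ℤ.* a ℤ.* b)) ≡ + 24 ℤ.* b ℤ.* a ℤ.* (+ 2 ℤ.* b) ℤ.* (+ 1 ℤ.+ + 12 ℤ.* a)
        l = ZS.solve-∀
      pred≡ : + ℕ.pred (12 * a) ≡ + 12 ℤ.* aZ ℤ.- + 1
      pred≡ = trans (go (12 * a)) (cong (λ z → z ℤ.- + 1) (ℤ.pos-* 12 a))
        where
        go : ∀ n .{{_ : NonZero n}} → + ℕ.pred n ≡ + n ℤ.- + 1
        go (suc n) = refl
      e3 : + (24 * a * β) ℤ.* + (24 * a * β) ℤ.- + 2 ℤ.* (+ β ℤ.* + (24 * a * β)) ≡ + (24 * β * a * (2 * β)) ℤ.* + ℕ.pred (12 * a)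
      e3 = trans (cong (λ z → z ℤ.* z ℤ.- + 2 ℤ.* (+ β ℤ.* z)) d≡) (trans (l aZ bZ) (sym (cong₂ ℤ._*_ m≡ pred≡)))
        where
        l : ∀ a b → + 24 ℤ.* a ℤ.* b ℤ.* (+ 24 ℤ.* a ℤ.* b) ℤ.- + 2 ℤ.* (b ℤ.* (+ 24 ℤ.* a ℤ.* b)) ≡ + 24 ℤ.* b ℤ.* a ℤ.* (+ 2 ℤ.* b) ℤ.* (+ 12 ℤ.* a ℤ.- + 1)
        l = ZS.solve-∀

    κγ : Fin t → ℕ
    κγ i = β * γ i
    κα : Fin u → ℕ
    κα i = β * α i

    nzγ : ∀ i → NonZero (κγ i)
    nzγ i = ℕ.m*n≢0 β (γ i) {{nzβ}} {{ℕ.>-nonZero (hγ i)}}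
    nzα : ∀ i → NonZero (κα i)
    nzα i = ℕ.m*n≢0 β (α i) {{nzβ}} {{ℕ.>-nonZero (hα i)}}

    Sα = ΣN u (λ i → α i * r i)
    Sγ = ΣN t (λ i → γ i * s i)

    W : Ser
    W = V (24 * β) ((F ⊗ mono b') ⊗ V a h)

    eta-E : ∀ k (δ e : Fin k → ℕ) → (∀ i → 1 ≤ δ i) → V (24 * β) (ΠF k (λ i → powS (V (δ i) f₁) (e i))) ⊗ mono (β * ΣN k (λ i → δ i * e i)) ≈ ΠF k (λ i → powS (E (β * δ i)) (e i))
    eta-E k δ e hδ = ≈-sym (begin
      ΠF k (λ i → powS (E (β * δ i)) (e i)) ≈⟨ ΠF-cong k one ⟩
      ΠF k (λ i → V (24 * β) (powS (V (δ i) f₁) (e i)) ⊗ mono (β * (δ i * e i))) ≈⟨ ΠF-⊗ k _ _ ⟩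
      ΠF k (λ i → V (24 * β) (powS (V (δ i) f₁) (e i))) ⊗ ΠF k (λ i → mono (β * (δ i * e i)))
        ≈⟨ R.*-cong (≈-sym (ΠF-V (24 * β) k _)) (≈-trans (mono-ΠF k _) (mono-≡ (ΣN-* k β _))) ⟩
      _ ∎)
      where
      open ≈R
      one : ∀ i → powS (E (β * δ i)) (e i) ≈ V (24 * β) (powS (V (δ i) f₁) (e i)) ⊗ mono (β * (δ i * e i))
      one i = begin
        powS (E (β * δ i)) (e i) ≈⟨ powS-cong (e i) (≈-trans (E-mono (β * δ i)) (R.*-comm _ _)) ⟩
        powS (V (24 * (β * δ i)) f₁ ⊗ mono (β * δ i)) (e i) ≈⟨ powS-⊗ _ _ (e i) ⟩
        powS (V (24 * (β * δ i)) f₁) (e i) ⊗ powS (mono (β * δ i)) (e i)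
          ≈⟨ R.*-cong (≈-trans (powS-cong (e i) (≈-trans (pw λ n → cong (λ z → V z f₁ n) (sym (ℕ.*-assoc 24 β (δ i)))) (≈-sym (V-V (24 * β) (δ i) f₁)))) (≈-sym (powS-V (24 * β) _ (e i))))
                (≈-trans (mono-powS _ (e i)) (mono-≡ (ℕ.*-assoc β (δ i) (e i)))) ⟩
        _ ∎
        where
        instance
          nzδ : NonZero (δ i)
          nzδ = ℕ.>-nonZero (hδ i)
          nzβδ : NonZero (β * δ i)
          nzβδ = ℕ.m*n≢0 β (δ i)

    -- the shifts agree by the choice of β
    W-E : W ⊗ ΠF t (λ i → powS (E (κγ i)) (s i)) ≈ ΠF u (λ i → powS (E (κα i)) (r i)) ⊗ H
    W-E = begin
      W ⊗ ΠF t (λ i → powS (E (κγ i)) (s i)) ≈⟨ R.*-cong W≈ (≈-sym (eta-E t γ s hγ)) ⟩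
      ((v F ⊗ mono (24 * β * b')) ⊗ vh) ⊗ (v Pγ ⊗ mono (β * Sγ))
        ≈⟨ solve 5 (λ f m h p n → ((f :* m) :* h) :* (p :* n) := (f :* p) :* ((m :* n) :* h)) R.refl (v F) (mono (24 * β * b')) vh (v Pγ) (mono (β * Sγ)) ⟩
      (v F ⊗ v Pγ) ⊗ ((mono (24 * β * b') ⊗ mono (β * Sγ)) ⊗ vh)
        ≈⟨ R.*-cong (≈-trans (≈-sym (V-⊗ (24 * β) F Pγ)) (V-cong (24 * β) (eta-relation u α r t γ s hα hγ))) (R.*-congʳ (≈-trans (mono-+ _ _) (≈-trans (mono-≡ shift) (≈-sym (mono-+ _ _))))) ⟩
      v Pα ⊗ ((mono (β * Sα) ⊗ mono (β * β)) ⊗ vh) ≈⟨ solve 4 (λ p m n h → p :* ((m :* n) :* h) := (p :* m) :* (n :* h)) R.refl (v Pα) (mono (β * Sα)) (mono (β * β)) vh ⟩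
      (v Pα ⊗ mono (β * Sα)) ⊗ (mono (β * β) ⊗ vh) ≈⟨ R.*-cong (eta-E u α r hα) h-H ⟩
      _ ∎
      where
      open ≈R
      v = V (24 * β)
      vh = V (24 * β * a) h
      Pγ = ΠF t (λ i → powS (V (γ i) f₁) (s i))
      Pα = ΠF u (λ i → powS (V (α i) f₁) (r i))
      W≈ : W ≈ (v F ⊗ mono (24 * β * b')) ⊗ vh
      W≈ = ≈-trans (V-⊗ (24 * β) _ _) (R.*-cong (≈-trans (V-⊗ (24 * β) _ _) (R.*-congˡ (V-mono (24 * β) b'))) (V-V (24 * β) a h))
      shift : 24 * β * b' + β * Sγ ≡ β * Sα + β * β
      shift = trans (l1 β b' Sγ) (trans (cong (β *_) (sym center)) (l2 β Sα))
        where
        l1 : ∀ β b S → 24 * β * b + β * S ≡ β * (24 * b + S)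
        l1 = NS.solve-∀
        l2 : ∀ β S → β * (β + S) ≡ β * S + β * β
        l2 = NS.solve-∀

    -- A common modulus: a multiple of 24 a β for `H`, and of 24 β α_i and 24 β γ_i for the scaled
    -- series.
    Λ : ℕ
    Λ = (24 * a * β) * (ΠN u α * ΠN t γ)

    instance
      nzΛ : NonZero Λ
      nzΛ = ℕ.m*n≢0 (24 * a * β) (ΠN u α * ΠN t γ) {{nzL}} {{ℕ.m*n≢0 _ _ {{ℕ.>-nonZero (ΠN>0 u α hα)}} {{ℕ.>-nonZero (ΠN>0 t γ hγ)}}}}

    L∣Λ : 24 * a * β ∣ Λ
    L∣Λ = ND.m∣m*n _

    24β∣L : 24 * β ∣ 24 * a * β
    24β∣L = divides a (l a β)
      where
      l : ∀ a b → 24 * a * b ≡ a * (24 * b)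
      l = NS.solve-∀

    2∣Λ : 2 ∣ Λ
    2∣Λ = ∣-trans (∣-trans (divides 12 refl) (∣-trans (ND.m∣m*n {24} a) (ND.m∣m*n β))) L∣Λ
    3∣Λ : 3 ∣ Λ
    3∣Λ = ∣-trans (∣-trans (divides 8 refl) (∣-trans (ND.m∣m*n {24} a) (ND.m∣m*n β))) L∣Λ

    α∣Λ : ∀ i → 24 * κα i ∣ Λ
    α∣Λ i = subst (_∣ Λ) (ℕ.*-assoc 24 β (α i)) (ND.*-pres-∣ 24β∣L (∣-trans (∣-ΠN u α i) (ND.m∣m*n _)))
    γ∣Λ : ∀ i → 24 * κγ i ∣ Λ
    γ∣Λ i = subst (_∣ Λ) (ℕ.*-assoc 24 β (γ i)) (ND.*-pres-∣ 24β∣L (∣-trans (∣-ΠN t γ i) (ND.n∣m*n (ΠN u α))))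

    open Poly∃ Λ 2∣Λ 3∣Λ
    open Thetas Λ using (R≤; R-resp)

    -- Large enough that the power 2^μ turns every scale in use, up to 8 β γ_i, into a polynomial,
    -- and that s_i ≤ 2^μ.
    μ : ℕ
    μ = ΣN u κα + (ΣN t (λ i → 8 * κγ i) + ΣN t s)

    scaled : ∀ k .{{_ : NonZero k}} L c → k * L ∣ Λ → k ≤ μ → InR (pw2 μ (V k (Θ₁ L c)))
    scaled (suc k) L c d le = InR-scaled μ k L c d (ℕ.<⇒≤ le)

    E-InR : ∀ k .{{_ : NonZero k}} → 24 * k ∣ Λ → k ≤ μ → InR (pw2 μ (E k))
    E-InR k d le = InR-resp (pw2-cong μ (V-cong k (≈-sym E₁-Θ))) (scaled k 6 (+ 1) (∣-trans (divides 4 (l k)) d) le)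
      where
      l : ∀ k → 24 * k ≡ 4 * (k * 6)
      l = NS.solve-∀

    Eα-InR : ∀ i → InR (pw2 μ (E (κα i)))
    Eα-InR i = E-InR (κα i) {{nzα i}} (α∣Λ i) (ℕ.≤-trans (≤-ΣN u κα i) (ℕ.m≤m+n _ _))

    8γ≤μ : ∀ i → 8 * κγ i ≤ μ
    8γ≤μ i = ℕ.≤-trans (≤-ΣN t (λ i → 8 * κγ i) i) (ℕ.≤-trans (ℕ.m≤m+n _ _) (ℕ.m≤n+m _ (ΣN u κα)))

    s≤2^μ : ∀ i → s i ≤ 2 ℕ.^ μ
    s≤2^μ i = ℕ.≤-trans (ℕ.≤-trans (≤-ΣN t s i) (ℕ.≤-trans (ℕ.m≤n+m _ _) (ℕ.m≤n+m _ (ΣN u κα)))) (n≤2^n μ)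
      where
      n≤2^n : ∀ n → n ≤ 2 ℕ.^ n
      n≤2^n zero = z≤n
      n≤2^n (suc n) = ℕ.+-mono-≤ (ℕ.m^n>0 2 n) (ℕ.≤-trans (n≤2^n n) (ℕ.m≤m+n _ 0))

    Eγ-InR : ∀ i → InR (pw2 μ (E (κγ i)))
    Eγ-InR i = E-InR (κγ i) {{nzγ i}} (γ∣Λ i) (ℕ.≤-trans (ℕ.m≤n*m (κγ i) 8) (8γ≤μ i))

    B : Ser
    B = ΠF t (λ i → pw2 μ (E (κγ i)))

    -- The cofactor in `E₁-cube`, taken at the scales β γ_i and to the power 2^μ, so that B C =
    -- B(q³)³.
    C : Ser
    C = ΠF t (λ i → pw2 μ (V (8 * κγ i) (Θ₁ 3 (+ 1))))

    B-InR : InR B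
    B-InR = InR-Π t Eγ-InR

    C-InR : InR C
    C-InR = InR-Π t λ i → scaled (8 * κγ i) {{ℕ.m*n≢0 8 _ {{_}} {{nzγ i}}}} 3 (+ 1) (subst (_∣ Λ) (l (κγ i)) (γ∣Λ i)) (8γ≤μ i)
      where
      l : ∀ k → 24 * k ≡ 8 * k * 3
      l = NS.solve-∀

    BC : B ⊗ C ≈ V 3 (B ⊗ (B ⊗ B))
    BC = begin
      B ⊗ C ≈⟨ ≈-sym (ΠF-⊗ t _ _) ⟩
      ΠF t (λ i → pw2 μ (E (κγ i)) ⊗ pw2 μ (V (8 * κγ i) (Θ₁ 3 (+ 1)))) ≈⟨ ΠF-cong t one ⟩
      ΠF t (λ i → V 3 (e i) ⊗ (V 3 (e i) ⊗ V 3 (e i))) ≈⟨ ≈-trans (ΠF-⊗ t _ _) (R.*-congˡ (ΠF-⊗ t _ _)) ⟩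
      ΠF t (λ i → V 3 (e i)) ⊗ (ΠF t (λ i → V 3 (e i)) ⊗ ΠF t (λ i → V 3 (e i))) ≈⟨ ≈-sym (R.*-cong (ΠF-V 3 t e) (R.*-cong (ΠF-V 3 t e) (ΠF-V 3 t e))) ⟩
      V 3 B ⊗ (V 3 B ⊗ V 3 B) ≈⟨ ≈-sym (≈-trans (V-⊗ 3 _ _) (R.*-congˡ (V-⊗ 3 _ _))) ⟩
      V 3 (B ⊗ (B ⊗ B)) ∎
      where
      open ≈R
      e : Fin t → Ser
      e i = pw2 μ (E (κγ i))
      one : ∀ i → e i ⊗ pw2 μ (V (8 * κγ i) (Θ₁ 3 (+ 1))) ≈ V 3 (e i) ⊗ (V 3 (e i) ⊗ V 3 (e i))
      one i = begin
        pw2 μ (V k E₁) ⊗ pw2 μ (V (8 * k) (Θ₁ 3 (+ 1))) ≈⟨ ≈-sym (pw2-⊗ μ _ _) ⟩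
        pw2 μ (V k E₁ ⊗ V (8 * k) (Θ₁ 3 (+ 1))) ≈⟨ pw2-cong μ (R.*-congˡ (≈-trans (pw λ n → cong (λ z → V z (Θ₁ 3 (+ 1)) n) (ℕ.*-comm 8 k)) (≈-sym (V-V k 8 _)))) ⟩
        pw2 μ (V k E₁ ⊗ V k (V 8 (Θ₁ 3 (+ 1)))) ≈⟨ pw2-cong μ (≈-trans (≈-sym (V-⊗ k _ _)) (≈-trans (V-cong k E₁-cube) (≈-trans (V-⊗ k _ _) (R.*-cong v (≈-trans (V-⊗ k _ _) (R.*-cong v v)))))) ⟩
        pw2 μ (V 3 (V k E₁) ⊗ (V 3 (V k E₁) ⊗ V 3 (V k E₁))) ≈⟨ ≈-trans (pw2-⊗ μ _ _) (R.*-congˡ (pw2-⊗ μ _ _)) ⟩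
        pw2 μ (V 3 (V k E₁)) ⊗ (pw2 μ (V 3 (V k E₁)) ⊗ pw2 μ (V 3 (V k E₁))) ≈⟨ R.*-cong (pw2-V μ 3 _) (R.*-cong (pw2-V μ 3 _) (pw2-V μ 3 _)) ⟩
        _ ∎
        where
        k = κγ i
        instance
          nzk : NonZero k
          nzk = nzγ i
        v : V k (V 3 E₁) ≈ V 3 (V k E₁)
        v = ≈-trans (V-V k 3 E₁) (≈-trans (pw λ n → cong (λ z → V z E₁ n) (ℕ.*-comm k 3)) (≈-sym (V-V 3 k E₁)))

    B-regular : Regular B
    B-regular = regular-Π t λ i → regular-pw2 μ (regular-E (κγ i) {{nzγ i}})

    -- W B is U_{2^μ} of its own 2^μ-th power, which is a polynomial in the theta series
    WB-InR : InR (W ⊗ B)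
    WB-InR = InR-resp (≈-trans (U-cong (2 ℕ.^ μ) (≈-trans (≈-sym eq) (pw2-V₂ μ (W ⊗ B)))) (UV (2 ℕ.^ μ) {{ℕ.m^n≢0 2 μ}} (W ⊗ B)))
      (InR-U₂^ μ (InR-⊗ (InR-⊗ (InR-Π u λ i → InR-powS (r i) (Eα-InR i)) (InR-pw2 μ (InR-class _ (+ β) L∣Λ))) (InR-Π t λ i → InR-powS (2 ℕ.^ μ ∸ s i) (Eγ-InR i))))
      where
      open ≈R
      Dγ : Fin t → Ser
      Dγ i = pw2 μ (E (κγ i))
      rest = ΠF t (λ i → powS (Dγ i) (2 ℕ.^ μ ∸ s i))
      eq : pw2 μ (W ⊗ B) ≈ (ΠF u (λ i → powS (pw2 μ (E (κα i))) (r i)) ⊗ pw2 μ H) ⊗ rest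
      eq = begin
        pw2 μ (W ⊗ B) ≈⟨ pw2-⊗ μ W B ⟩
        pw2 μ W ⊗ pw2 μ B ≈⟨ R.*-congˡ (≈-trans (pw2-Π μ t Dγ) (≈-trans (ΠF-cong t λ i → ≈-trans (≈-sym (pw2-powS μ (Dγ i)))
            (≈-trans (pw λ n → cong (λ z → powS (Dγ i) z n) (sym (ℕ.m+[n∸m]≡n (s≤2^μ i)))) (powS-+ (Dγ i) (s i) _))) (ΠF-⊗ t _ _))) ⟩
        pw2 μ W ⊗ (ΠF t (λ i → powS (Dγ i) (s i)) ⊗ rest) ≈⟨ ≈-sym (R.*-assoc _ _ _) ⟩
        (pw2 μ W ⊗ ΠF t (λ i → powS (Dγ i) (s i))) ⊗ rest
          ≈⟨ R.*-congʳ (R.*-congˡ (≈-sym (≈-trans (pw2-Π μ t _) (ΠF-cong t λ i → pw2-pow μ (E (κγ i)) (s i))))) ⟩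
        (pw2 μ W ⊗ pw2 μ (ΠF t (λ i → powS (E (κγ i)) (s i)))) ⊗ rest ≈⟨ R.*-congʳ (≈-trans (≈-sym (pw2-⊗ μ _ _)) (≈-trans (pw2-cong μ W-E) (pw2-⊗ μ _ _))) ⟩
        (pw2 μ (ΠF u (λ i → powS (E (κα i)) (r i))) ⊗ pw2 μ H) ⊗ rest
          ≈⟨ R.*-congʳ (R.*-congʳ (≈-trans (pw2-Π μ u _) (ΠF-cong u λ i → pw2-pow μ (E (κα i)) (r i)))) ⟩
        _ ∎

    -- `U (24 * β)` undoes the substitution, and h(q^a) passes through `U a` by the projection
    -- formula.
    W-section : U (24 * β * a) W ≈ G ⊗ h
    W-section = ≈-trans (≈-sym (U-U a (24 * β) W)) (≈-trans (U-cong a (≈-trans (UV (24 * β) _) (R.*-comm _ _))) (≈-trans (U-V-⊗ a h _) (R.*-comm _ _)))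

    module Dyn = Dynamics Λ 2∣Λ 3∣Λ

  theta-recurrence : ∀ ρ → 1 < ρ → ∃ λ m₁ → ∃ λ m₂ → Smooth m₁ × Smooth m₂ × ρ * m₁ ≤ m₂ × m₂ < 2 * (ρ * m₁) × U m₁ (G ⊗ h) ≈ U m₂ (G ⊗ h)
  theta-recurrence ρ 1<ρ = descend (Dyn.recurrence W B C _ _ _ (proj₂ B-InR) (proj₂ C-InR) (proj₂ WB-InR) BC B-regular ρ 1<ρ)
    where
    sect : ∀ m₁ m₂ → U m₁ W ≈ U m₂ W → U m₁ (G ⊗ h) ≈ U m₂ (G ⊗ h)
    sect m₁ m₂ p = ≈-trans (at-m m₁) (≈-trans (U-cong (24 * β * a) p) (≈-sym (at-m m₂)))
      where
      swap : ∀ c m n → c * (m * n) ≡ m * (c * n)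
      swap = NS.solve-∀
      at-m : ∀ m → U m (G ⊗ h) ≈ U (24 * β * a) (U m W)
      at-m m = ≈-trans (U-cong m (≈-sym W-section)) (pw λ n → cong W (swap (24 * β * a) m n))
    descend : (∃ λ m₁ → ∃ λ m₂ → Smooth m₁ × Smooth m₂ × ρ * m₁ ≤ m₂ × m₂ < 2 * (ρ * m₁) × U m₁ W ≈ U m₂ W) → _
    descend (m₁ , m₂ , s₁ , s₂ , lo , hi , p) = m₁ , m₂ , s₁ , s₂ , lo , hi , sect m₁ m₂ p

-- Counting, and parities of truncated theta sums

bit : Bool → ℕ
bit true = 1
bit false = 0

ΣL : (ℕ → ℕ) → ℕ → ℕ
ΣL f zero = 0
ΣL f (suc n) = ΣL f n + f n

cnt : (ℕ → Bool) → ℕ → ℕ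
cnt φ = ΣL (bit ∘ φ)

ΣL-mono : ∀ f {m n} → m ≤ n → ΣL f m ≤ ΣL f n
ΣL-mono f {m} {zero} z≤n = ℕ.≤-refl
ΣL-mono f {m} {suc n} le with ℕ.m≤n⇒m<n∨m≡n le
... | inj₁ (s≤s l) = ℕ.≤-trans (ΣL-mono f l) (ℕ.m≤m+n _ _)
... | inj₂ refl = ℕ.≤-refl

ΣL-≤ : ∀ {f g} n → (∀ i → i < n → f i ≤ g i) → ΣL f n ≤ ΣL g n
ΣL-≤ zero h = z≤n
ΣL-≤ (suc n) h = ℕ.+-mono-≤ (ΣL-≤ n λ i l → h i (ℕ.m≤n⇒m≤1+n l)) (h n ℕ.≤-refl)

ΣL-+ : ∀ f g n → ΣL (λ i → f i + g i) n ≡ ΣL f n + ΣL g n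
ΣL-+ f g zero = refl
ΣL-+ f g (suc n) = trans (cong (ℕ._+ (f n + g n)) (ΣL-+ f g n)) (l (ΣL f n) (ΣL g n) (f n) (g n))
  where
  l : ∀ a b c d → a + b + (c + d) ≡ a + c + (b + d)
  l = NS.solve-∀

ΣL-0 : ∀ n → ΣL (λ _ → 0) n ≡ 0
ΣL-0 zero = refl
ΣL-0 (suc n) = trans (ℕ.+-identityʳ _) (ΣL-0 n)

ΣL-swap : ∀ (f : ℕ → ℕ → ℕ) m n → ΣL (λ i → ΣL (f i) n) m ≡ ΣL (λ j → ΣL (λ i → f i j) m) n
ΣL-swap f zero n = sym (ΣL-0 n)
ΣL-swap f (suc m) n = trans (cong (ℕ._+ ΣL (f m) n) (ΣL-swap f m n)) (sym (ΣL-+ _ (f m) n))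

ΣL-* : ∀ f c n → ΣL f n * c ≡ ΣL (λ i → f i * c) n
ΣL-* f c zero = refl
ΣL-* f c (suc n) = trans (ℕ.*-distribʳ-+ c (ΣL f n) (f n)) (cong (ℕ._+ f n * c) (ΣL-* f c n))

bit-≤1 : ∀ b → bit b ≤ 1
bit-≤1 true = ℕ.≤-refl
bit-≤1 false = z≤n

cnt-≤ : ∀ φ n → cnt φ n ≤ n
cnt-≤ φ zero = z≤n
cnt-≤ φ (suc n) = subst (cnt φ n + bit (φ n) ≤_) (ℕ.+-comm n 1) (ℕ.+-mono-≤ (cnt-≤ φ n) (bit-≤1 (φ n)))

cnt-progression : ∀ m .{{_ : NonZero m}} c φ ψ T → (∀ Y → φ Y ≡ true → c ≤ m * Y × ψ (m * Y ∸ c) ≡ true) → cnt φ T ≤ cnt ψ (m * T ∸ c)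
cnt-progression m c φ ψ zero h = z≤n
cnt-progression m c φ ψ (suc T) h with φ T in eq
... | false = ℕ.≤-trans (ℕ.≤-reflexive (ℕ.+-identityʳ _)) (ℕ.≤-trans (cnt-progression m c φ ψ T h) (ΣL-mono _ (ℕ.∸-monoˡ-≤ c (ℕ.*-monoʳ-≤ m (ℕ.n≤1+n T)))))
... | true with h T eq
... | le , p = ℕ.≤-trans (ℕ.+-mono-≤ (cnt-progression m c φ ψ T h) (ℕ.≤-reflexive (cong bit (sym p)))) (ΣL-mono (bit ∘ ψ) {suc (m * T ∸ c)} (ℕ.≤-trans
   (ℕ.≤-reflexive (sym (ℕ.+-∸-assoc 1 le))) (ℕ.∸-monoˡ-≤ c (ℕ.≤-trans (ℕ.+-monoˡ-≤ (m * T) (ℕ.>-nonZero⁻¹ m)) (ℕ.≤-reflexive (sym (ℕ.*-suc m T)))))))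

-- The `Y` with m Y < c have no image, but Y ≤ m Y < c leaves at most `c` of them.
cnt-progression′ : ∀ m .{{_ : NonZero m}} c φ ψ T → (∀ Y → φ Y ≡ true → c ≤ m * Y → ψ (m * Y ∸ c) ≡ true) → cnt φ T ≤ c + cnt ψ (m * T ∸ c)
cnt-progression′ m c φ ψ T h = ℕ.≤-trans (ΣL-≤ T λ i _ → split i) (ℕ.≤-trans (ℕ.≤-reflexive (ΣL-+ _ _ T))
  (ℕ.+-mono-≤ (below T) (cnt-progression m c φ' ψ T λ Y t → let (p , q) = ∧-elim {does (c ℕ.≤? m * Y)} t in
     does-true (c ℕ.≤? m * Y) p , h Y q (does-true (c ℕ.≤? m * Y) p))))
  where
  φ' : ℕ → Bool
  φ' Y = does (c ℕ.≤? m * Y) ∧ φ Y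
  low : ℕ → Bool
  low Y = does (Y ℕ.<? c)
  split : ∀ i → bit (φ i) ≤ bit (low i) + bit (φ' i)
  split i with c ℕ.≤? m * i
  ... | yes p = ℕ.≤-trans (ℕ.m≤n+m _ (bit (low i))) (ℕ.≤-reflexive (cong (λ z → bit (low i) + bit (z ∧ φ i)) (sym (dec-true (c ℕ.≤? m * i) p))))
  ... | no ¬p = ℕ.≤-trans (bit-≤1 (φ i)) (ℕ.≤-trans (ℕ.≤-reflexive (cong bit (sym (dec-true (i ℕ.<? c) (ℕ.≤-<-trans (ℕ.m≤n*m i m) (ℕ.≰⇒> ¬p)))))) (ℕ.m≤m+n _ _))
  below : ∀ T → cnt low T ≤ c
  below T with ℕ.≤-total T c
  ... | inj₁ le = ℕ.≤-trans (cnt-≤ low T) le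
  ... | inj₂ ge = subst (λ z → cnt low z ≤ c) (ℕ.m+[n∸m]≡n ge) (go (T ∸ c))
    where
    go : ∀ j → cnt low (c + j) ≤ c
    go zero = subst (λ z → cnt low z ≤ c) (sym (ℕ.+-identityʳ c)) (cnt-≤ low c)
    go (suc j) = subst (λ z → cnt low z ≤ c) (sym (ℕ.+-suc c j)) (ℕ.≤-trans (ℕ.≤-reflexive (trans (cong (λ z → cnt low (c + j) + bit z) (dec-false (c + j ℕ.<? c) λ lt → ℕ.<⇒≱ lt (ℕ.m≤m+n c j))) (ℕ.+-identityʳ _))) (go j))

-- Consecutive elements are at least m / g apart. The induction remembers the last element `l` and
-- bounds by g l, since a bound by g n would not leave room for the next gap.
cnt-spaced : ∀ φ m g n → (∀ x x' → x < x' → φ x ≡ true → φ x' ≡ true → m ≤ g * (x' ∸ x)) → cnt φ n * m ≤ m + g * n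
cnt-spaced φ m g n sep with go n
  where
  go : ∀ n → (cnt φ n ≡ 0) ⊎ (∃ λ l → l < n × φ l ≡ true × cnt φ n * m ≤ m + g * l)
  go zero = inj₁ refl
  go (suc n) with φ n in eq | go n
  ... | false | inj₁ z = inj₁ (trans (ℕ.+-identityʳ _) z)
  ... | false | inj₂ (l , lt , p , q) = inj₂ (l , ℕ.m≤n⇒m≤1+n lt , p , subst (λ z → z * m ≤ m + g * l) (sym (ℕ.+-identityʳ (cnt φ n))) q)
  ... | true | inj₁ z = inj₂ (n , ℕ.≤-refl , eq , subst (λ z → (z + 1) * m ≤ m + g * n) (sym z) (ℕ.≤-trans (ℕ.≤-reflexive (ℕ.+-identityʳ m)) (ℕ.m≤m+n m _)))
  ... | true | inj₂ (l , lt , p , q) = inj₂ (n , ℕ.≤-refl , eq , (begin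
      (cnt φ n + 1) * m ≡⟨ l1 (cnt φ n) m ⟩
      cnt φ n * m + m ≤⟨ ℕ.+-mono-≤ q (sep l n lt p eq) ⟩
      m + g * l + g * (n ∸ l) ≡⟨ ℕ.+-assoc m _ _ ⟩
      m + (g * l + g * (n ∸ l)) ≡⟨ cong (m ℕ.+_) (trans (sym (ℕ.*-distribˡ-+ g l _)) (cong (g *_) (ℕ.m+[n∸m]≡n (ℕ.<⇒≤ lt)))) ⟩
      m + g * n ∎))
    where
    open ℕ.≤-Reasoning
    l1 : ∀ a m → (a + 1) * m ≡ a * m + m
    l1 = NS.solve-∀
... | inj₁ z = subst (λ w → w * m ≤ m + g * n) (sym z) z≤n
... | inj₂ (l , lt , _ , q) = ℕ.≤-trans q (ℕ.+-monoʳ-≤ m (ℕ.*-monoʳ-≤ g (ℕ.<⇒≤ lt)))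

ΣL-interval : ∀ f A B → A ≤ B → (∀ Y → A ≤ Y → Y < B → 1 ≤ f Y) → B + ΣL f A ≤ A + ΣL f B
ΣL-interval f A B le h = subst (λ z → z + ΣL f A ≤ A + ΣL f z) (ℕ.m+[n∸m]≡n le) (go (B ∸ A) (ℕ.≤-reflexive (ℕ.m+[n∸m]≡n le)))
  where
  go : ∀ j → A + j ≤ B → A + j + ΣL f A ≤ A + ΣL f (A + j)
  go zero _ rewrite ℕ.+-identityʳ A = ℕ.≤-refl
  go (suc j) l rewrite ℕ.+-suc A j = subst (suc (A + j + ΣL f A) ≤_) (ℕ.+-assoc A _ _) (subst (_≤ A + ΣL f (A + j) + f (A + j)) (ℕ.+-comm _ 1)
    (ℕ.+-mono-≤ (go j (ℕ.<⇒≤ l)) (h (A + j) (ℕ.m≤m+n A j) l)))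

-- The ceiling of x / m.
cdiv : ℕ → (m : ℕ) .{{_ : NonZero m}} → ℕ
cdiv x m = (x + ℕ.pred m) ℕ./ m

module _ (x m : ℕ) .{{nz : NonZero m}} where
  private
    sp : suc (ℕ.pred m) ≡ m
    sp = ℕ.suc-pred m
    q = cdiv x m
    r = (x + ℕ.pred m) ℕ.% m
    eq : x + ℕ.pred m ≡ r + q * m
    eq = ℕM.m≡m%n+[m/n]*n (x + ℕ.pred m) m

  cdiv-upper : x ≤ m * cdiv x m
  cdiv-upper = ℕ.+-cancelˡ-≤ (ℕ.pred m) _ _ (ℕ.≤-trans (ℕ.≤-reflexive (trans (ℕ.+-comm (ℕ.pred m) x) eq))
    (ℕ.+-mono-≤ (ℕ.≤-pred (subst (suc r ≤_) (sym sp) (ℕM.m%n<n (x + ℕ.pred m) m))) (ℕ.≤-reflexive (ℕ.*-comm q m))))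

  cdiv-lower : m * cdiv x m < x + m
  cdiv-lower = ℕ.≤-trans (s≤s (ℕ.≤-trans (ℕ.≤-reflexive (ℕ.*-comm m q)) (ℕ.≤-trans (ℕ.m≤n+m _ r) (ℕ.≤-reflexive (sym eq)))))
    (ℕ.≤-reflexive (trans (sym (ℕ.+-suc x (ℕ.pred m))) (cong (x ℕ.+_) sp)))

  <cdiv : ∀ Y → m * Y < x → Y < cdiv x m
  <cdiv Y lt = ℕ.*-cancelˡ-< m Y _ (ℕ.<-≤-trans lt cdiv-upper)

  <cdiv⁻¹ : ∀ Y → Y < cdiv x m → m * Y < x
  <cdiv⁻¹ Y lt = ℕ.+-cancelˡ-< m _ _ (ℕ.≤-<-trans (ℕ.≤-trans (ℕ.≤-reflexive (sym (ℕ.*-suc m Y))) (ℕ.*-monoʳ-≤ m lt)) (subst (m * cdiv x m <_) (ℕ.+-comm x m) cdiv-lower))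

  cdiv≤ : ∀ Y → x ≤ m * Y → cdiv x m ≤ Y
  cdiv≤ Y le = ℕ.≮⇒≥ λ lt → ℕ.<⇒≱ (<cdiv⁻¹ Y lt) le

  cdiv≤⁻¹ : ∀ Y → cdiv x m ≤ Y → x ≤ m * Y
  cdiv≤⁻¹ Y le = ℕ.≮⇒≥ λ lt → ℕ.<⇒≱ (<cdiv Y lt) le

-- parity of the number of y with ε y ≤ M, for the exponents ε of a theta series
module Zones (D c₀ : ℕ) (2≤D : 2 ≤ D) (ε : ℤ → ℕ) (ε⁺ : ∀ k → ε (+ k) ≡ c₀ * (D * (k * k) + k))
             (ε⁻ : ∀ k → ε -[1+ k ] ≡ c₀ * (D * (suc k * suc k) ∸ suc k)) where

  e⁺ e⁻ : ℕ → ℕ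
  e⁺ k = c₀ * (D * (k * k) + k)
  e⁻ k = c₀ * (D * (k * k) ∸ k)

  k≤Dkk : ∀ k → k ≤ D * (k * k)
  k≤Dkk zero = z≤n
  k≤Dkk (suc k) = ℕ.≤-trans (ℕ.m≤m*n (suc k) (suc k)) (ℕ.m≤n*m _ D {{ℕ.>-nonZero (ℕ.≤-trans (s≤s z≤n) 2≤D)}})

  e⁻≤e⁺ : ∀ k → e⁻ k ≤ e⁺ k
  e⁻≤e⁺ k = ℕ.*-monoʳ-≤ c₀ (ℕ.≤-trans (ℕ.m∸n≤m _ k) (ℕ.m≤m+n _ k))

  -- Together with `e⁻≤e⁺`, this orders the integers by ε as 0, -1, 1, -2, 2, ....
  e⁺≤e⁻ : ∀ k → e⁺ k ≤ e⁻ (suc k)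
  e⁺≤e⁻ k = ℕ.*-monoʳ-≤ c₀ (ℕ.+-cancelʳ-≤ (suc k) _ _ (ℕ.≤-trans lem (ℕ.≤-reflexive (sym (ℕ.m∸n+n≡m (k≤Dkk (suc k)))))))
    where
    lem : D * (k * k) + k + suc k ≤ D * (suc k * suc k)
    lem = ℕ.≤-trans (ℕ.≤-reflexive (l1 D k)) (ℕ.≤-trans (ℕ.+-monoʳ-≤ (D * (k * k)) (ℕ.≤-trans (ℕ.m≤m+n _ 1) (ℕ.≤-trans (ℕ.≤-reflexive (l2 k)) (ℕ.*-monoˡ-≤ (k + 1) 2≤D)))) (ℕ.≤-trans (ℕ.m≤m+n _ (D * k)) (ℕ.≤-reflexive (l3 D k))))
      where
      l1 : ∀ D k → D * (k * k) + k + suc k ≡ D * (k * k) + (k + suc k)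
      l1 = NS.solve-∀
      l2 : ∀ k → k + suc k + 1 ≡ 2 * (k + 1)
      l2 = NS.solve-∀
      l3 : ∀ D k → D * (k * k) + D * (k + 1) + D * k ≡ D * (suc k * suc k)
      l3 = NS.solve-∀

  e⁺-mono : ∀ {j k} → j ≤ k → e⁺ j ≤ e⁺ k
  e⁺-mono le = ℕ.*-monoʳ-≤ c₀ (ℕ.+-mono-≤ (ℕ.*-monoʳ-≤ D (ℕ.*-mono-≤ le le)) le)

  e⁻-mono : ∀ {j k} → j ≤ k → e⁻ j ≤ e⁻ k
  e⁻-mono {j} {k} le with ℕ.m≤n⇒m<n∨m≡n le
  ... | inj₂ refl = ℕ.≤-refl
  e⁻-mono {j} {suc k} le | inj₁ (s≤s l) = ℕ.≤-trans (e⁻≤e⁺ j) (ℕ.≤-trans (e⁺-mono l) (e⁺≤e⁻ k))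

  below : ℕ → ℤ → Bool
  below M y = does (ε y ℕ.≤? M)

  private
    all : ∀ k M → e⁺ k ≤ M → ∀ y → ∣ y ∣ ≤ k → below M y ≡ true
    all k M le (+ j) l = dec-true (ε (+ j) ℕ.≤? M) (ℕ.≤-trans (ℕ.≤-reflexive (ε⁺ j)) (ℕ.≤-trans (e⁺-mono l) le))
    all k M le -[1+ j ] l = dec-true (ε -[1+ j ] ℕ.≤? M) (ℕ.≤-trans (ℕ.≤-reflexive (ε⁻ j)) (ℕ.≤-trans (e⁻≤e⁺ (suc j)) (ℕ.≤-trans (e⁺-mono l) le)))

    sum-true : ∀ k (φ : ℤ → Bool) → (∀ y → ∣ y ∣ ≤ k → φ y ≡ true) → sumZ k φ ≡ true
    sum-true zero φ h = h (+ 0) z≤n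
    sum-true (suc k) φ h = cong₂ _xor_ (sum-true k φ λ y l → h y (ℕ.m≤n⇒m≤1+n l)) (cong₂ _xor_ (h (+ suc k) ℕ.≤-refl) (h -[1+ k ] ℕ.≤-refl))

    sum-tail : ∀ k N (φ : ℤ → Bool) → k ≤ N → (∀ y → k < ∣ y ∣ → φ y ≡ false) → sumZ N φ ≡ sumZ k φ
    sum-tail k zero φ z≤n h = refl
    sum-tail k (suc N) φ le h with ℕ.m≤n⇒m<n∨m≡n le
    ... | inj₂ refl = refl
    ... | inj₁ (s≤s l) = trans (cong₂ _xor_ (sum-tail k N φ l h) (cong₂ _xor_ (h (+ suc N) (s≤s l)) (h -[1+ N ] (s≤s l)))) (xor-identityʳ _)

    none : ∀ k M → M < e⁻ (suc k) → ∀ y → k < ∣ y ∣ → below M y ≡ false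
    none k M lt (+ j) l = dec-false (ε (+ j) ℕ.≤? M) λ le → ℕ.<⇒≱ lt (ℕ.≤-trans (ℕ.≤-trans (e⁻-mono l) (e⁻≤e⁺ j)) (ℕ.≤-trans (ℕ.≤-reflexive (sym (ε⁺ j))) le))
    none k M lt -[1+ j ] l = dec-false (ε -[1+ j ] ℕ.≤? M) λ le → ℕ.<⇒≱ lt (ℕ.≤-trans (e⁻-mono l) (ℕ.≤-trans (ℕ.≤-reflexive (sym (ε⁻ j))) le))

  -- Exactly the 2 k + 1 integers with |y| ≤ k are counted.
  odd-zone : ∀ k M N → k ≤ N → e⁺ k ≤ M → M < e⁻ (suc k) → sumZ N (below M) ≡ true
  odd-zone k M N le lo hi = trans (sum-tail k N _ le (none k M hi)) (sum-true k _ (all k M lo))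

  -- Now -(k + 1) is counted too, but k + 1 is not. These zones have length 2 c₀ (k + 1), shorter
  -- than the odd ones by a factor of about `D`.
  even-zone : ∀ k M N → suc k ≤ N → e⁻ (suc k) ≤ M → M < e⁺ (suc k) → sumZ N (below M) ≡ false
  even-zone k M N le lo hi = trans (sum-tail (suc k) N _ le (none (suc k) M (ℕ.<-≤-trans hi (e⁺≤e⁻ (suc k)))))
    (cong₂ _xor_ (sum-true k _ (all k M (ℕ.≤-trans (e⁺≤e⁻ k) lo)))
      (cong₂ _xor_ (dec-false (ε (+ suc k) ℕ.≤? M) λ le → ℕ.<⇒≱ hi (ℕ.≤-trans (ℕ.≤-reflexive (sym (ε⁺ (suc k)))) le))
                   (dec-true (ε -[1+ k ] ℕ.≤? M) (ℕ.≤-trans (ℕ.≤-reflexive (ε⁻ k)) lo))))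

private
  cnt-0 : ∀ φ n → cnt φ n ≡ 0 → ∀ x → x < n → φ x ≡ false
  cnt-0 φ (suc n) e x lt with ℕ.m≤n⇒m<n∨m≡n (ℕ.≤-pred lt)
  ... | inj₁ l = cnt-0 φ n (ℕ.m+n≡0⇒m≡0 _ e) x l
  ... | inj₂ refl = b (φ x) (ℕ.m+n≡0⇒n≡0 (cnt φ x) e)
    where
    b : ∀ c → bit c ≡ 0 → c ≡ false
    b false _ = refl

least : ∀ (P : ℕ → Set) → (∀ n → Dec (P n)) → ¬ P 0 → ∀ n → P n → ∃ λ j → ¬ P j × P (suc j)
least P d ¬0 zero p = ⊥-elim (¬0 p)
least P d ¬0 (suc n) p with d n
... | yes q = least P d ¬0 n q
... | no ¬q = n , ¬q , p

-- Many zeros of G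

module Count (D c₀ g₀ : ℕ) (12≤D : 12 ≤ D) (0<c₀ : 0 < c₀) (0<g₀ : 0 < g₀) (ε : ℤ → ℕ)
  (ε⁺ : ∀ k → ε (+ k) ≡ c₀ * (D * (k * k) + k)) (ε⁻ : ∀ k → ε -[1+ k ] ≡ c₀ * (D * (suc k * suc k) ∸ suc k))
  (ε-big : ∀ y → ∣ y ∣ ≤ ε y) (G : Ser) where

  private
    2≤D : 2 ≤ D
    2≤D = ℕ.≤-trans (ℕ.m≤m+n 2 10) 12≤D
    instance
      nzD : NonZero D
      nzD = ℕ.>-nonZero (ℕ.≤-trans (s≤s z≤n) 2≤D)
      nzc : NonZero c₀
      nzc = ℕ.>-nonZero 0<c₀

  open Zones D c₀ 2≤D ε ε⁺ ε⁻

  -- Measured in Y, the k-th even zone of m₁ Y has length about 2 c₀ k / m₁, and there a full period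
  -- of the zones of m₂ Y has length about 2 c₀ D k / √(m₁ m₂). If m₂ / m₁ ≥ (4 D)², the second is
  -- at most a quarter of the first, so a whole odd zone fits.
  ρ : ℕ
  ρ = 16 * (D * D)

  module _ (m₁ m₂ : ℕ) .{{nz₁ : NonZero m₁}} .{{nz₂ : NonZero m₂}}
    (sep₁ : ∀ e y d → m₁ ∣ e + ε y → m₁ ∣ e + ε (y ℤ.+ + d) → m₁ ∣ g₀ * d)
    (sep₂ : ∀ e y d → m₂ ∣ e + ε y → m₂ ∣ e + ε (y ℤ.+ + d) → m₂ ∣ g₀ * d)
    (lo : ρ * m₁ ≤ m₂) (hi : m₂ < 2 * (ρ * m₁)) (per : U m₁ (G ⊗ Gen 0 ε (λ _ → true)) ≈ U m₂ (G ⊗ Gen 0 ε (λ _ → true)))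
    (K : ℕ) .{{nzK : NonZero K}} (K-large : 2 * m₂ ≤ c₀ * (D * K)) (K-large′ : m₂ ≤ g₀ * (D * K)) where

    -- Bounds m₂ Y on the range of Y in use. There m₁ Y is at most about e⁺ (2 K), and m₂ < 2 ρ m₁,
    -- which gives the main term 8 ρ c₀ D K²; the rest is for lower order terms.
    X : ℕ
    X = 10 * (ρ * (c₀ * (D * (K * K))))

    badcount : ℕ
    badcount = cnt (λ e → not (G e)) X

    private
      Rr : ℕ
      Rr = suc (2 * (18 * (D * K)))
      -- Only |y| ≤ R matter: `X` is 160 c₀ D³ K², while ε y is about c₀ D y², and 18² = 324 exceeds
      -- 160 with room for the linear term.
      R : ℕ
      R = 18 * (D * K)

      pos : ℕ → ℤ
      pos x = + x ℤ.- + R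

      -- The y whose contribution to the coefficient of G h at `M` differs from the one for the
      -- constant G = 1.
      bad : ℕ → ℤ → Bool
      bad M y = below M y ∧ not (G (M ∸ ε y))

      hc : ℕ → ℕ → ℕ
      hc m Y = cnt (λ x → bad (m * Y) (pos x)) Rr

      e⁻-pos : ∀ k → suc k ≤ e⁻ (suc k)
      e⁻-pos k = ℕ.≤-trans (ℕ.m+n≤o⇒m≤o∸n (suc k) (ℕ.≤-trans (ℕ.≤-reflexive (l (suc k))) (ℕ.*-mono-≤ 2≤D (ℕ.m≤m*n (suc k) (suc k))))) (ℕ.m≤n*m _ c₀)
        where
        l : ∀ k → k + k ≡ 2 * k
        l = NS.solve-∀

      far : X ≤ e⁻ (suc R)
      far = ℕ.≤-trans (ℕ.≤-reflexive (l0 c₀ D K)) (ℕ.*-monoʳ-≤ c₀ (ℕ.m+n≤o⇒m≤o∸n _ (ℕ.≤-trans (ℕ.+-monoʳ-≤ (160 * (D * D * (D * (K * K)))) one) (ℕ.≤-trans (ℕ.m≤m+n _ _) (ℕ.≤-reflexive (l2 D K))))))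
        where
        l0 : ∀ c D K → 10 * (16 * (D * D) * (c * (D * (K * K)))) ≡ c * (160 * (D * D * (D * (K * K))))
        l0 = NS.solve-∀
        one : suc R ≤ D * suc R
        one = ℕ.m≤n*m (suc R) D
        l2 : ∀ D K → 160 * (D * D * (D * (K * K))) + D * suc (18 * (D * K)) + (164 * (D * D * (D * (K * K))) + 18 * (D * D * K)) ≡ D * (suc (18 * (D * K)) * suc (18 * (D * K)))
        l2 = NS.solve-∀

      no-hit : ∀ m Y → m * Y < X → hc m Y ≡ 0 → ∀ y → bad (m * Y) y ≡ false
      no-hit m Y lt z y with ∣ y ∣ ℕ.≤? R
      ... | yes le = let (x , x< , e) = index y le in trans (cong (bad (m * Y)) e) (cnt-0 _ Rr z x x<)
        where
        index : ∀ y → ∣ y ∣ ≤ R → ∃ λ x → x < Rr × y ≡ pos x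
        index (+ j) l = j + R , s≤s (ℕ.≤-trans (ℕ.+-monoˡ-≤ R l) (ℕ.≤-reflexive (cong (R ℕ.+_) (sym (ℕ.+-identityʳ R))))) , trans (l1 (+ j) (+ R)) (cong (λ z → z ℤ.- + R) (sym (ℤ.pos-+ j R)))
          where
          l1 : ∀ j R → j ≡ j ℤ.+ R ℤ.- R
          l1 = ZS.solve-∀
        index -[1+ j ] l = R ∸ suc j , s≤s (ℕ.≤-trans (ℕ.m∸n≤m R (suc j)) (ℕ.m≤m+n R _)) , sym (trans (cong (λ z → z ℤ.- + R) (trans (sym (ℤ.⊖-≥ l)) (sym (ℤ.m-n≡m⊖n R (suc j))))) (l2 (+ R) (+ suc j)))
          where
          l2 : ∀ R j → R ℤ.- j ℤ.- R ≡ ℤ.- j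
          l2 = ZS.solve-∀
      ... | no ¬le = cong (_∧ not (G (m * Y ∸ ε y))) (dec-false (ε y ℕ.≤? m * Y) λ q → ℕ.<⇒≱ lt (ℕ.≤-trans (ℕ.≤-trans far (beyond y (ℕ.≰⇒> ¬le))) q))
        where
        beyond : ∀ y → R < ∣ y ∣ → e⁻ (suc R) ≤ ε y
        beyond (+ j) l = ℕ.≤-trans (e⁻-mono l) (ℕ.≤-trans (e⁻≤e⁺ j) (ℕ.≤-reflexive (sym (ε⁺ j))))
        beyond -[1+ j ] l = ℕ.≤-trans (e⁻-mono l) (ℕ.≤-reflexive (sym (ε⁻ j)))

      Vs : Ser
      Vs = G ⊗ Gen 0 ε (λ _ → true)

      V-at : ∀ M → (∀ y → bad M y ≡ false) → Vs M ≡ sumZ M (below M)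
      V-at M h = trans (at (R.*-comm G (Gen 0 ε (λ _ → true))) M) (trans (Gen-⊗-at 0 ε (λ _ → true) G M (λ y _ → ε-big y)) (sumZ-cong M λ y _ → term y (h y)))
        where
        term : ∀ y → bad M y ≡ false → (mono (ε y) ⊗ G) M ≡ below M y
        term y b with ε y ℕ.≤? M
        ... | no ¬le = trans (mono-⊗-lo (ε y) G M (ℕ.≰⇒> ¬le)) (sym (dec-false (ε y ℕ.≤? M) ¬le))
        ... | yes le = trans (trans (subst (λ z → (mono (ε y) ⊗ G) M ≡ (mono (ε y) ⊗ G) z) (sym (ℕ.m+[n∸m]≡n le)) refl) (mono-⊗-hi (ε y) G (M ∸ ε y)))
              (trans (g (G (M ∸ ε y)) (trans (cong (_∧ not (G (M ∸ ε y))) (sym (dec-true (ε y ℕ.≤? M) le))) b)) (sym (dec-true (ε y ℕ.≤? M) le)))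
          where
          g : ∀ c → true ∧ not c ≡ false → c ≡ true
          g true _ = refl

      f : ℕ → ℕ
      f Y = hc m₁ Y + hc m₂ Y

      -- With no bad y at either place, the equal coefficients at m₁ Y and m₂ Y would be the
      -- parities of two zones, one even and one odd.
      good : ∀ k k₂ Y → e⁻ (suc k) ≤ m₁ * Y → m₁ * Y < e⁺ (suc k) → e⁺ k₂ ≤ m₂ * Y → m₂ * Y < e⁻ (suc k₂)
        → m₁ * Y < X → m₂ * Y < X → 1 ≤ f Y
      good k k₂ Y a b c d x₁ x₂ with f Y in eq
      ... | suc _ = s≤s z≤n
      ... | zero with trans (sym (trans (V-at (m₁ * Y) (no-hit m₁ Y x₁ (ℕ.m+n≡0⇒m≡0 _ eq))) (even-zone k _ _ (ℕ.≤-trans (e⁻-pos k) a) a b)))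
                    (trans (at per Y) (trans (V-at (m₂ * Y) (no-hit m₂ Y x₂ (ℕ.m+n≡0⇒n≡0 (hc m₁ Y) eq))) (odd-zone k₂ _ _ (ℕ.≤-trans k₂≤ c) c d)))
        where
        k₂≤ : k₂ ≤ e⁺ k₂
        k₂≤ = ℕ.≤-trans (ℕ.m≤n+m k₂ _) (ℕ.m≤n*m _ c₀)
      ... | ()

      1≤ρ : 1 ≤ ρ
      1≤ρ = ℕ.≤-trans (ℕ.*-mono-≤ (ℕ.≤-trans (s≤s z≤n) 12≤D) (ℕ.≤-trans (s≤s z≤n) 12≤D)) (ℕ.m≤n*m _ 16)

      m₁<m₂ : m₁ < m₂
      m₁<m₂ = ℕ.<-≤-trans (ℕ.m<m+n m₁ (ℕ.>-nonZero⁻¹ m₁)) (ℕ.≤-trans (ℕ.≤-trans (ℕ.≤-reflexive (cong (m₁ ℕ.+_) (sym (ℕ.+-identityʳ m₁)))) (ℕ.*-monoˡ-≤ m₁ (ℕ.≤-trans (ℕ.≤-trans 2≤D (ℕ.m≤m*n D D)) (ℕ.m≤n*m _ 16)))) lo)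

      -- the one-zone of m₂ Y following the start of the k-th zero-zone of m₁ Y is contained in it
      module Interval (k' : ℕ) where
        k = suc k'
        P : ℕ → Set
        P j = m₂ * e⁻ k ≤ m₁ * e⁺ j
        ¬P0 : ¬ P 0
        ¬P0 p = ℕ.<⇒≱ (ℕ.*-mono-< (ℕ.>-nonZero⁻¹ m₂) (ℕ.≤-trans (s≤s z≤n) (e⁻-pos k'))) (ℕ.≤-trans p (ℕ.≤-reflexive (trans (cong (λ z → m₁ * (c₀ * z)) (trans (ℕ.+-identityʳ _) (ℕ.*-zeroʳ D))) (trans (cong (m₁ *_) (ℕ.*-zeroʳ c₀)) (ℕ.*-zeroʳ m₁)))))
        Pbig : P (m₂ * k)
        Pbig = ℕ.≤-trans (ℕ.*-monoʳ-≤ m₂ (e⁻≤e⁺ k)) (ℕ.≤-trans (ℕ.≤-trans (ℕ.≤-reflexive (l1 m₂ c₀ D k)) (ℕ.*-monoʳ-≤ c₀ (ℕ.+-mono-≤ (ℕ.*-monoʳ-≤ D (ℕ.≤-trans (ℕ.m≤n*m _ m₂) (ℕ.≤-reflexive (l2 m₂ k)))) ℕ.≤-refl))) (ℕ.m≤n*m _ m₁))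
          where
          l1 : ∀ m c D k → m * (c * (D * (k * k) + k)) ≡ c * (D * (m * (k * k)) + m * k)
          l1 = NS.solve-∀
          l2 : ∀ m k → m * (m * (k * k)) ≡ m * k * (m * k)
          l2 = NS.solve-∀
        found : ∃ λ j → ¬ P j × P (suc j)
        found = least P (λ j → m₂ * e⁻ k ℕ.≤? m₁ * e⁺ j) ¬P0 (m₂ * k) Pbig
        k₃ = proj₁ found
        k₂ = suc k₃
        p : m₂ * e⁻ k ≤ m₁ * e⁺ k₂
        p = proj₂ (proj₂ found)
        -- the failure at k₃, divided by c₀
        q : m₁ * (D * (k₃ * k₃) + k₃) + m₂ * k < m₂ * (D * (k * k))
        q = ℕ.<-≤-trans (ℕ.+-monoˡ-< (m₂ * k) (ℕ.*-cancelˡ-< c₀ _ _ (subst₂ _<_ (sw m₁ c₀ _) (sw m₂ c₀ _) (ℕ.≰⇒> (proj₁ (proj₂ found))))))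
          (ℕ.≤-reflexive (trans (sym (ℕ.*-distribˡ-+ m₂ _ k)) (cong (m₂ *_) (ℕ.m∸n+n≡m (k≤Dkk k)))))
          where
          sw : ∀ m c z → m * (c * z) ≡ c * (m * z)
          sw = NS.solve-∀
        q′ : m₁ * (k₃ * k₃) < m₂ * (k * k)
        q′ = ℕ.*-cancelˡ-< D _ _ (ℕ.≤-<-trans (ℕ.≤-trans (ℕ.≤-reflexive (sw D m₁ _)) (ℕ.≤-trans (ℕ.*-monoʳ-≤ m₁ (ℕ.m≤m+n _ k₃)) (ℕ.m≤m+n _ _))) (ℕ.<-≤-trans q (ℕ.≤-reflexive (sw m₂ D _))))
          where
          sw : ∀ m c z → m * (c * z) ≡ c * (m * z)
          sw = NS.solve-∀
        -- The size of `ρ` enters here. Otherwise m₂ k < 2 D k₂ m₁ ≤ 4 D k₃ m₁, whose square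
        -- contradicts m₁ k₃² < m₂ k² and m₂ ≥ 16 D² m₁. For k₃ = 0 the step k₂ ≤ 2 k₃ fails, and m₂
        -- ≥ ρ m₁ is used directly.
        star : 2 * (D * (k₂ * m₁)) ≤ m₂ * k
        star = ℕ.≮⇒≥ (contra k₃ q′)
          where
          contra : ∀ j → m₁ * (j * j) < m₂ * (k * k) → m₂ * k < 2 * (D * (suc j * m₁)) → ⊥
          contra zero _ lt = ℕ.<⇒≱ lt (ℕ.≤-trans (ℕ.≤-trans (ℕ.≤-trans (ℕ.≤-reflexive (l D m₁)) (ℕ.*-monoˡ-≤ m₁ (ℕ.*-mono-≤ (ℕ.m≤m+n 2 14) (ℕ.m≤m*n D D)))) lo) (ℕ.m≤m*n m₂ k))
            where
            l : ∀ D m → 2 * (D * (1 * m)) ≡ 2 * D * m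
            l = NS.solve-∀
          contra (suc j) small lt = ℕ.<-irrefl refl (begin-strict
            m₂ * k * (m₂ * k) <⟨ ℕ.*-mono-< lt₂ lt₂ ⟩
            4 * (D * (suc j * m₁)) * (4 * (D * (suc j * m₁))) ≡⟨ l1 D (suc j) m₁ ⟩
            16 * (D * D) * m₁ * (m₁ * (suc j * suc j)) ≤⟨ ℕ.*-mono-≤ lo (ℕ.<⇒≤ small) ⟩
            m₂ * (m₂ * (k * k)) ≡⟨ l2 m₂ k ⟩
            m₂ * k * (m₂ * k) ∎)
            where
            open ℕ.≤-Reasoning
            lt₂ : m₂ * k < 4 * (D * (suc j * m₁))
            lt₂ = ℕ.<-≤-trans lt (ℕ.≤-trans (ℕ.*-monoʳ-≤ 2 (ℕ.*-monoʳ-≤ D (ℕ.*-monoˡ-≤ m₁ (ℕ.≤-trans (s≤s (ℕ.m≤n+m (suc j) j)) (ℕ.≤-reflexive (l3 j)))))) (ℕ.≤-reflexive (l4 D (suc j) m₁)))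
              where
              l3 : ∀ j → suc (j + suc j) ≡ 2 * suc j
              l3 = NS.solve-∀
              l4 : ∀ D j m → 2 * (D * (2 * j * m)) ≡ 4 * (D * (j * m))
              l4 = NS.solve-∀
            l1 : ∀ D j m → 4 * (D * (j * m)) * (4 * (D * (j * m))) ≡ 16 * (D * D) * m * (m * (j * j))
            l1 = NS.solve-∀
            l2 : ∀ m k → m * (m * (k * k)) ≡ m * k * (m * k)
            l2 = NS.solve-∀
        -- D (k₃ + 2)² exceeds D k₃² by 4 D k₂, and by `star` m₁ times this is at most 2 m₂ k, the
        -- length of the even zone up to the factor c₀ m₂.
        upper : m₁ * e⁻ (suc k₂) ≤ m₂ * e⁺ k
        upper = begin
          m₁ * (c₀ * (D * (suc k₂ * suc k₂) ∸ suc k₂)) ≤⟨ ℕ.*-monoʳ-≤ m₁ (ℕ.*-monoʳ-≤ c₀ (ℕ.m∸n≤m _ (suc k₂))) ⟩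
          m₁ * (c₀ * (D * (suc k₂ * suc k₂))) ≡⟨ l1 m₁ c₀ D k₃ ⟩
          c₀ * (m₁ * (D * (k₃ * k₃)) + 2 * (2 * (D * (k₂ * m₁)))) ≤⟨ ℕ.*-monoʳ-≤ c₀ (ℕ.+-mono-≤ (ℕ.*-monoʳ-≤ m₁ (ℕ.m≤m+n _ k₃)) (ℕ.*-monoʳ-≤ 2 star)) ⟩
          c₀ * (m₁ * (D * (k₃ * k₃) + k₃) + 2 * (m₂ * k)) ≡⟨ l2 c₀ (m₁ * (D * (k₃ * k₃) + k₃)) (m₂ * k) ⟩
          c₀ * (m₁ * (D * (k₃ * k₃) + k₃) + m₂ * k + m₂ * k) ≤⟨ ℕ.*-monoʳ-≤ c₀ (ℕ.+-monoˡ-≤ (m₂ * k) (ℕ.<⇒≤ q)) ⟩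
          c₀ * (m₂ * (D * (k * k)) + m₂ * k) ≡⟨ l3 c₀ m₂ (D * (k * k)) k ⟩
          m₂ * e⁺ k ∎
          where
          open ℕ.≤-Reasoning
          l1 : ∀ m c D j → m * (c * (D * (suc (suc j) * suc (suc j)))) ≡ c * (m * (D * (j * j)) + 2 * (2 * (D * (suc j * m))))
          l1 = NS.solve-∀
          l2 : ∀ c x y → c * (x + 2 * y) ≡ c * (x + y + y)
          l2 = NS.solve-∀
          l3 : ∀ c m x k → c * (m * x + m * k) ≡ m * (c * (x + k))
          l3 = NS.solve-∀
        k≤k₂ : k ≤ k₂
        k≤k₂ = ℕ.≮⇒≥ λ lt → ℕ.<⇒≱ (ℕ.*-monoˡ-< (e⁻ k) {{ℕ.>-nonZero (ℕ.≤-trans (s≤s z≤n) (e⁻-pos k'))}} m₁<m₂)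
          (ℕ.≤-trans p (ℕ.*-monoʳ-≤ m₁ (ℕ.≤-trans (e⁺≤e⁻ k₂) (e⁻-mono lt))))
        A B : ℕ
        A = cdiv (e⁺ k₂) m₂
        B = cdiv (e⁻ (suc k₂)) m₂
        gap : e⁺ k₂ + c₀ * (D * k) ≤ e⁻ (suc k₂)
        gap = ℕ.≤-trans (ℕ.+-monoʳ-≤ (e⁺ k₂) (ℕ.*-monoʳ-≤ c₀ (ℕ.*-monoʳ-≤ D k≤k₂))) (ℕ.≤-trans (ℕ.≤-reflexive (sym (ℕ.*-distribˡ-+ c₀ _ _)))
          (ℕ.*-monoʳ-≤ c₀ (ℕ.m+n≤o⇒m≤o∸n _ (ℕ.≤-trans (ℕ.≤-reflexive (l1 D k₂)) (ℕ.≤-trans (ℕ.+-monoʳ-≤ (D * (k₂ * k₂) + D * k₂) (ℕ.≤-trans (ℕ.n≤1+n _) (ℕ.≤-trans (ℕ.≤-reflexive (l2 k₂)) (ℕ.*-monoˡ-≤ (suc k₂) 2≤D)))) (ℕ.≤-reflexive (l3 D k₂)))))))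
          where
          l1 : ∀ D j → D * (j * j) + j + D * j + suc j ≡ D * (j * j) + D * j + suc (j + j)
          l1 = NS.solve-∀
          l2 : ∀ j → suc (suc (j + j)) ≡ 2 * suc j
          l2 = NS.solve-∀
          l3 : ∀ D j → D * (j * j) + D * j + D * suc j ≡ D * (suc j * suc j)
          l3 = NS.solve-∀
        long : m₂ * A + c₀ * (D * k) ≤ m₂ * B + m₂
        long = begin
          m₂ * A + c₀ * (D * k) ≤⟨ ℕ.+-monoˡ-≤ _ (ℕ.<⇒≤ (cdiv-lower (e⁺ k₂) m₂)) ⟩
          e⁺ k₂ + m₂ + c₀ * (D * k) ≡⟨ l (e⁺ k₂) m₂ _ ⟩
          e⁺ k₂ + c₀ * (D * k) + m₂ ≤⟨ ℕ.+-monoˡ-≤ m₂ (ℕ.≤-trans gap (cdiv-upper (e⁻ (suc k₂)) m₂)) ⟩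
          m₂ * B + m₂ ∎
          where
          open ℕ.≤-Reasoning
          l : ∀ a b c → a + b + c ≡ a + c + b
          l = NS.solve-∀
        zone : ∀ Y → A ≤ Y → Y < B → e⁻ k ≤ m₁ * Y × m₁ * Y < e⁺ k × e⁺ k₂ ≤ m₂ * Y × m₂ * Y < e⁻ (suc k₂)
        zone Y a b = ℕ.*-cancelˡ-≤ m₂ (ℕ.≤-trans p (ℕ.≤-trans (ℕ.*-monoʳ-≤ m₁ lo₂) (ℕ.≤-reflexive (sw m₁ m₂ Y))))
          , ℕ.*-cancelˡ-< m₂ _ _ (ℕ.≤-<-trans (ℕ.≤-reflexive (sw m₂ m₁ Y)) (ℕ.<-≤-trans (ℕ.*-monoʳ-< m₁ hi₂) upper)) , lo₂ , hi₂
          where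
          sw : ∀ m c z → m * (c * z) ≡ c * (m * z)
          sw = NS.solve-∀
          lo₂ = cdiv≤⁻¹ (e⁺ k₂) m₂ Y a
          hi₂ = <cdiv⁻¹ (e⁻ (suc k₂)) m₂ Y b

      -- The first Y past the k-th even zone of m₁ Y; between two consecutive values lies one even
      -- zone.
      n : ℕ → ℕ
      n k = cdiv (e⁺ k) m₁

      top : 2 * (ρ * (e⁺ (2 * K) + m₁)) ≤ X
      top = begin
        2 * (ρ * (c₀ * (D * (2 * K * (2 * K)) + 2 * K) + m₁)) ≡⟨ l1 ρ c₀ D K m₁ ⟩
        8 * (ρ * (c₀ * (D * (K * K)))) + ρ * (4 * (c₀ * K) + 2 * m₁) ≤⟨ ℕ.+-monoʳ-≤ (8 * (ρ * (c₀ * (D * (K * K))))) (ℕ.*-monoʳ-≤ ρ slack) ⟩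
        8 * (ρ * (c₀ * (D * (K * K)))) + ρ * (2 * (c₀ * (D * (K * K)))) ≡⟨ l2 ρ (c₀ * (D * (K * K))) ⟩
        X ∎
        where
        open ℕ.≤-Reasoning
        l1 : ∀ r c D K m → 2 * (r * (c * (D * (2 * K * (2 * K)) + 2 * K) + m)) ≡ 8 * (r * (c * (D * (K * K)))) + r * (4 * (c * K) + 2 * m)
        l1 = NS.solve-∀
        l2 : ∀ r z → 8 * (r * z) + r * (2 * z) ≡ 10 * (r * z)
        l2 = NS.solve-∀
        l3 : ∀ c K → 4 * (c * K) ≡ c * (4 * K)
        l3 = NS.solve-∀
        l4 : ∀ z → z + z ≡ 2 * z
        l4 = NS.solve-∀
        DK≤ : D * K ≤ D * (K * K)
        DK≤ = ℕ.*-monoʳ-≤ D (ℕ.m≤m*n K K)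
        slack : 4 * (c₀ * K) + 2 * m₁ ≤ 2 * (c₀ * (D * (K * K)))
        slack = ℕ.≤-trans (ℕ.+-mono-≤ (ℕ.≤-trans (ℕ.≤-reflexive (l3 c₀ K)) (ℕ.*-monoʳ-≤ c₀ (ℕ.≤-trans (ℕ.*-monoˡ-≤ K (ℕ.≤-trans (ℕ.m≤m+n 4 8) 12≤D)) DK≤)))
          (ℕ.≤-trans (ℕ.*-monoʳ-≤ 2 (ℕ.<⇒≤ m₁<m₂)) (ℕ.≤-trans K-large (ℕ.*-monoʳ-≤ c₀ DK≤)))) (ℕ.≤-reflexive (l4 (c₀ * (D * (K * K)))))

      2ρm : ∀ Y → m₂ * Y ≤ 2 * (ρ * (m₁ * Y))
      2ρm Y = ℕ.≤-trans (ℕ.*-monoˡ-≤ Y (ℕ.<⇒≤ hi)) (ℕ.≤-reflexive (l ρ m₁ Y))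
        where
        l : ∀ r m Y → 2 * (r * m) * Y ≡ 2 * (r * (m * Y))
        l = NS.solve-∀

      T : ℕ
      T = n (2 * K)

      m₁T : m₁ * T ≤ e⁺ (2 * K) + m₁
      m₁T = ℕ.<⇒≤ (cdiv-lower (e⁺ (2 * K)) m₁)

      T₂ : m₂ * T ≤ X
      T₂ = ℕ.≤-trans (2ρm T) (ℕ.≤-trans (ℕ.*-monoʳ-≤ 2 (ℕ.*-monoʳ-≤ ρ m₁T)) top)

      T₁ : m₁ * T ≤ X
      T₁ = ℕ.≤-trans (ℕ.*-monoˡ-≤ T (ℕ.<⇒≤ m₁<m₂)) T₂

      below-X : ∀ m .{{_ : NonZero m}} Y → m * T ≤ X → Y < T → m * Y < X
      below-X m Y le lt = ℕ.<-≤-trans (ℕ.*-monoʳ-< m lt) le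

      Pf : ℕ → ℕ
      Pf k = ΣL f (n k)

      -- The interval [A, B) lies between `n k'` and `n (suc k')`, so different zones count
      -- different Y. Rounding its ends costs one `m₂`.
      growth : ∀ k' → K ≤ suc k' → suc k' ≤ 2 * K → c₀ * (D * suc k') + m₂ * Pf k' ≤ m₂ * Pf (suc k') + m₂
      growth k' Kk k2K = ℕ.+-cancelˡ-≤ (m₂ * A) _ _ (begin
        m₂ * A + (c₀ * (D * suc k') + m₂ * Pf k') ≡⟨ sym (ℕ.+-assoc (m₂ * A) _ _) ⟩
        m₂ * A + c₀ * (D * suc k') + m₂ * Pf k' ≤⟨ ℕ.+-mono-≤ long (ℕ.*-monoʳ-≤ m₂ (ΣL-mono f nA)) ⟩
        m₂ * B + m₂ + m₂ * ΣL f A ≡⟨ l1 m₂ B (ΣL f A) ⟩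
        m₂ * (B + ΣL f A) + m₂ ≤⟨ ℕ.+-monoˡ-≤ m₂ (ℕ.*-monoʳ-≤ m₂ (ΣL-interval f A B (ℕ.<⇒≤ A<B) ones)) ⟩
        m₂ * (A + ΣL f B) + m₂ ≤⟨ ℕ.+-monoˡ-≤ m₂ (ℕ.*-monoʳ-≤ m₂ (ℕ.+-monoʳ-≤ A (ΣL-mono f Bn))) ⟩
        m₂ * (A + Pf (suc k')) + m₂ ≡⟨ l2 m₂ A (Pf (suc k')) ⟩
        m₂ * A + (m₂ * Pf (suc k') + m₂) ∎)
        where
        open ℕ.≤-Reasoning
        open Interval k' using (A; B; long; zone; k₂)
        l1 : ∀ m b s → m * b + m + m * s ≡ m * (b + s) + m
        l1 = NS.solve-∀
        l2 : ∀ m a s → m * (a + s) + m ≡ m * a + (m * s + m)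
        l2 = NS.solve-∀
        m₂< : m₂ < c₀ * (D * suc k')
        m₂< = ℕ.<-≤-trans (ℕ.<-≤-trans (ℕ.m<m+n m₂ (ℕ.>-nonZero⁻¹ m₂)) (ℕ.≤-trans (ℕ.≤-reflexive (cong (m₂ ℕ.+_) (sym (ℕ.+-identityʳ m₂)))) K-large)) (ℕ.*-monoʳ-≤ c₀ (ℕ.*-monoʳ-≤ D Kk))
        A<B : A < B
        A<B = ℕ.*-cancelˡ-< m₂ A B (ℕ.+-cancelʳ-< m₂ _ _ (ℕ.<-≤-trans (ℕ.+-monoʳ-< (m₂ * A) m₂<) long))
        nA : n k' ≤ A
        nA = cdiv≤ (e⁺ k') m₁ A (ℕ.≤-trans (e⁺≤e⁻ k') (proj₁ (zone A ℕ.≤-refl A<B)))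
        Bn : B ≤ n (suc k')
        -- B - 1 is the last Y of the interval, hence still inside the even zone.
        Bn = subst (_≤ n (suc k')) (ℕ.suc-pred B {{ℕ.>-nonZero (ℕ.≤-trans (s≤s z≤n) A<B)}}) (<cdiv (e⁺ (suc k')) m₁ (ℕ.pred B)
          (proj₁ (proj₂ (zone (ℕ.pred B) (ℕ.≤-pred (subst (suc A ≤_) (sym (ℕ.suc-pred B {{ℕ.>-nonZero (ℕ.≤-trans (s≤s z≤n) A<B)}})) A<B))
            (ℕ.≤-reflexive (ℕ.suc-pred B {{ℕ.>-nonZero (ℕ.≤-trans (s≤s z≤n) A<B)}}))))))
        nT : n (suc k') ≤ T
        nT = cdiv≤ (e⁺ (suc k')) m₁ T (ℕ.≤-trans (e⁺-mono k2K) (cdiv-upper (e⁺ (2 * K)) m₁))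
        ones : ∀ Y → A ≤ Y → Y < B → 1 ≤ f Y
        ones Y a b = let (z1 , z2 , z3 , z4) = zone Y a b ; Y<T = ℕ.<-≤-trans b (ℕ.≤-trans Bn nT) in
          good k' k₂ Y z1 z2 z3 z4 (below-X m₁ Y T₁ Y<T) (below-X m₂ Y T₂ Y<T)

      total : ∀ j → j ≤ K → j * (c₀ * (D * K)) + m₂ * Pf K ≤ m₂ * Pf (K + j) + j * m₂
      total zero _ = ℕ.≤-reflexive (trans (cong (λ z → m₂ * Pf z) (sym (ℕ.+-identityʳ K))) (sym (ℕ.+-identityʳ _)))
      total (suc j) le rewrite ℕ.+-suc K j = begin
        c₀ * (D * K) + j * (c₀ * (D * K)) + m₂ * Pf K ≡⟨ ℕ.+-assoc (c₀ * (D * K)) _ _ ⟩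
        c₀ * (D * K) + (j * (c₀ * (D * K)) + m₂ * Pf K) ≤⟨ ℕ.+-mono-≤ (ℕ.*-monoʳ-≤ c₀ (ℕ.*-monoʳ-≤ D K≤)) (total j (ℕ.<⇒≤ le)) ⟩
        c₀ * (D * suc (K + j)) + (m₂ * Pf (K + j) + j * m₂) ≡⟨ sym (ℕ.+-assoc (c₀ * (D * suc (K + j))) _ _) ⟩
        c₀ * (D * suc (K + j)) + m₂ * Pf (K + j) + j * m₂ ≤⟨ ℕ.+-monoˡ-≤ (j * m₂) (growth (K + j) K≤ 2K) ⟩
        m₂ * Pf (suc (K + j)) + m₂ + j * m₂ ≡⟨ ℕ.+-assoc (m₂ * Pf (suc (K + j))) m₂ (j * m₂) ⟩
        m₂ * Pf (suc (K + j)) + (m₂ + j * m₂) ∎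
        where
        open ℕ.≤-Reasoning
        K≤ : K ≤ suc (K + j)
        K≤ = ℕ.≤-trans (ℕ.m≤m+n K j) (ℕ.n≤1+n _)
        2K : suc (K + j) ≤ 2 * K
        2K = ℕ.≤-trans (ℕ.≤-reflexive (sym (ℕ.+-suc K j))) (ℕ.≤-trans (ℕ.+-monoʳ-≤ K le) (ℕ.≤-reflexive (cong (K ℕ.+_) (sym (ℕ.+-identityʳ K)))))

      -- pairs (Y, y) with a hit correspond to pairs (e, y) with G e = 0 and m ∣ e + ε y
      hits : ∀ m .{{_ : NonZero m}} → (∀ e y d → m ∣ e + ε y → m ∣ e + ε (y ℤ.+ + d) → m ∣ g₀ * d) → m * T ≤ X
        → ΣL (hc m) T * m ≤ badcount * (m + g₀ * Rr)
      hits m sep le = begin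
        ΣL (hc m) T * m ≡⟨ cong (ℕ._* m) (ΣL-swap (λ Y x → bit (bad (m * Y) (pos x))) T Rr) ⟩
        ΣL (λ x → cnt (λ Y → bad (m * Y) (pos x)) T) Rr * m ≤⟨ ℕ.*-monoˡ-≤ m (ΣL-≤ Rr λ x _ → per-x x) ⟩
        ΣL (λ x → cnt (ψ' x) X) Rr * m ≡⟨ cong (ℕ._* m) (ΣL-swap (λ x e → bit (ψ' x e)) Rr X) ⟩
        ΣL (λ e → cnt (λ x → ψ' x e) Rr) X * m ≡⟨ ΣL-* _ m X ⟩
        ΣL (λ e → cnt (λ x → ψ' x e) Rr * m) X ≤⟨ ΣL-≤ X (λ e _ → per-e e) ⟩
        ΣL (λ e → bit (not (G e)) * (m + g₀ * Rr)) X ≡⟨ sym (ΣL-* _ (m + g₀ * Rr) X) ⟩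
        badcount * (m + g₀ * Rr) ∎
        where
        open ℕ.≤-Reasoning
        ψ' : ℕ → ℕ → Bool
        ψ' x e = not (G e) ∧ does (m ∣? (e + ε (pos x)))
        per-x : ∀ x → cnt (λ Y → bad (m * Y) (pos x)) T ≤ cnt (ψ' x) X
        per-x x = ℕ.≤-trans (cnt-progression m (ε (pos x)) _ (ψ' x) T λ Y t → let (a , b) = ∧-elim {below (m * Y) (pos x)} t ; le = does-true (ε (pos x) ℕ.≤? m * Y) a in
          le , cong₂ _∧_ b (dec-true (m ∣? _) (subst (m ∣_) (sym (ℕ.m∸n+n≡m le)) (ND.m∣m*n Y)))) (ΣL-mono _ (ℕ.≤-trans (ℕ.m∸n≤m _ (ε (pos x))) le))
        per-e : ∀ e → cnt (λ x → ψ' x e) Rr * m ≤ bit (not (G e)) * (m + g₀ * Rr)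
        per-e e with not (G e)
        ... | false = ℕ.≤-reflexive (cong (ℕ._* m) (ΣL-0 Rr))
        ... | true = ℕ.≤-trans (cnt-spaced _ m g₀ Rr λ x x' lt a b → ND.∣⇒≤ {{ℕ.m*n≢0 g₀ _ {{ℕ.>-nonZero 0<g₀}} {{ℕ.>-nonZero (ℕ.m<n⇒0<n∸m lt)}}}}
                (sep e (pos x) (x' ∸ x) (does-true (m ∣? _) a) (subst (λ z → m ∣ e + ε z) (step x x' (ℕ.<⇒≤ lt)) (does-true (m ∣? _) b)))) (ℕ.≤-reflexive (sym (ℕ.+-identityʳ _)))
          where
          step : ∀ x x' → x ≤ x' → pos x' ≡ pos x ℤ.+ + (x' ∸ x)
          step x x' l = trans (cong (λ z → + z ℤ.- + R) (sym (ℕ.m+[n∸m]≡n l))) (trans (cong (λ z → z ℤ.- + R) (ℤ.pos-+ x (x' ∸ x))) (l1 (+ x) (+ (x' ∸ x)) (+ R)))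
            where
            l1 : ∀ x d R → x ℤ.+ d ℤ.- R ≡ x ℤ.- R ℤ.+ d
            l1 = ZS.solve-∀

      -- 1 for `m₂`, and 37 because Rr = 36 D K + 1 ≤ 37 D K.
      cap : m₂ + g₀ * Rr ≤ 38 * (g₀ * (D * K))
      cap = ℕ.≤-trans (ℕ.+-mono-≤ K-large′ (ℕ.*-monoʳ-≤ g₀ (ℕ.≤-trans (s≤s ℕ.≤-refl) (ℕ.+-monoˡ-≤ (2 * (18 * (D * K))) (ℕ.*-mono-≤ (ℕ.≤-trans (s≤s z≤n) 2≤D) (ℕ.>-nonZero⁻¹ K)))))) (ℕ.≤-reflexive (l g₀ (D * K)))
        where
        l : ∀ g z → g * z + g * (z + 2 * (18 * z)) ≡ 38 * (g * z)
        l = NS.solve-∀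

      -- Multiplied by `m₂`, the hits at m₁ Y cost an extra factor m₂ / m₁ < 2 ρ, those at m₂ Y a
      -- factor 1 ≤ ρ.
      m₂P : m₂ * Pf (2 * K) ≤ 3 * (ρ * (badcount * (38 * (g₀ * (D * K)))))
      m₂P = begin
        m₂ * Pf (2 * K) ≡⟨ cong (m₂ *_) (ΣL-+ (hc m₁) (hc m₂) T) ⟩
        m₂ * (S₁ + S₂) ≡⟨ ℕ.*-distribˡ-+ m₂ S₁ S₂ ⟩
        m₂ * S₁ + m₂ * S₂ ≤⟨ ℕ.+-mono-≤ (ℕ.≤-trans (2ρm S₁) (ℕ.*-monoʳ-≤ 2 (ℕ.*-monoʳ-≤ ρ b₁))) (ℕ.≤-trans b₂ (ℕ.m≤n*m _ ρ {{ℕ.>-nonZero 1≤ρ}})) ⟩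
        2 * (ρ * Z) + ρ * Z ≡⟨ l (ρ * Z) ⟩
        3 * (ρ * Z) ∎
        where
        open ℕ.≤-Reasoning
        S₁ = ΣL (hc m₁) T
        S₂ = ΣL (hc m₂) T
        Z = badcount * (38 * (g₀ * (D * K)))
        l : ∀ z → 2 * z + z ≡ 3 * z
        l = NS.solve-∀
        b₁ : m₁ * S₁ ≤ Z
        b₁ = ℕ.≤-trans (ℕ.≤-reflexive (ℕ.*-comm m₁ S₁)) (ℕ.≤-trans (hits m₁ sep₁ T₁) (ℕ.*-monoʳ-≤ badcount (ℕ.≤-trans (ℕ.+-monoˡ-≤ _ (ℕ.<⇒≤ m₁<m₂)) cap)))
        b₂ : m₂ * S₂ ≤ Z
        b₂ = ℕ.≤-trans (ℕ.≤-reflexive (ℕ.*-comm m₂ S₂)) (ℕ.≤-trans (hits m₂ sep₂ T₂) (ℕ.*-monoʳ-≤ badcount cap))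

    -- The zones from `K` to 2 K give hits of weight K · c₀ D K, of which rounding takes at most
    -- half by `K-large`; `m₂P` bounds them from above. The constant is 228 = 2 · 3 · 38.
    many-bad : c₀ * K ≤ 228 * (ρ * (g₀ * badcount))
    many-bad = ℕ.*-cancelʳ-≤ _ _ (D * K) {{ℕ.m*n≢0 D K}} (begin
      c₀ * K * (D * K) ≡⟨ l1 c₀ K (D * K) ⟩
      K * (c₀ * (D * K)) ≤⟨ half (K * (c₀ * (D * K))) (m₂ * Pf (2 * K)) (K * m₂)
          (ℕ.≤-trans (ℕ.m≤m+n _ (m₂ * Pf K)) (ℕ.≤-trans (total K ℕ.≤-refl) (ℕ.≤-reflexive (cong (λ z → m₂ * Pf z + K * m₂) (cong (K ℕ.+_) (sym (ℕ.+-identityʳ K)))))))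
          (ℕ.≤-trans (ℕ.≤-reflexive (l2 K m₂)) (ℕ.*-monoʳ-≤ K K-large)) ⟩
      2 * (m₂ * Pf (2 * K)) ≤⟨ ℕ.*-monoʳ-≤ 2 m₂P ⟩
      2 * (3 * (ρ * (badcount * (38 * (g₀ * (D * K)))))) ≡⟨ l3 ρ badcount g₀ (D * K) ⟩
      228 * (ρ * (g₀ * badcount)) * (D * K) ∎)
      where
      open ℕ.≤-Reasoning
      l1 : ∀ c K z → c * K * z ≡ K * (c * z)
      l1 = NS.solve-∀
      l2 : ∀ K m → 2 * (K * m) ≡ K * (2 * m)
      l2 = NS.solve-∀
      l3 : ∀ r b g z → 2 * (3 * (r * (b * (38 * (g * z))))) ≡ 228 * (r * (g * b)) * z
      l3 = NS.solve-∀
      half : ∀ x y z → x ≤ y + z → 2 * z ≤ x → x ≤ 2 * y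
      half x y z p r = ℕ.+-cancelʳ-≤ x _ _ (ℕ.≤-trans (ℕ.≤-reflexive (cong (x ℕ.+_) (sym (ℕ.+-identityʳ x)))) (ℕ.≤-trans (ℕ.*-monoʳ-≤ 2 p)
        (ℕ.≤-trans (ℕ.≤-reflexive (ℕ.*-distribˡ-+ 2 y z)) (ℕ.+-monoʳ-≤ (2 * y) r))))

cnt-filter : ∀ {P : ℕ → Set} (P? : ∀ n → Dec (P n)) n → length (List.filter P? (List.upTo n)) ≡ cnt (λ i → does (P? i)) n
cnt-filter P? zero = refl
cnt-filter P? (suc n) = trans (cong (λ l → length (List.filter P? l)) (sym (LP.upTo-∷ʳ n)))
  (trans (cong length (LP.filter-++ P? (List.upTo n) (n ∷ []))) (trans (LP.length-++ (List.filter P? (List.upTo n))) (cong₂ _+_ (cnt-filter P? n) (last n))))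
  where
  last : ∀ n → length (List.filter P? (n ∷ [])) ≡ bit (does (P? n))
  last n with does (P? n)
  ... | true = refl
  ... | false = refl

-- The exponents of h and smooth moduli

module Exponents (a β : ℕ) .{{nza : NonZero a}} where
  D c₀ : ℕ
  D = 12 * a
  c₀ = 2 * β

  εf : ℤ → ℕ
  εf y = 2 * β * jt (24 * a) (suc (12 * a)) (ℕ.pred (12 * a)) y

  ε⁺ : ∀ k → εf (+ k) ≡ c₀ * (D * (k * k) + k)
  ε⁺ k = cong (c₀ *_) (trans (l a (tri k) k) (cong (λ z → D * z + k) (sym (tri-sq k))))
    where
    l : ∀ a t k → 24 * a * t + suc (12 * a) * k ≡ 12 * a * (t + t + k) + k
    l = NS.solve-∀

  ε⁻ : ∀ k → εf -[1+ k ] ≡ c₀ * (D * (suc k * suc k) ∸ suc k)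
  ε⁻ k = cong (c₀ *_) (sym (trans (cong (_∸ suc k) eq) (ℕ.m+n∸n≡m (24 * a * tri (suc k) + ℕ.pred D * suc k) (suc k))))
    where
    instance
      nzD : NonZero (12 * a)
      nzD = ℕ.m*n≢0 12 a
    l1 : ∀ A t k → A * (t + t + k) ≡ 2 * A * t + A * k
    l1 = NS.solve-∀
    l2 : ∀ x p k → x + suc p * k ≡ x + p * k + k
    l2 = NS.solve-∀
    eq : D * (suc k * suc k) ≡ 24 * a * tri (suc k) + ℕ.pred D * suc k + suc k
    eq = trans (cong (D *_) (tri-sq (suc k))) (trans (l1 D (tri (suc k)) (suc k)) (trans (cong₂ (λ x y → x * tri (suc k) + y * suc k) (sym (ℕ.*-assoc 2 12 a)) (sym (ℕ.suc-pred D)))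
      (l2 (24 * a * tri (suc k)) (ℕ.pred D) (suc k))))

  ε-ℤ : ∀ y → + εf y ≡ + c₀ ℤ.* (y ℤ.* (+ D ℤ.* y ℤ.+ + 1))
  ε-ℤ (+ k) = trans (cong +_ (ε⁺ k)) (trans (ℤ.pos-* c₀ _) (cong (λ z → + c₀ ℤ.* z) (trans (ℤ.pos-+ (D * (k * k)) k)
    (trans (cong (λ z → z ℤ.+ + k) (trans (ℤ.pos-* D _) (cong (λ z → + D ℤ.* z) (ℤ.pos-* k k)))) (l (+ D) (+ k))))))
    where
    l : ∀ D k → D ℤ.* (k ℤ.* k) ℤ.+ k ≡ k ℤ.* (D ℤ.* k ℤ.+ + 1)
    l = ZS.solve-∀
  ε-ℤ -[1+ k ] = trans (cong +_ (ε⁻ k)) (trans (ℤ.pos-* c₀ _) (cong (λ z → + c₀ ℤ.* z) (trans (sym (trans (ℤ.m-n≡m⊖n (D * (suc k * suc k)) (suc k)) (ℤ.⊖-≥ le)))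
    (trans (cong (λ z → z ℤ.- + suc k) (trans (ℤ.pos-* D _) (cong (λ z → + D ℤ.* z) (ℤ.pos-* (suc k) (suc k))))) (l (+ D) (+ suc k))))))
    where
    l : ∀ D k → D ℤ.* (k ℤ.* k) ℤ.- k ≡ ℤ.- k ℤ.* (D ℤ.* ℤ.- k ℤ.+ + 1)
    l = ZS.solve-∀
    le : suc k ≤ D * (suc k * suc k)
    le = ℕ.≤-trans (ℕ.m≤m*n (suc k) (suc k)) (ℕ.m≤n*m _ D {{ℕ.m*n≢0 12 a}})

  -- ε (y + d) - ε y = c₀ d (1 + 6 z) and β / β₀ ≡ 1 mod 6, so a {2,3}-smooth modulus only sees the factor 2 β₀ d
  separation : ∀ β₀ w → β ≡ suc (6 * w) * β₀ → ∀ {m} → Smooth m → ∀ e y d → m ∣ e + εf y → m ∣ e + εf (y ℤ.+ + d) → m ∣ 2 * β₀ * d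
  separation β₀ w β≡ {m} sm e y d p q = Smooth-cancel sm w (2 * β₀ * d) (Smooth-cancel sm k _ (subst (m ∣_) rearr (∣-trans diff (ND.m∣m*n v))))
    where
    z : ℤ
    z = + 2 ℤ.* + a ℤ.* (y ℤ.+ y ℤ.+ + d)
    v : ℕ
    v = ∣ + 1 ℤ.+ + 6 ℤ.* z ∣
    delta : (+ e ℤ.+ + εf (y ℤ.+ + d)) ℤ.- (+ e ℤ.+ + εf y) ≡ + c₀ ℤ.* + d ℤ.* (+ 1 ℤ.+ + 6 ℤ.* z)
    delta = trans (cong₂ (λ s t → (+ e ℤ.+ s) ℤ.- (+ e ℤ.+ t)) (ε-ℤ (y ℤ.+ + d)) (ε-ℤ y))
      (trans (cong (λ D → (+ e ℤ.+ + c₀ ℤ.* ((y ℤ.+ + d) ℤ.* (D ℤ.* (y ℤ.+ + d) ℤ.+ + 1))) ℤ.- (+ e ℤ.+ + c₀ ℤ.* (y ℤ.* (D ℤ.* y ℤ.+ + 1)))) (ℤ.pos-* 12 a)) (l (+ e) (+ c₀) y (+ d) (+ a)))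
      where
      l : ∀ e c y d a → (e ℤ.+ c ℤ.* ((y ℤ.+ d) ℤ.* (+ 12 ℤ.* a ℤ.* (y ℤ.+ d) ℤ.+ + 1))) ℤ.- (e ℤ.+ c ℤ.* (y ℤ.* (+ 12 ℤ.* a ℤ.* y ℤ.+ + 1)))
        ≡ c ℤ.* d ℤ.* (+ 1 ℤ.+ + 6 ℤ.* (+ 2 ℤ.* a ℤ.* (y ℤ.+ y ℤ.+ d)))
      l = ZS.solve-∀
    diff : m ∣ c₀ * d * v
    diff = subst (m ∣_) (trans (cong ∣_∣ delta) (trans (ℤ.abs-* (+ c₀ ℤ.* + d) _) (cong (ℕ._* v) (ℤ.abs-* (+ c₀) (+ d)))))
      (ZDS.∣⇒∣ᵤ {+ m} (ZDS.∣m∣n⇒∣m-n (ZDS.∣ᵤ⇒∣ {+ m} {+ e ℤ.+ + εf (y ℤ.+ + d)} q) (ZDS.∣ᵤ⇒∣ {+ m} {+ e ℤ.+ + εf y} p)))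
    -- |1 + 6 z| is 5 modulo 6 for negative z, so the divisor is multiplied in twice: its square is
    -- 1 modulo 6, the form that `Smooth-cancel` accepts.
    square : ∀ z → ∃ λ k → ∣ + 1 ℤ.+ + 6 ℤ.* z ∣ * ∣ + 1 ℤ.+ + 6 ℤ.* z ∣ ≡ suc (6 * k)
    square (+ n) = 6 * (n * n) + 2 * n , trans (cong₂ (λ s t → ∣ + 1 ℤ.+ s ∣ * ∣ + 1 ℤ.+ t ∣) (sym (ℤ.pos-* 6 n)) (sym (ℤ.pos-* 6 n))) (l n)
      where
      l : ∀ n → suc (6 * n) * suc (6 * n) ≡ suc (6 * (6 * (n * n) + 2 * n))
      l = NS.solve-∀
    square -[1+ n ] = 6 * (n * n) + 10 * n + 4 , trans (cong₂ _*_ e5 e5) (l n)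
      where
      l : ∀ n → (6 * n + 5) * (6 * n + 5) ≡ suc (6 * (6 * (n * n) + 10 * n + 4))
      l = NS.solve-∀
      l1 : ∀ n → + 1 ℤ.+ + 6 ℤ.* ℤ.- (+ 1 ℤ.+ n) ≡ ℤ.- (+ 6 ℤ.* n ℤ.+ + 5)
      l1 = ZS.solve-∀
      e5 : ∣ + 1 ℤ.+ + 6 ℤ.* -[1+ n ] ∣ ≡ 6 * n + 5
      e5 = trans (cong ∣_∣ (l1 (+ n))) (trans (ℤ.∣-i∣≡∣i∣ (+ 6 ℤ.* + n ℤ.+ + 5)) (cong (λ s → ∣ s ℤ.+ + 5 ∣) (sym (ℤ.pos-* 6 n))))
    k = proj₁ (square z)
    rearr : c₀ * d * v * v ≡ suc (6 * k) * (suc (6 * w) * (2 * β₀ * d))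
    rearr = trans (ℕ.*-assoc (c₀ * d) v v) (trans (cong₂ (λ s t → 2 * s * d * t) β≡ (proj₂ (square z))) (l (suc (6 * w)) β₀ d (suc (6 * k))))
      where
      l : ∀ s b d t → 2 * (s * b) * d * t ≡ t * (s * (2 * b * d))
      l = NS.solve-∀

-- Choice of the parameters and conclusion

module Final (u : ℕ) (α r : Fin u → ℕ) (t : ℕ) (γ s : Fin t → ℕ) (hα : ∀ i → 1 ≤ α i) (hγ : ∀ i → 1 ≤ γ i)
             (a : ℕ) .{{nza : NonZero a}} (b : ℤ) (M : ℕ) where

  private
    Sα = ΣN u (λ i → α i * r i)
    Sγ = ΣN t (λ i → γ i * s i)

    -- A representative of -b modulo `a`, large enough to make `β₀` positive.
    b₀ : ℕ
    b₀ = (ℤ.- b) %ℕ a + a * suc Sα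

    Sα<b₀ : Sα < 24 * b₀
    Sα<b₀ = ℕ.≤-trans (ℕ.≤-trans (ℕ.m≤n*m (suc Sα) a) (ℕ.m≤n+m _ ((ℤ.- b) %ℕ a))) (ℕ.m≤n*m b₀ 24)

    β₀ : ℕ
    β₀ = 24 * b₀ + Sγ ∸ Sα

    β₀+ : β₀ + Sα ≡ 24 * b₀ + Sγ
    β₀+ = ℕ.m∸n+n≡m (ℕ.≤-trans (ℕ.<⇒≤ Sα<b₀) (ℕ.m≤m+n _ Sγ))

    instance
      nzβ₀ : NonZero β₀
      nzβ₀ = ℕ.>-nonZero (ℕ.m<n⇒0<n∸m (ℕ.<-≤-trans Sα<b₀ (ℕ.m≤m+n _ Sγ)))

    -- ρ = (4 D)²; and w makes 4 Z² M² Q = w c₀ below, where w ≤ c₀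
    D g₀ ρ Z w β b' c₀ : ℕ
    D = 12 * a
    g₀ = 2 * β₀
    ρ = 16 * (D * D)
    Z = 456 * (ρ * g₀)
    w = 40 * (Z * Z * (M * M) * (a * (ρ * D)))
    β = suc (6 * (4 * (a * w))) * β₀
    b' = b₀ + a * (β₀ * w)
    c₀ = 2 * β

    instance
      nzβ : NonZero β
      nzβ = ℕ.m*n≢0 (suc (6 * (4 * (a * w)))) β₀
      nzD : NonZero D
      nzD = ℕ.m*n≢0 12 a
      nzg : NonZero g₀
      nzg = ℕ.m*n≢0 2 β₀
      nzρ : NonZero ρ
      nzρ = ℕ.m*n≢0 16 (D * D) {{_}} {{ℕ.m*n≢0 D D}}
      nzZ : NonZero Z
      nzZ = ℕ.m*n≢0 456 (ρ * g₀) {{_}} {{ℕ.m*n≢0 ρ g₀}}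
      nzc : NonZero c₀
      nzc = ℕ.m*n≢0 2 β

    -- Raising b₀ by a β₀ w raises β₀ by 24 a w β₀: `b'` keeps its class modulo `a`, and β stays a
    -- multiple of `β₀`, with quotient 1 modulo 6.
    center : β + Sα ≡ 24 * b' + Sγ
    center = trans (l1 (a * w) β₀ Sα) (trans (cong (24 * (a * w * β₀) ℕ.+_) β₀+) (l2 a w β₀ b₀ Sγ))
      where
      l1 : ∀ z β S → suc (6 * (4 * z)) * β + S ≡ 24 * (z * β) + (β + S)
      l1 = NS.solve-∀
      l2 : ∀ a w β b S → 24 * (a * w * β) + (24 * b + S) ≡ 24 * (b + a * (β * w)) + S
      l2 = NS.solve-∀

    -- the progression n ≡ b is n = a Y - b'
    b+b' : ∃ λ q → + b' ℤ.+ b ≡ + a ℤ.* q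
    b+b' = + suc Sα ℤ.+ + (β₀ * w) ℤ.- (ℤ.- b) /ℕ a , trans (cong (λ z → z ℤ.+ b) (trans (ℤ.pos-+ b₀ _) (cong₂ ℤ._+_ (trans (ℤ.pos-+ r₀ _) (cong₂ ℤ._+_ mod (ℤ.pos-* a (suc Sα)))) (ℤ.pos-* a (β₀ * w)))))
      (l b ((ℤ.- b) /ℕ a) (+ a) (+ suc Sα) (+ (β₀ * w)))
      where
      r₀ = (ℤ.- b) %ℕ a
      l0 : ∀ r q → r ≡ r ℤ.+ q ℤ.- q
      l0 = ZS.solve-∀
      mod : + r₀ ≡ ℤ.- b ℤ.- (ℤ.- b) /ℕ a ℤ.* + a
      mod = trans (l0 (+ r₀) ((ℤ.- b) /ℕ a ℤ.* + a)) (cong (λ z → z ℤ.- (ℤ.- b) /ℕ a ℤ.* + a) (sym (a≡a%ℕn+[a/ℕn]*n (ℤ.- b) a)))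
      l : ∀ b q a S x → ℤ.- b ℤ.- q ℤ.* a ℤ.+ a ℤ.* S ℤ.+ a ℤ.* x ℤ.+ b ≡ a ℤ.* (S ℤ.+ x ℤ.- q)
      l = ZS.solve-∀

    module A = Assembly u α r t γ s hα hγ a b' β center
    module Ex = Exponents a β

    12≤D : 12 ≤ D
    12≤D = ℕ.m≤m*n 12 a

    module C = Count D c₀ g₀ 12≤D (ℕ.>-nonZero⁻¹ c₀) (ℕ.>-nonZero⁻¹ g₀) A.ε Ex.ε⁺ Ex.ε⁻ A.ε-big A.G

    eta : D.Series
    eta = D.etaQuotient u α r t γ s

    P? : ∀ n → Dec ((a ∣ (∣ + n ℤ.- b ∣)) × (2 ∣ (∣ eta n ∣)))
    P? n = (a ∣? ∣ + n ℤ.- b ∣) ×-dec (2 ∣? ∣ eta n ∣)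

    bad⇒even : ∀ Y → not (A.G Y) ≡ true → b' ≤ a * Y → does (P? (a * Y ∸ b')) ≡ true
    bad⇒even Y bad le = cong₂ _∧_ (dec-true (a ∣? _) class) (trans (even-dec ∣ eta n ∣) (trans (cong not (trans (sym (red₂-at eta n)) (sym value))) bad))
      where
      n = a * Y ∸ b'
      value : A.G Y ≡ red₂ eta n
      value = trans (at (R.*-comm _ (mono b')) (a * Y)) (trans (cong (mono b' ⊗ red₂ eta) (sym (ℕ.m+[n∸m]≡n le))) (mono-⊗-hi b' (red₂ eta) n))
      q = proj₁ b+b'
      class : a ∣ ∣ + n ℤ.- b ∣
      class = ZDS.∣⇒∣ᵤ {+ a} (ZDS.divides (+ Y ℤ.- q) (trans (cong (λ z → z ℤ.- b) (trans (sym (ℤ.⊖-≥ le)) (sym (ℤ.m-n≡m⊖n (a * Y) b')))) (trans (l1 (+ (a * Y)) (+ b') b)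
        (trans (cong₂ ℤ._-_ (ℤ.pos-* a Y) (proj₂ b+b')) (l2 (+ a) (+ Y) q)))))
        where
        l1 : ∀ x y b → x ℤ.- y ℤ.- b ≡ x ℤ.- (y ℤ.+ b)
        l1 = ZS.solve-∀
        l2 : ∀ a Y q → a ℤ.* Y ℤ.- a ℤ.* q ≡ (Y ℤ.- q) ℤ.* a
        l2 = ZS.solve-∀

    1<ρ : 1 < ρ
    1<ρ = ℕ.≤-trans (ℕ.m≤m+n 2 14) (ℕ.m≤m*n 16 (D * D) {{ℕ.m*n≢0 D D}})

    -- Chosen such that a X = K² Q for the range `X` of the count, so `K` is about √(N / Q).
    Q : ℕ
    Q = a * (10 * (ρ * (c₀ * D)))

    instance
      nzQ : NonZero Q
      nzQ = ℕ.m*n≢0 a _ {{nza}} {{ℕ.m*n≢0 10 _ {{_}} {{ℕ.m*n≢0 ρ _ {{nzρ}} {{ℕ.m*n≢0 c₀ D}}}}}}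

    w≤c₀ : w ≤ c₀
    w≤c₀ = ℕ.≤-trans (ℕ.≤-trans (ℕ.≤-trans (ℕ.≤-trans (ℕ.m≤n*m w a) (ℕ.m≤n*m _ 4)) (ℕ.≤-trans (ℕ.m≤n*m _ 6) (ℕ.n≤1+n _))) (ℕ.m≤m*n _ β₀)) (ℕ.m≤n*m β 2)

    count : ℕ → ℕ
    count N = length (List.filter P? (List.upTo (suc N)))

    module _ (m₁ m₂ : ℕ) (s₁ : Smooth m₁) (s₂ : Smooth m₂) (lo : ρ * m₁ ≤ m₂) (hi : m₂ < 2 * (ρ * m₁)) (per : U m₁ (A.G ⊗ A.h) ≈ U m₂ (A.G ⊗ A.h)) where

      -- 2 m₂ serves the size conditions of the count, Z b' the indices below `b'`, which correspond
      -- to no coefficient of `F`.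
      K₀ : ℕ
      K₀ = suc (2 * m₂ + Z * b')

      module _ (N K : ℕ) (K₀≤K : K₀ ≤ K) (loN : K * K * Q ≤ N) (hiN : N < suc K * suc K * Q) where

        instance
          nzK : NonZero K
          nzK = ℕ.>-nonZero (ℕ.≤-trans (s≤s z≤n) K₀≤K)
          nz₁ : NonZero m₁
          nz₁ = ℕ.>-nonZero (Smooth>0 s₁)
          nz₂ : NonZero m₂
          nz₂ = ℕ.>-nonZero (Smooth>0 s₂)

        2m≤K : 2 * m₂ ≤ K
        2m≤K = ℕ.≤-trans (ℕ.≤-trans (ℕ.m≤m+n _ (Z * b')) (ℕ.n≤1+n _)) K₀≤K

        Zb≤K : Z * b' ≤ K
        Zb≤K = ℕ.≤-trans (ℕ.≤-trans (ℕ.m≤n+m _ (2 * m₂)) (ℕ.n≤1+n _)) K₀≤K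

        large : 2 * m₂ ≤ c₀ * (D * K)
        large = ℕ.≤-trans 2m≤K (ℕ.≤-trans (ℕ.m≤n*m K D) (ℕ.m≤n*m _ c₀))

        large′ : m₂ ≤ g₀ * (D * K)
        large′ = ℕ.≤-trans (ℕ.≤-trans (ℕ.m≤n*m m₂ 2) 2m≤K) (ℕ.≤-trans (ℕ.m≤n*m K D) (ℕ.m≤n*m _ g₀))

        sep : ∀ {m} → Smooth m → ∀ e y d → m ∣ e + A.ε y → m ∣ e + A.ε (y ℤ.+ + d) → m ∣ g₀ * d
        sep = Ex.separation β₀ (4 * (a * w)) refl

        badN : ℕ
        badN = C.badcount m₁ m₂ (sep s₁) (sep s₂) lo hi per K large large′

        bound : c₀ * K ≤ 228 * (ρ * (g₀ * badN))
        bound = C.many-bad m₁ m₂ (sep s₁) (sep s₂) lo hi per K large large′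

        X : ℕ
        X = 10 * (ρ * (c₀ * (D * (K * K))))

        aX : a * X ≤ N
        aX = ℕ.≤-trans (ℕ.≤-reflexive (l a ρ c₀ D K)) loN
          where
          l : ∀ a r c D K → a * (10 * (r * (c * (D * (K * K))))) ≡ K * K * (a * (10 * (r * (c * D))))
          l = NS.solve-∀

        badN≤ : badN ≤ b' + count N
        badN≤ = ℕ.≤-trans (cnt-progression′ a b' _ (λ n → does (P? n)) X bad⇒even)
          (ℕ.+-monoʳ-≤ b' (ℕ.≤-trans (ΣL-mono _ (ℕ.≤-trans (ℕ.m∸n≤m _ b') (ℕ.≤-trans aX (ℕ.n≤1+n N)))) (ℕ.≤-reflexive (sym (cnt-filter P? (suc N))))))

        -- 456 is twice 228: of the two copies of c₀ K, one absorbs Z b'.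
        cK : c₀ * K ≤ Z * count N
        cK = ℕ.+-cancelˡ-≤ (c₀ * K) _ _ (begin
          c₀ * K + c₀ * K ≤⟨ ℕ.+-mono-≤ bound′ bound′ ⟩
          228 * (ρ * (g₀ * (b' + count N))) + 228 * (ρ * (g₀ * (b' + count N))) ≡⟨ l ρ g₀ b' (count N) ⟩
          Z * b' + Z * count N ≤⟨ ℕ.+-monoˡ-≤ _ (ℕ.≤-trans Zb≤K (ℕ.m≤n*m K c₀)) ⟩
          c₀ * K + Z * count N ∎)
          where
          open ℕ.≤-Reasoning
          bound′ : c₀ * K ≤ 228 * (ρ * (g₀ * (b' + count N)))
          bound′ = ℕ.≤-trans bound (ℕ.*-monoʳ-≤ 228 (ℕ.*-monoʳ-≤ ρ (ℕ.*-monoʳ-≤ g₀ badN≤)))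
          l : ∀ r g b c → 228 * (r * (g * (b + c))) + 228 * (r * (g * (b + c))) ≡ 456 * (r * g) * b + 456 * (r * g) * c
          l = NS.solve-∀

        conclusion : M * M * N ≤ count N * count N
        conclusion = ℕ.*-cancelˡ-≤ (Z * Z) {{ℕ.m*n≢0 Z Z}} (begin
          Z * Z * (M * M * N) ≤⟨ ℕ.*-monoʳ-≤ (Z * Z) (ℕ.*-monoʳ-≤ (M * M) (ℕ.≤-trans (ℕ.<⇒≤ hiN) (ℕ.*-monoˡ-≤ Q (ℕ.*-mono-≤ sK sK)))) ⟩
          Z * Z * (M * M * (2 * K * (2 * K) * Q)) ≡⟨ l1 (Z * Z) (M * M) K a ρ c₀ D ⟩
          -- `c₀` grows with `w` while `Z` does not depend on it, which is why every `M` can be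
          -- reached.
          w * (c₀ * (K * K)) ≤⟨ ℕ.*-monoˡ-≤ _ w≤c₀ ⟩
          c₀ * (c₀ * (K * K)) ≡⟨ l2 c₀ K ⟩
          c₀ * K * (c₀ * K) ≤⟨ ℕ.*-mono-≤ cK cK ⟩
          Z * count N * (Z * count N) ≡⟨ l3 Z (count N) ⟩
          Z * Z * (count N * count N) ∎)
          where
          open ℕ.≤-Reasoning
          sK : suc K ≤ 2 * K
          sK = ℕ.≤-trans (ℕ.+-monoˡ-≤ K (ℕ.>-nonZero⁻¹ K)) (ℕ.≤-reflexive (cong (K ℕ.+_) (sym (ℕ.+-identityʳ K))))
          l1 : ∀ z m K a r c D → z * (m * (2 * K * (2 * K) * (a * (10 * (r * (c * D)))))) ≡ 40 * (z * m * (a * (r * D))) * (c * (K * K))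
          l1 = NS.solve-∀
          l2 : ∀ c K → c * (c * (K * K)) ≡ c * K * (c * K)
          l2 = NS.solve-∀
          l3 : ∀ z c → z * c * (z * c) ≡ z * z * (c * c)
          l3 = NS.solve-∀

      -- `K` is the integer part of √(N / Q), and the bound on `N` makes it at least `K₀`.
      finish : ∃ λ X → ∀ N → X ≤ N → M * M * N ≤ count N * count N
      finish = suc K₀ * suc K₀ * Q , λ N le → at-scale N le (least (λ j → N < j * j * Q) (λ j → N ℕ.<? j * j * Q) (λ ()) (suc N)
          (ℕ.≤-trans (ℕ.m≤m*n (suc N) (suc N)) (ℕ.m≤m*n _ Q)))
        where
        at-scale : ∀ N → suc K₀ * suc K₀ * Q ≤ N → (∃ λ K → ¬ N < K * K * Q × N < suc K * suc K * Q) → M * M * N ≤ count N * count N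
        at-scale N le (K , p , q) = conclusion N K (ℕ.≮⇒≥ λ lt → ℕ.<⇒≱ q (ℕ.≤-trans (ℕ.*-monoˡ-≤ Q (ℕ.*-mono-≤ (ℕ.m≤n⇒m≤1+n lt) (ℕ.m≤n⇒m≤1+n lt))) le)) (ℕ.≮⇒≥ p) q

  -- The limit with the square root cleared: count / √N ≥ M for all large `N`.
  many-even : ∃ λ X → ∀ N → X ≤ N → M * M * N ≤ D.countEven eta (+ a) b N * D.countEven eta (+ a) b N
  many-even = use (A.theta-recurrence ρ 1<ρ)
    where
    use : (∃ λ m₁ → ∃ λ m₂ → Smooth m₁ × Smooth m₂ × ρ * m₁ ≤ m₂ × m₂ < 2 * (ρ * m₁) × U m₁ (A.G ⊗ A.h) ≈ U m₂ (A.G ⊗ A.h)) → _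
    use (m₁ , m₂ , s₁ , s₂ , lo , hi , per) = finish m₁ m₂ s₁ s₂ lo hi per

theorem2 : (u : ℕ) (α r : Fin u → ℕ) (t : ℕ) (γ s : Fin t → ℕ)
    → Injective _≡_ _≡_ α → Injective _≡_ _≡_ γ
    → (∀ i → 1 ≤ α i) → (∀ i → 1 ≤ r i)
    → (∀ i → 1 ≤ γ i) → (∀ i → 1 ≤ s i)
    → (a b : ℤ) → + 1 ≤ℤ a
    → ∀ (M : ℕ) → ∃ λ (X : ℕ) → ∀ (N : ℕ) → X ≤ N
    → M * M * N ≤ countEven (etaQuotient u α r t γ s) a b N * countEven (etaQuotient u α r t γ s) a b N
theorem2 u α r t γ s _ _ hα _ hγ _ (+ suc n) b _ M = Final.many-even u α r t γ s hα hγ (suc n) b M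
theorem2 u α r t γ s _ _ hα _ hγ _ (+ zero) b (ℤ.+≤+ ()) M
theorem2 u α r t γ s _ _ hα _ hγ _ -[1+ n ] b () M
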